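{- Let $\pi=(d_0,\dots,d_{n-1})$ be a tree degree sequence, let $\mathcal{T}_\pi$ be the set of all trees with degree sequence $\pi$, and let $T_\pi^*$ be the greedy tree with degree sequence $\pi$. Then for every $T\in\mathcal{T}_\pi$ and every integer $k\ge 0$, $$C(k;T)\lhd_w C(k;T_\pi^*).$$ In other words, for each $r=0,\dots,n-1$, $$\max_{T\in\mathcal{T}_\pi}\ \max_{U\subseteq V(T),\,|U|=r}\ \sum_{v\in U}C_v(k;T)=\sum_{v\in U^*}C_v(k;T_\pi^*),$$ where $U^*$ is the set of the first $r$ vertices of $T_\pi^*$ in a BFS-ordering.
   Context: Graphs are finite and simple. For a vertex $v$ of a graph $G$ and an integer $k\ge 0$, $C_v(k;G)$ is the number of closed walks of length $k$ in $G$ starting at $v$, i.e. sequences $w_1,\dots,w_{k+1}$ of vertices with consecutive ones adjacent and $w_1=w_{k+1}=v$; $C(k;G)=(C_v(k;G))_{v\in V(G)}$. A tree degree sequence is a nonincreasing sequence of nonnegative integers that is the degree sequence of some tree. Weak majorization: for nonnegative sequences $\alpha=(x_0,\dots,x_{n-1})$, $\beta=(y_0,\dots,y_{n-1})$ of the same length with nonincreasing rearrangements $x_{[0]}\ge\dots\ge x_{[n-1]}$ and $y_{[0]}\ge\dots\ge y_{[n-1]}$, write $\alpha\lhd_w\beta$ if $\sum_{i=0}^t x_{[i]}\le\sum_{i=0}^t y_{[i]}$ for all $t=0,\dots,n-1$. Greedy tree: in a rooted tree, the height (level) $h(v)$ of a vertex is its distance to the root, and $f(v)$ denotes the father of a non-root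 vertex $v$. A BFS-ordering is a total ordering $\prec$ of the vertices such that vertices of smaller level come before vertices of larger level and, for all $u\prec v$ in the same level: (1) $d(u)\ge d(v)$; (2) if $u,v$ are not roots, then $f(u)=f(v)$ or $f(u)\prec f(v)$. A greedy tree is a rooted tree (one root) admitting a BFS-ordering and such that every degree of a vertex at level $i$ is at least every degree of a vertex at level $i+1$, for all $i$. For each tree degree sequence $\pi$ there is exactly one (up to isomorphism) greedy tree with degree sequence $\pi$, denoted $T_\pi^*$. -}

module Defs where

open import Data.Bool.Base using (Bool; T)
open import Data.Bool.Properties using (T?)
open import Data.Fin.Base using (Fin; toℕ)
open import Data.Fin.Properties using (_≟_)
open import Data.Fin.Subset using (Subset; ∣_∣)
open import Data.Fin.Subset.Properties using (_∈?_)
open import Data.List.Base as List using (List; allFin; cartesianProductWith; filter)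
open import Data.List.Relation.Binary.Permutation.Propositional using (_↭_)
open import Data.Nat.Base using (ℕ; zero; suc; _+_; _≤_; _<_; _≥_; NonZero)
open import Data.Nat.ListAction using (sum)
open import Data.Nat.Properties using (≤-decTotalOrder; _<?_)
open import Data.Product.Base using (∃; ∃₂; _×_)
open import Data.Sum.Base using (_⊎_)
open import Data.Vec.Base using (Vec; []; _∷_; head; last; tabulate; toList)
open import Data.Vec.Relation.Unary.Linked using (Linked; linked?)
open import Data.Vec.Relation.Unary.Unique.Propositional using (Unique)
open import Level using (Level) renaming (zero to 0ℓ)
open import Relation.Binary.Core using (Rel)
open import Relation.Binary.Definitions using (Decidable; Irreflexive; Symmetric)
open import Relation.Binary.Properties.DecTotalOrder ≤-decTotalOrder using (≥-decTotalOrder)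
open import Relation.Binary.PropositionalEquality.Core using (_≡_)
open import Relation.Binary.Structures using (IsStrictTotalOrder)
open import Relation.Nullary.Decidable using (Dec; does; _×-dec_)
open import Relation.Nullary.Negation using (¬_)
open import Relation.Unary using (Pred)

import Data.List.Sort ≥-decTotalOrder as Nonincreasing

record Graph (n : ℕ) : Set where
  field
    edge : Fin n → Fin n → Bool

  infix 4 _~_ _~?_

  _~_ : Rel (Fin n) 0ℓ
  u ~ v = T (edge u v)

  field
    ~-sym    : Symmetric _~_
    ~-irrefl : Irreflexive _≡_ _~_

  _~?_ : Decidable _~_
  u ~? v = T? (edge u v)

  deg : Fin n → ℕ
  deg v = ∣ tabulate (edge v) ∣

  degrees : Vec ℕ n
  degrees = tabulate deg

  -- A walk of length k has k + 1 vertices.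

  IsWalk : Fin n → Fin n → ∀ {k} → Vec (Fin n) (suc k) → Set
  IsWalk u v w = head w ≡ u × last w ≡ v × Linked _~_ w

  isWalk? : ∀ u v {k} (w : Vec (Fin n) (suc k)) → Dec (IsWalk u v w)
  isWalk? u v w = (head w ≟ u) ×-dec (last w ≟ v) ×-dec linked? _~?_ w

  Connected : Set
  Connected = ∀ u v → ∃₂ λ k (w : Vec (Fin n) (suc k)) → IsWalk u v w

  -- At least three vertices, pairwise distinct, cyclically adjacent.

  IsCycle : ∀ {m} → Vec (Fin n) (3 + m) → Set
  IsCycle c = Unique c × Linked _~_ c × last c ~ head c

  Acyclic : Set
  Acyclic = ∀ {m} (c : Vec (Fin n) (3 + m)) → ¬ IsCycle c

  IsDistance : Fin n → Fin n → ℕ → Set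
  IsDistance u v d =
      (∃ λ (w : Vec (Fin n) (suc d)) → IsWalk u v w)
    × (∀ {k} (w : Vec (Fin n) (suc k)) → IsWalk u v w → d ≤ k)

record IsTree {n} (G : Graph n) : Set where
  open Graph G
  field
    nonempty  : NonZero n
    connected : Connected
    acyclic   : Acyclic

-- Every vector occurs exactly once.

vectors : ∀ n k → List (Vec (Fin n) k)
vectors n zero    = List.[ [] ]
vectors n (suc k) = cartesianProductWith _∷_ (allFin n) (vectors n k)

closedWalks : ∀ {n} → ℕ → Graph n → Fin n → ℕ
closedWalks {n} k G v = List.length (filter (isWalk? v v) (vectors n (suc k)))
  where open Graph G

C : ∀ {n} → ℕ → Graph n → Vec ℕ n
C k G = tabulate (closedWalks k G)

-- Used only for nonincreasing π, where ↭ says that the nonincreasing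
-- rearrangement of the degrees is π.

infix 4 _∈𝒯_

_∈𝒯_ : ∀ {n} → Graph n → Vec ℕ n → Set
G ∈𝒯 π = IsTree G × toList (Graph.degrees G) ↭ toList π

IsTreeDegreeSequence : ∀ {n} → Vec ℕ n → Set
IsTreeDegreeSequence π = Linked _≥_ π × ∃ λ G → G ∈𝒯 π

largest-sum : ∀ {n} → ℕ → Vec ℕ n → ℕ
largest-sum m α = sum (List.take m (Nonincreasing.sort (toList α)))

infix 4 _◁w_

_◁w_ : ∀ {n} → Vec ℕ n → Vec ℕ n → Set
_◁w_ {n} α β = ∀ (t : Fin n) →
  largest-sum (suc (toℕ t)) α ≤ largest-sum (suc (toℕ t)) β

module Rooted {n} (G : Graph n) (root : Fin n) where
  open Graph G

  Height : Fin n → ℕ → Set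
  Height = IsDistance root

  -- p is the father of v; this forces v to differ from the root.

  Father : Fin n → Fin n → Set
  Father v p = p ~ v × ∃ λ i → Height p i × Height v (suc i)

  record IsBFSOrdering (_≺_ : Rel (Fin n) 0ℓ) : Set where
    field
      isStrictTotalOrder : IsStrictTotalOrder _≡_ _≺_
      level-mono   : ∀ {u v i j} → Height u i → Height v j → i < j → u ≺ v
      deg-anti     : ∀ {u v i} → Height u i → Height v i → u ≺ v →
                     deg u ≥ deg v
      father-mono  : ∀ {u v i p q} → Height u i → Height v i → u ≺ v →
                     Father u p → Father v q → p ≡ q ⊎ p ≺ q

    open IsStrictTotalOrder isStrictTotalOrder public
      using () renaming (_<?_ to _≺?_)

    -- v is among the first r vertices iff fewer than r vertices precede it.

    first : ℕ → Subset n
    first r = tabulate λ v →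
      does (List.length (filter (_≺? v) (allFin n)) <? r)

  record IsGreedyTree : Set₁ where
    field
      isTree         : IsTree G
      bfsOrdering    : ∃ IsBFSOrdering
      level-deg-anti : ∀ {u v i} → Height u i → Height v (suc i) →
                       deg u ≥ deg v

open Rooted public using (IsBFSOrdering; IsGreedyTree)

sumOver : ∀ {n} → Subset n → (Fin n → ℕ) → ℕ
sumOver {n} U f = sum (List.map f (filter (_∈? U) (allFin n)))

IsMaximum : ∀ {ℓ : Level} → Pred ℕ ℓ → ℕ → Set ℓ
IsMaximum P m = P m × (∀ x → P x → x ≤ m)

IsMaxSum : ∀ {n} → ℕ → (Fin n → ℕ) → ℕ → Set
IsMaxSum {n} r f = IsMaximum λ s →
  ∃ λ (U : Subset n) → ∣ U ∣ ≡ r × sumOver U f ≡ s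

{-# OPTIONS --safe #-}
-- In a rooted tree let D count the closed walks below a vertex and W all closed
-- walks at it.  With S the sum of D over the children, D = 1 + x² S D, and
-- W = 1 + x² (S W + D W′) for a child of a vertex with series W′.  Comonotone sums,
-- products, sums over children and pullbacks to children preserve weak
-- majorization, so sorting the outdegrees of every level, and attaching children
-- to parents in that order, can only increase the closed walk counts of each level
-- in this sense.  The same holds for a tree rooted at an edge.
--
-- Root a tree at a vertex of maximal degree, sort its levels, then sort its levels
-- with respect to the edge from the root to the first child.  Let A be the branch
-- at that child and B the rest.  The second step lowers the sum of all depths
-- unless it preserves the size of A; in that case the outdegrees on every level of
-- B were already at least those on the same level of A, hence the outdegrees in
-- breadth-first order are nonincreasing and the tree is the greedy one.  The same
-- two views of the greedy tree show that its closed walk counts are nonincreasing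
-- in breadth-first order.

module Submission where

open import Defs
open import Level using () renaming (zero to 0ℓ)
open import Data.Bool.Base using (Bool; true; false; if_then_else_)
open import Data.Empty using (⊥-elim)
open import Data.Fin.Base using (Fin; zero; suc; toℕ)
open import Data.Fin.Properties using (any?; toℕ<n) renaming (_≟_ to _≟ᶠ_)
open import Data.Fin.Subset using (Subset; ∣_∣) renaming (_∈_ to _∈ₛ_)
open import Data.Fin.Subset.Properties using (_∈?_)
open import Data.List.Base as List using
  (List; []; _∷_; _++_; map; concatMap; take; drop; length; filter; allFin; [_])
open import Data.List.Membership.Propositional using (_∈_; lose)
open import Data.List.Membership.Propositional.Properties using
  (∈-∃++; ∈-concatMap⁺; ∈-filter⁺; ∈-allFin; ∈-++⁺ˡ; ∈-++⁺ʳ; ∈-map⁺; ∈-map⁻)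
open import Data.List.Membership.Propositional.Properties.WithK using (unique∧set⇒bag)
open import Data.List.Properties using
  ( map-++; map-∘; map-id; map-cong; map-cong-local; map-tabulate; length-map; length-++
  ; length-++-≤ˡ; length-++-≤ʳ; length-take; length-drop; length-tabulate; take-map; take-take
  ; take++drop≡id; concatMap-++; concatMap-map; ++-assoc; ++-identityʳ; ++-conicalˡ; ++-conicalʳ
  ; ∷-injective; filter-++; filter-all; filter-none)
open import Data.List.Relation.Binary.BagAndSetEquality using (∼bag⇒↭)
open import Data.List.Relation.Binary.Permutation.Propositional as Perm using
  (_↭_; ↭-refl; ↭-sym; ↭-trans; ↭-reflexive; prep; ↭⇒↭ₛ)
import Data.List.Relation.Binary.Permutation.Propositional.Properties as Perm
import Data.List.Relation.Binary.Permutation.Setoid.Properties as PermSetoid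
open import Data.List.Relation.Binary.Pointwise as PW using (Pointwise-≡⇒≡; Pointwise; []; _∷_)
open import Data.List.Relation.Unary.All as All using (All; []; _∷_)
import Data.List.Relation.Unary.All.Properties as All
open import Data.List.Relation.Unary.AllPairs as AllPairs using (AllPairs; []; _∷_)
import Data.List.Relation.Unary.AllPairs.Properties as AllPairs
open import Data.List.Relation.Unary.Any using (here)
open import Data.List.Relation.Unary.Sorted.TotalOrder.Properties using
  (AllPairs⇒Sorted; Sorted⇒AllPairs; ↗↭↗⇒≋)
open import Data.List.Relation.Unary.Unique.Propositional.Properties using (allFin⁺)
import Data.List.Sort as ListSort
open import Data.Nat.Base hiding (compare)
open import Data.Nat.ListAction using (sum)
open import Data.Nat.ListAction.Properties using (sum-++; sum-↭)
open import Data.Nat.Properties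
open import Data.Nat.Tactic.RingSolver using (solve-∀)
open import Data.Product.Base using (∃; ∃₂; _×_; _,_; proj₁; proj₂; -,_)
open import Data.Sum.Base using (_⊎_; inj₁; inj₂)
open import Data.Unit.Base using (⊤; tt)
open import Data.Vec.Base as Vec using (Vec; []; _∷_)
open import Data.Vec.Properties using (lookup∘tabulate; lookup⇒[]=; []=⇒lookup)
open import Data.Vec.Relation.Unary.All as VecAll using ()
open import Data.Vec.Relation.Unary.AllPairs as VecAllPairs using ()
open import Data.Vec.Relation.Unary.Linked as Linked using (Linked; linked?; [-]; []; _∷_)
import Data.Vec.Relation.Unary.Unique.Propositional as VecUnique
open import Function.Base using (_∘_; id; const; _$_; case_of_)
open import Function.Bundles using (mk⇔)
open import Relation.Binary.Bundles using (DecTotalOrder)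
open import Relation.Binary.Core using (Rel)
open import Relation.Binary.Definitions using (tri<; tri≈; tri>)
open import Relation.Binary.PropositionalEquality using
  (_≡_; _≢_; _≗_; refl; sym; trans; cong; cong₂; subst; subst₂; setoid; module ≡-Reasoning)
open import Relation.Binary.Structures using (IsStrictTotalOrder)
import Relation.Binary.Construct.On as On
import Relation.Binary.Properties.StrictTotalOrder as StrictTotalOrderProperties
open import Algebra.Properties.CommutativeSemigroup +-commutativeSemigroup using (interchange)
open import Relation.Binary.Properties.DecTotalOrder ≤-decTotalOrder using (≥-decTotalOrder)
open import Relation.Binary.Construct.Closure.ReflexiveTransitive using (Star; ε; _◅_; _◅◅_)
  renaming (reverse to Star-reverse)
open import Relation.Nullary using (¬_; Dec; yes; no)
open import Relation.Nullary.Decidable using (does; _×-dec_; map′; dec-true; dec-false)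

-- Formal power series with natural coefficients.

-- Sorting compares only vertices of a common level, and a single root never puts two depths on one
-- level; this is why a second view is required. Write A_0, A_1, ... and B_0, B_1, ... for the
-- levels of the two sides of the edge. From the edge, A_i and B_i form one level; from the root,
-- A_i and B_(i+1) do. Any two neighbours in the chain B_0, A_0, B_1, A_1, ... therefore share a
-- level in one of the views, and sortedness in both views is sortedness of the whole breadth-first
-- sequence.
--
-- Maximality of the root survives cutting the edge: its outdegree drops by one and is still at
-- least that of A, so sorting from the edge does not exchange the ends. That sort preserves the sum
-- of the distances to the nearer end, and the depth sum at the root exceeds this sum by the size of
-- A. As the largest outdegrees of each level move to the side of the root, A cannot grow, so the
-- depth sum can serve as the measure of termination.

Series : Set
Series = ℕ → ℕ

infixl 7 _⊛_
infixl 6 _⊕_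

_⊕_ : Series → Series → Series
(f ⊕ g) k = f k + g k

_⊛_ : Series → Series → Series
(f ⊛ g) zero    = f 0 * g 0
(f ⊛ g) (suc k) = f 0 * g (suc k) + (f ∘ suc ⊛ g) k

𝟙 : Series
𝟙 zero    = 1
𝟙 (suc _) = 0

delay : Series → Series
delay f zero    = 0
delay f (suc k) = f k

-- The solution X of X = f + x² s X, peeling one coefficient off X at a time.

solve : Series → Series → Series
solve f s zero    = f 0
solve f s (suc k) = solve (λ j → f (suc j) + f 0 * delay s j) s k

⊛-cong : ∀ {f f′ g g′} → f ≗ f′ → g ≗ g′ → f ⊛ g ≗ f′ ⊛ g′
⊛-cong p q zero    = cong₂ _*_ (p 0) (q 0)
⊛-cong p q (suc k) = cong₂ _+_ (cong₂ _*_ (p 0) (q (suc k))) (⊛-cong (p ∘ suc) q k)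

delay-cong : ∀ {f f′} → f ≗ f′ → delay f ≗ delay f′
delay-cong p zero    = refl
delay-cong p (suc k) = p k

delay-⊕ : ∀ f g → delay (f ⊕ g) ≗ delay f ⊕ delay g
delay-⊕ f g zero    = refl
delay-⊕ f g (suc k) = refl

⊛-distribʳ-⊕ : ∀ h f g → (f ⊕ g) ⊛ h ≗ f ⊛ h ⊕ g ⊛ h
⊛-distribʳ-⊕ h f g zero    = *-distribʳ-+ (h 0) (f 0) (g 0)
⊛-distribʳ-⊕ h f g (suc k) =
  trans (cong ((f 0 + g 0) * h (suc k) +_) (⊛-distribʳ-⊕ h (f ∘ suc) (g ∘ suc) k))
        (lemma (f 0) (g 0) (h (suc k)) ((f ∘ suc ⊛ h) k) ((g ∘ suc ⊛ h) k))
  where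
  lemma : ∀ a b c d e → (a + b) * c + (d + e) ≡ (a * c + d) + (b * c + e)
  lemma = solve-∀

⊛-scaleʳ : ∀ c f g → (λ j → c * f j) ⊛ g ≗ (λ j → c * (f ⊛ g) j)
⊛-scaleʳ c f g zero    = *-assoc c (f 0) (g 0)
⊛-scaleʳ c f g (suc k) =
  trans (cong (c * f 0 * g (suc k) +_) (⊛-scaleʳ c (f ∘ suc) g k))
        (lemma c (f 0) (g (suc k)) ((f ∘ suc ⊛ g) k))
  where
  lemma : ∀ a b c d → a * b * c + a * d ≡ a * (b * c + d)
  lemma = solve-∀

⊛-assoc : ∀ f g h → (f ⊛ g) ⊛ h ≗ f ⊛ (g ⊛ h)
⊛-assoc f g h zero    = *-assoc (f 0) (g 0) (h 0)
⊛-assoc f g h (suc k) = begin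
  f 0 * g 0 * h (suc k) + (((λ j → f 0 * g (suc j)) ⊕ (f ∘ suc ⊛ g)) ⊛ h) k
    ≡⟨ cong (f 0 * g 0 * h (suc k) +_) (⊛-distribʳ-⊕ h (λ j → f 0 * g (suc j)) (f ∘ suc ⊛ g) k) ⟩
  f 0 * g 0 * h (suc k) + (((λ j → f 0 * g (suc j)) ⊛ h) k + ((f ∘ suc ⊛ g) ⊛ h) k)
    ≡⟨ cong₂ (λ a b → f 0 * g 0 * h (suc k) + (a + b))
             (⊛-scaleʳ (f 0) (g ∘ suc) h k) (⊛-assoc (f ∘ suc) g h k) ⟩
  f 0 * g 0 * h (suc k) + (f 0 * (g ∘ suc ⊛ h) k + (f ∘ suc ⊛ (g ⊛ h)) k)
    ≡⟨ lemma (f 0) (g 0) (h (suc k)) ((g ∘ suc ⊛ h) k) _ ⟩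
  f 0 * (g 0 * h (suc k) + (g ∘ suc ⊛ h) k) + (f ∘ suc ⊛ (g ⊛ h)) k ∎
  where
  open ≡-Reasoning
  lemma : ∀ a b c d e → a * b * c + (a * d + e) ≡ a * (b * c + d) + e
  lemma = solve-∀

⊛-sucʳ : ∀ f g k → (f ⊛ g) (suc k) ≡ f (suc k) * g 0 + (f ⊛ g ∘ suc) k
⊛-sucʳ f g zero    = +-comm (f 0 * g 1) (f 1 * g 0)
⊛-sucʳ f g (suc k) =
  trans (cong (f 0 * g (2 + k) +_) (⊛-sucʳ (f ∘ suc) g k))
        (lemma (f 0 * g (2 + k)) (f (2 + k) * g 0) _)
  where
  lemma : ∀ a b c → a + (b + c) ≡ b + (a + c)
  lemma = solve-∀

⊛-comm : ∀ f g → f ⊛ g ≗ g ⊛ f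
⊛-comm f g zero    = *-comm (f 0) (g 0)
⊛-comm f g (suc k) =
  trans (cong₂ _+_ (*-comm (f 0) (g (suc k))) (⊛-comm (f ∘ suc) g k)) (sym (⊛-sucʳ g f k))

⊛-distribˡ-⊕ : ∀ h f g → h ⊛ (f ⊕ g) ≗ h ⊛ f ⊕ h ⊛ g
⊛-distribˡ-⊕ h f g k = begin
  (h ⊛ (f ⊕ g)) k         ≡⟨ ⊛-comm h (f ⊕ g) k ⟩
  ((f ⊕ g) ⊛ h) k         ≡⟨ ⊛-distribʳ-⊕ h f g k ⟩
  (f ⊛ h) k + (g ⊛ h) k   ≡⟨ cong₂ _+_ (⊛-comm f h k) (⊛-comm g h k) ⟩
  (h ⊛ f) k + (h ⊛ g) k   ∎
  where open ≡-Reasoning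

𝟘⊛ : ∀ g → const 0 ⊛ g ≗ const 0
𝟘⊛ g zero    = refl
𝟘⊛ g (suc k) = 𝟘⊛ g k

𝟙⊛ : ∀ g → 𝟙 ⊛ g ≗ g
𝟙⊛ g zero    = *-identityˡ (g 0)
𝟙⊛ g (suc k) = begin
  1 * g (suc k) + (const 0 ⊛ g) k  ≡⟨ cong₂ _+_ (*-identityˡ (g (suc k))) (𝟘⊛ g k) ⟩
  g (suc k) + 0                    ≡⟨ +-identityʳ _ ⟩
  g (suc k)                        ∎
  where open ≡-Reasoning

delay-⊛ : ∀ f g → delay f ⊛ g ≗ delay (f ⊛ g)
delay-⊛ f g zero    = refl
delay-⊛ f g (suc k) = refl

⊛-delay : ∀ f g → f ⊛ delay g ≗ delay (f ⊛ g)
⊛-delay f g k =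
  trans (⊛-comm f (delay g) k) (trans (delay-⊛ g f k) (delay-cong (⊛-comm g f) k))

-- Writing X = X₀ + x X′ splits x s X into X₀ x s, known once X₀ is, and x² s X′. The equation for X
-- thus becomes an equation of the same shape for X′, the one on which `solve` recurses.
delay-⊛-head : ∀ s X → delay (s ⊛ X) ≗ (λ k → X 0 * delay s k) ⊕ delay (delay (s ⊛ X ∘ suc))
delay-⊛-head s X zero          = sym (trans (+-identityʳ _) (*-zeroʳ (X 0)))
delay-⊛-head s X (suc zero)    = trans (*-comm (s 0) (X 0)) (sym (+-identityʳ _))
delay-⊛-head s X (suc (suc k)) =
  trans (⊛-sucʳ s X k) (cong (_+ (s ⊛ X ∘ suc) k) (*-comm (s (suc k)) (X 0)))

infix 4 _Solves_,_

_Solves_,_ : Series → Series → Series → Set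
X Solves f , s = X ≗ f ⊕ delay (delay (s ⊛ X))

solve-Solves : ∀ f s → solve f s Solves f , s
solve-Solves f s zero    = sym (+-identityʳ _)
solve-Solves f s (suc k) = begin
  solve f s (suc k)
    ≡⟨ solve-Solves (λ j → f (suc j) + f 0 * delay s j) s k ⟩
  f (suc k) + f 0 * delay s k + delay (delay (s ⊛ solve f s ∘ suc)) k
    ≡⟨ +-assoc (f (suc k)) _ _ ⟩
  f (suc k) + (f 0 * delay s k + delay (delay (s ⊛ solve f s ∘ suc)) k)
    ≡⟨ cong (f (suc k) +_) (sym (delay-⊛-head s (solve f s) k)) ⟩
  f (suc k) + delay (s ⊛ solve f s) k ∎
  where open ≡-Reasoning

-- The coefficient at 0 is forced, and the shifted series solves the shifted equation. Uniqueness is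
-- what later identifies the series of walk counts in a graph with the series of a plane tree.
solve-unique : ∀ {f s X} → X Solves f , s → X ≗ solve f s
solve-unique {f} {s} {X} eq zero    = trans (eq 0) (+-identityʳ _)
solve-unique {f} {s} {X} eq (suc k) = solve-unique tail-eq k
  where
  open ≡-Reasoning
  X₀ : X 0 ≡ f 0
  X₀ = trans (eq 0) (+-identityʳ _)
  tail-eq : X ∘ suc Solves (λ j → f (suc j) + f 0 * delay s j) , s
  tail-eq j = begin
    X (suc j)
      ≡⟨ eq (suc j) ⟩
    f (suc j) + delay (s ⊛ X) j
      ≡⟨ cong (f (suc j) +_) (delay-⊛-head s X j) ⟩
    f (suc j) + (X 0 * delay s j + delay (delay (s ⊛ X ∘ suc)) j)
      ≡⟨ cong (λ c → f (suc j) + (c * delay s j + delay (delay (s ⊛ X ∘ suc)) j)) X₀ ⟩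
    f (suc j) + (f 0 * delay s j + delay (delay (s ⊛ X ∘ suc)) j)
      ≡⟨ sym (+-assoc (f (suc j)) _ _) ⟩
    f (suc j) + f 0 * delay s j + delay (delay (s ⊛ X ∘ suc)) j ∎

solve-cong : ∀ {f f′ s s′} → f ≗ f′ → s ≗ s′ → solve f s ≗ solve f′ s′
solve-cong p q zero    = p 0
solve-cong p q (suc k) =
  solve-cong (λ j → cong₂ _+_ (p (suc j)) (cong₂ _*_ (p 0) (delay-cong q j))) q k

solve-delay : ∀ f s → solve (delay f) s ≗ delay (solve f s)
solve-delay f s zero    = refl
solve-delay f s (suc k) = solve-cong (λ j → +-identityʳ (f j)) (λ _ → refl) k

-- Both sides are h / (1 - x² s).
solve-𝟙-⊛ : ∀ s h → solve 𝟙 s ⊛ h ≗ solve h s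
solve-𝟙-⊛ s h = solve-unique λ k → begin
  (X ⊛ h) k
    ≡⟨ ⊛-cong (solve-Solves 𝟙 s) (λ _ → refl) k ⟩
  ((𝟙 ⊕ delay (delay (s ⊛ X))) ⊛ h) k
    ≡⟨ ⊛-distribʳ-⊕ h 𝟙 (delay (delay (s ⊛ X))) k ⟩
  (𝟙 ⊛ h) k + (delay (delay (s ⊛ X)) ⊛ h) k
    ≡⟨ cong₂ _+_ (𝟙⊛ h k) (delay-⊛ (delay (s ⊛ X)) h k) ⟩
  h k + delay (delay (s ⊛ X) ⊛ h) k
    ≡⟨ cong (h k +_) (delay-cong (delay-⊛ (s ⊛ X) h) k) ⟩
  h k + delay (delay ((s ⊛ X) ⊛ h)) k
    ≡⟨ cong (h k +_) (delay-cong (delay-cong (⊛-assoc s X h)) k) ⟩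
  h k + delay (delay (s ⊛ (X ⊛ h))) k ∎
  where
  open ≡-Reasoning
  X = solve 𝟙 s

-- Weak majorization of lists, by the excess over every threshold.

variable
  A B : Set

∑ : (A → ℕ) → List A → ℕ
∑ f xs = sum (map f xs)

∑-++ : ∀ (f : A → ℕ) xs ys → ∑ f (xs ++ ys) ≡ ∑ f xs + ∑ f ys
∑-++ f xs ys = trans (cong sum (map-++ f xs ys)) (sum-++ (map f xs) (map f ys))

∑-↭ : ∀ (f : A → ℕ) {xs ys} → xs ↭ ys → ∑ f xs ≡ ∑ f ys
∑-↭ f p = sum-↭ (Perm.map⁺ f p)

∑-cong : ∀ {f g : A → ℕ} → f ≗ g → ∑ f ≗ ∑ g
∑-cong p xs = cong sum (map-cong p xs)

∑-map : ∀ (f : B → ℕ) (φ : A → B) xs → ∑ f (map φ xs) ≡ ∑ (f ∘ φ) xs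
∑-map f φ xs = cong sum (sym (map-∘ xs))

∑-concatMap : ∀ (f : B → ℕ) (g : A → List B) xs → ∑ f (concatMap g xs) ≡ ∑ (∑ f ∘ g) xs
∑-concatMap f g []       = refl
∑-concatMap f g (x ∷ xs) =
  trans (∑-++ f (g x) (concatMap g xs)) (cong (∑ f (g x) +_) (∑-concatMap f g xs))

∑-+ : ∀ (f g : A → ℕ) xs → ∑ (λ x → f x + g x) xs ≡ ∑ f xs + ∑ g xs
∑-+ f g []       = refl
∑-+ f g (x ∷ xs) = trans (cong (f x + g x +_) (∑-+ f g xs)) (interchange (f x) (g x) _ _)

∑-const : ∀ c (xs : List A) → ∑ (const c) xs ≡ length xs * c
∑-const c []       = refl
∑-const c (x ∷ xs) = cong (c +_) (∑-const c xs)

∑-*ˡ : ∀ c (f : A → ℕ) xs → ∑ (λ x → c * f x) xs ≡ c * ∑ f xs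
∑-*ˡ c f []       = sym (*-zeroʳ c)
∑-*ˡ c f (x ∷ xs) = trans (cong (c * f x +_) (∑-*ˡ c f xs)) (sym (*-distribˡ-+ c (f x) _))

∑-mono : ∀ {f g : A → ℕ} → (∀ x → f x ≤ g x) → ∀ xs → ∑ f xs ≤ ∑ g xs
∑-mono p []       = z≤n
∑-mono p (x ∷ xs) = +-mono-≤ (p x) (∑-mono p xs)

∑-take-≤ : ∀ (f : A → ℕ) m xs → ∑ f (take m xs) ≤ ∑ f xs
∑-take-≤ f zero    xs       = z≤n
∑-take-≤ f (suc m) []       = z≤n
∑-take-≤ f (suc m) (x ∷ xs) = +-monoʳ-≤ (f x) (∑-take-≤ f m xs)

∑-take-mono : ∀ (f : A → ℕ) {l m} → l ≤ m → ∀ xs → ∑ f (take l xs) ≤ ∑ f (take m xs)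
∑-take-mono f z≤n     xs       = z≤n
∑-take-mono f (s≤s p) []       = z≤n
∑-take-mono f (s≤s p) (x ∷ xs) = +-monoʳ-≤ (f x) (∑-take-mono f p xs)

length-concatMap : ∀ (g : A → List B) xs → length (concatMap g xs) ≡ ∑ (length ∘ g) xs
length-concatMap g []       = refl
length-concatMap g (x ∷ xs) =
  trans (length-++ (g x)) (cong (length (g x) +_) (length-concatMap g xs))

take-++-length : ∀ (xs ys : List A) → take (length xs) (xs ++ ys) ≡ xs
take-++-length []       ys = refl
take-++-length (x ∷ xs) ys = cong (x ∷_) (take-++-length xs ys)

concatMap-↭ : ∀ (g : A → List B) {xs ys} → xs ↭ ys → concatMap g xs ↭ concatMap g ys
concatMap-↭ g _↭_.refl                = ↭-refl
concatMap-↭ g (_↭_.prep x p)          = Perm.++⁺ˡ (g x) (concatMap-↭ g p)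
concatMap-↭ g (_↭_.swap {xs} {ys} x y p) =
  ↭-trans (Perm.shifts (g x) (g y)) (Perm.++⁺ˡ (g y) (Perm.++⁺ˡ (g x) (concatMap-↭ g p)))
concatMap-↭ g (_↭_.trans p q)         = ↭-trans (concatMap-↭ g p) (concatMap-↭ g q)

Antitone : (A → ℕ) → List A → Set
Antitone f = AllPairs (λ x y → f y ≤ f x)

excess : (A → ℕ) → ℕ → List A → ℕ
excess f τ = ∑ (λ x → f x ∸ τ)

infix 4 _⊑_

-- Inclusion of multisets: a selection may be reordered freely, as the rearrangement argument for
-- products does.
record _⊑_ {A : Set} (us xs : List A) : Set where
  constructor sub
  field
    others : List A
    ↭-all  : us ++ others ↭ xs

⊑-length : ∀ {us xs : List A} → us ⊑ xs → length us ≤ length xs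
⊑-length {us = us} {xs} (sub vs p) = begin
  length us              ≤⟨ m≤m+n _ _ ⟩
  length us + length vs  ≡⟨ sym (length-++ us) ⟩
  length (us ++ vs)      ≡⟨ Perm.↭-length p ⟩
  length xs              ∎
  where open ≤-Reasoning

∑-⊑ : ∀ (f : A → ℕ) {us xs} → us ⊑ xs → ∑ f us ≤ ∑ f xs
∑-⊑ f {us} {xs} (sub vs p) = begin
  ∑ f us           ≤⟨ m≤m+n _ _ ⟩
  ∑ f us + ∑ f vs  ≡⟨ sym (∑-++ f us vs) ⟩
  ∑ f (us ++ vs)   ≡⟨ ∑-↭ f p ⟩
  ∑ f xs           ∎
  where open ≤-Reasoning

⊑-take : ∀ j {us xs : List A} → us ⊑ xs → take j us ⊑ xs
⊑-take j {us} (sub vs p) = sub (drop j us ++ vs)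
  (↭-trans (↭-reflexive (trans (sym (++-assoc (take j us) _ _))
                               (cong (_++ vs) (take++drop≡id j us)))) p)

⊑-concatMap : ∀ (g : A → List B) {us xs} → us ⊑ xs → concatMap g us ⊑ concatMap g xs
⊑-concatMap g {us} (sub vs p) =
  sub (concatMap g vs) (↭-trans (↭-reflexive (sym (concatMap-++ g us vs))) (concatMap-↭ g p))

⊑-resp-↭ : ∀ {us ws xs : List A} → ws ↭ us → us ⊑ xs → ws ⊑ xs
⊑-resp-↭ r (sub vs p) = sub vs (↭-trans (Perm.++⁺ʳ vs r) p)

-- Keeping the list `ys` itself in order, instead of sorting the values of `f`, makes any two
-- functions antitone along `ys` comonotone: their largest sums are attained on the same initial
-- segments.
record Dom {A : Set} (f : A → ℕ) (xs ys : List A) : Set where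
  field
    antitone : Antitone f ys
    length-≡ : length xs ≡ length ys
    excess-≤ : ∀ τ → excess f τ xs ≤ excess f τ ys

open Dom public

∑≤excess : ∀ (f : A → ℕ) τ xs → ∑ f xs ≤ length xs * τ + excess f τ xs
∑≤excess f τ []       = z≤n
∑≤excess f τ (x ∷ xs) = begin
  f x + ∑ f xs                                            ≤⟨ +-mono-≤ (m≤n+m∸n (f x) τ) (∑≤excess f τ xs) ⟩
  τ + (f x ∸ τ) + (length xs * τ + excess f τ xs)         ≡⟨ interchange τ (f x ∸ τ) (length xs * τ) _ ⟩
  τ + length xs * τ + (f x ∸ τ + excess f τ xs)           ∎
  where open ≤-Reasoning

-- The threshold is the first value not taken.

take-threshold : ∀ (f : A → ℕ) {ys} l → Antitone f ys → l ≤ length ys →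
  ∃ λ τ → l * τ + excess f τ ys ≤ ∑ f (take l ys) × (∀ {b} → All (λ y → f y ≤ b) ys → τ ≤ b)
take-threshold f {[]}     zero    _        _       = 0 , z≤n , λ _ → z≤n
take-threshold f {y ∷ ys} zero    (p ∷ _)  _       =
  f y , ≤-reflexive (cong₂ _+_ (n∸n≡0 (f y)) (no-excess p)) , λ { (q ∷ _) → q }
  where
  no-excess : ∀ {τ xs} → All (λ x → f x ≤ τ) xs → excess f τ xs ≡ 0
  no-excess []       = refl
  no-excess (q ∷ qs) = cong₂ _+_ (m≤n⇒m∸n≡0 q) (no-excess qs)
take-threshold f {y ∷ ys} (suc l) (p ∷ ps) (s≤s l≤) with take-threshold f l ps l≤
... | τ , below , minimal = τ , bound , λ { (_ ∷ qs) → minimal qs }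
  where
  open ≤-Reasoning
  bound : τ + l * τ + (f y ∸ τ + excess f τ ys) ≤ f y + ∑ f (take l ys)
  bound = begin
    τ + l * τ + (f y ∸ τ + excess f τ ys)    ≡⟨ interchange τ (l * τ) (f y ∸ τ) _ ⟩
    τ + (f y ∸ τ) + (l * τ + excess f τ ys)  ≡⟨ cong (_+ (l * τ + excess f τ ys)) (m+[n∸m]≡n (minimal p)) ⟩
    f y + (l * τ + excess f τ ys)            ≤⟨ +-monoʳ-≤ (f y) below ⟩
    f y + ∑ f (take l ys)                    ∎

-- Duality between sums of l entries and thresholds: such a sum is at most l τ plus the excess over
-- τ, whatever τ is, and `take-threshold` supplies a τ for which the first l entries of `ys` reach
-- this bound.
Dom⇒∑≤∑take : ∀ {f : A → ℕ} {xs ys us} → Dom f xs ys → us ⊑ xs →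
  ∑ f us ≤ ∑ f (take (length us) ys)
Dom⇒∑≤∑take {f = f} {xs} {ys} {us} d p =
  let τ , below , _ = take-threshold f (length us) (antitone d)
                        (≤-trans (⊑-length p) (≤-reflexive (length-≡ d))) in begin
  ∑ f us                           ≤⟨ ∑≤excess f τ us ⟩
  length us * τ + excess f τ us    ≤⟨ +-monoʳ-≤ (length us * τ) (∑-⊑ _ p) ⟩
  length us * τ + excess f τ xs    ≤⟨ +-monoʳ-≤ (length us * τ) (excess-≤ d τ) ⟩
  length us * τ + excess f τ ys    ≤⟨ below ⟩
  ∑ f (take (length us) ys)        ∎
  where open ≤-Reasoning

-- The entries that are at least τ turn the bound of `∑≤excess` into an equality, so control of all
-- sums over selections gives back control of the excess.
select-excess : ∀ (f : A → ℕ) τ xs →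
  ∃ λ us → us ⊑ xs × ∑ f us ≡ length us * τ + excess f τ xs
select-excess f τ [] = [] , sub [] ↭-refl , refl
select-excess f τ (x ∷ xs) with select-excess f τ xs | τ ≤? f x
... | us , sub vs p , eq | yes τ≤ = x ∷ us , sub vs (prep x p) , (begin
  f x + ∑ f us                                     ≡⟨ cong₂ _+_ (sym (m+[n∸m]≡n τ≤)) eq ⟩
  τ + (f x ∸ τ) + (length us * τ + excess f τ xs)  ≡⟨ interchange τ (f x ∸ τ) (length us * τ) _ ⟩
  τ + length us * τ + (f x ∸ τ + excess f τ xs)    ∎)
  where open ≡-Reasoning
... | us , sub vs p , eq | no τ≰ = us , sub (x ∷ vs) (↭-trans (Perm.shift x us vs) (prep x p)) ,
  trans eq (cong (λ e → length us * τ + (e + excess f τ xs)) (sym (m≤n⇒m∸n≡0 (<⇒≤ (≰⇒> τ≰)))))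

∑≤∑take⇒Dom : ∀ {f : A → ℕ} {xs ys} → Antitone f ys → length xs ≡ length ys →
  (∀ {us} → us ⊑ xs → ∑ f us ≤ ∑ f (take (length us) ys)) → Dom f xs ys
∑≤∑take⇒Dom {f = f} {xs} {ys} anti len bound = record
  { antitone = anti
  ; length-≡ = len
  ; excess-≤ = λ τ → let us , p , eq = select-excess f τ xs in
      +-cancelˡ-≤ (length us * τ) _ _ (begin
        length us * τ + excess f τ xs               ≡⟨ sym eq ⟩
        ∑ f us                                      ≤⟨ bound p ⟩
        ∑ f (take (length us) ys)                   ≤⟨ ∑≤excess f τ (take (length us) ys) ⟩
        length (take (length us) ys) * τ + excess f τ (take (length us) ys)
          ≤⟨ +-mono-≤ (*-monoˡ-≤ τ (take-≤ (length us) ys)) (∑-take-≤ _ (length us) ys) ⟩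
        length us * τ + excess f τ ys               ∎)
  }
  where
  open ≤-Reasoning
  take-≤ : ∀ m (zs : List _) → length (take m zs) ≤ m
  take-≤ m zs = ≤-trans (≤-reflexive (length-take m zs)) (m⊓n≤m m _)

↭⇒Dom : ∀ {f : A → ℕ} {xs ys} → Antitone f ys → xs ↭ ys → Dom f xs ys
↭⇒Dom anti p = record
  { antitone = anti
  ; length-≡ = Perm.↭-length p
  ; excess-≤ = λ τ → ≤-reflexive (∑-↭ _ p)
  }

Dom-resp-≗ : ∀ {f g : A → ℕ} {xs ys} → f ≗ g → Dom f xs ys → Dom g xs ys
Dom-resp-≗ {xs = xs} {ys} p d = record
  { antitone = AllPairs.map (λ {x} {y} → subst₂ _≤_ (p y) (p x)) (antitone d)
  ; length-≡ = length-≡ d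
  ; excess-≤ = λ τ → subst₂ _≤_ (∑-cong (λ x → cong (_∸ τ) (p x)) xs)
                                (∑-cong (λ x → cong (_∸ τ) (p x)) ys) (excess-≤ d τ)
  }

Dom-map⁺ : ∀ {f : B → ℕ} (φ : A → B) {xs ys} → Dom (f ∘ φ) xs ys → Dom f (map φ xs) (map φ ys)
Dom-map⁺ φ {xs} {ys} d = record
  { antitone = AllPairs.map⁺ (antitone d)
  ; length-≡ = trans (length-map φ xs) (trans (length-≡ d) (sym (length-map φ ys)))
  ; excess-≤ = λ τ → subst₂ _≤_ (sym (∑-map _ φ xs)) (sym (∑-map _ φ ys)) (excess-≤ d τ)
  }

Dom-map⁻ : ∀ {f : B → ℕ} (φ : A → B) {xs ys} → Dom f (map φ xs) (map φ ys) → Dom (f ∘ φ) xs ys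
Dom-map⁻ φ {xs} {ys} d = record
  { antitone = AllPairs.map⁻ (antitone d)
  ; length-≡ = trans (sym (length-map φ xs)) (trans (length-≡ d) (length-map φ ys))
  ; excess-≤ = λ τ → subst₂ _≤_ (∑-map _ φ xs) (∑-map _ φ ys) (excess-≤ d τ)
  }

Dom-const : ∀ {xs ys : List A} c → length xs ≡ length ys → Dom (const c) xs ys
Dom-const {xs = xs} {ys} c len = record
  { antitone = universal ys
  ; length-≡ = len
  ; excess-≤ = λ τ → ≤-reflexive (trans (∑-const (c ∸ τ) xs)
                       (trans (cong (_* (c ∸ τ)) len) (sym (∑-const (c ∸ τ) ys))))
  }
  where
  universal : ∀ zs → Antitone (const c) zs
  universal []       = []
  universal (z ∷ zs) = All.universal (λ _ → ≤-refl) zs ∷ universal zs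

-- The excess is not additive in the function, but sums over a selection are, and one initial
-- segment of `ys` bounds both of them.
Dom-+ : ∀ {f g : A → ℕ} {xs ys} → Dom f xs ys → Dom g xs ys → Dom (λ x → f x + g x) xs ys
Dom-+ {f = f} {g} {ys = ys} d e = ∑≤∑take⇒Dom
  (AllPairs.map (λ (p , q) → +-mono-≤ p q) (AllPairs.zip (antitone d , antitone e)))
  (length-≡ d)
  λ {us} p → subst₂ _≤_ (sym (∑-+ f g us)) (sym (∑-+ f g (take (length us) ys)))
               (+-mono-≤ (Dom⇒∑≤∑take d p) (Dom⇒∑≤∑take e p))

Dom-total : ∀ {f : A → ℕ} {xs ys} → Dom f xs ys → ∑ f xs ≤ ∑ f ys
Dom-total d = excess-≤ d 0

-- Products of comonotone functions, by rearrangement.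

dot : List ℕ → List ℕ → ℕ
dot (a ∷ as) (b ∷ bs) = a * b + dot as bs
dot _        _        = 0

dot-comm : ∀ as bs → dot as bs ≡ dot bs as
dot-comm []       []       = refl
dot-comm []       (_ ∷ _)  = refl
dot-comm (_ ∷ _)  []       = refl
dot-comm (a ∷ as) (b ∷ bs) = cong₂ _+_ (*-comm a b) (dot-comm as bs)

dot-map : ∀ (f g : A → ℕ) xs → dot (map f xs) (map g xs) ≡ ∑ (λ x → f x * g x) xs
dot-map f g []       = refl
dot-map f g (x ∷ xs) = cong (f x * g x +_) (dot-map f g xs)

-- Summation by parts; s is the slack accumulated by the partial sums.

abel : ∀ s w {as bs ws} → length as ≡ length bs → AllPairs _≥_ ws → All (_≤ w) ws →
  (∀ j → sum (take j as) ≤ s + sum (take j bs)) → dot as ws ≤ s * w + dot bs ws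
abel s w {[]}                     _   _        _        _ = z≤n
abel s w {_ ∷ _}           {ws = []} _   _        _        _ = z≤n
abel s w {a ∷ as} {b ∷ bs} {v ∷ ws} len (p ∷ ps) (v≤w ∷ _) partial = begin
  a * v + dot as ws                      ≤⟨ +-monoʳ-≤ (a * v) (abel s′ v (suc-injective len) ps p partial′) ⟩
  a * v + (s′ * v + dot bs ws)           ≡⟨ sym (+-assoc (a * v) _ _) ⟩
  a * v + s′ * v + dot bs ws             ≡⟨ cong (_+ dot bs ws) (sym (*-distribʳ-+ v a s′)) ⟩
  (a + s′) * v + dot bs ws               ≡⟨ cong (λ c → c * v + dot bs ws) (m+[n∸m]≡n a≤s+b) ⟩
  (s + b) * v + dot bs ws                ≡⟨ cong (_+ dot bs ws) (*-distribʳ-+ v s b) ⟩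
  s * v + b * v + dot bs ws              ≡⟨ +-assoc (s * v) _ _ ⟩
  s * v + (b * v + dot bs ws)            ≤⟨ +-monoˡ-≤ _ (*-monoʳ-≤ s v≤w) ⟩
  s * w + (b * v + dot bs ws)            ∎
  where
  open ≤-Reasoning
  a≤s+b : a ≤ s + b
  a≤s+b = subst₂ _≤_ (+-identityʳ a) (cong (s +_) (+-identityʳ b)) (partial 1)
  s′ = s + b ∸ a
  partial′ : ∀ j → sum (take j as) ≤ s′ + sum (take j bs)
  partial′ j = +-cancelˡ-≤ a _ _ (begin
    a + sum (take j as)           ≤⟨ partial (suc j) ⟩
    s + (b + sum (take j bs))     ≡⟨ sym (+-assoc s b _) ⟩
    s + b + sum (take j bs)       ≡⟨ cong (_+ sum (take j bs)) (sym (m+[n∸m]≡n a≤s+b)) ⟩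
    a + s′ + sum (take j bs)      ≡⟨ +-assoc a s′ _ ⟩
    a + (s′ + sum (take j bs))    ∎)

abel₀ : ∀ {as bs ws} → length as ≡ length bs → AllPairs _≥_ ws →
  (∀ j → sum (take j as) ≤ sum (take j bs)) → dot as ws ≤ dot bs ws
abel₀ {as} {bs} {ws} len ps = abel 0 (sum ws) {as} {bs} {ws} len ps (bounded ws)
  where
  bounded : ∀ vs → All (_≤ sum vs) vs
  bounded []       = []
  bounded (v ∷ vs) = m≤m+n v _ ∷ All.map (λ p → ≤-trans p (m≤n+m _ v)) (bounded vs)

∃-sorted : ∀ (g : A → ℕ) xs → ∃ λ ys → ys ↭ xs × Antitone g ys
∃-sorted g xs = Sort.sort xs , Sort.sort-↭ xs , Sorted⇒AllPairs totalOrder (Sort.sort-↗ xs)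
  where
  O = On.decTotalOrder ≥-decTotalOrder g
  open DecTotalOrder O using (totalOrder)
  module Sort = ListSort O

Dom⇒partial-sums : ∀ {f : A → ℕ} {xs ys us} → Dom f xs ys → us ⊑ xs → ∀ j →
  sum (take j (map f us)) ≤ sum (take j (map f (take (length us) ys)))
Dom⇒partial-sums {f = f} {xs} {ys} {us} d p j = begin
  sum (take j (map f us))                      ≡⟨ cong sum (take-map j us) ⟩
  ∑ f (take j us)                              ≤⟨ Dom⇒∑≤∑take d (⊑-take j p) ⟩
  ∑ f (take (length (take j us)) ys)           ≡⟨ cong (λ m → ∑ f (take m ys)) (length-take j us) ⟩
  ∑ f (take (j ⊓ length us) ys)                ≡⟨ cong (∑ f) (sym (take-take j (length us) ys)) ⟩
  ∑ f (take j (take (length us) ys))           ≡⟨ cong sum (sym (take-map j (take (length us) ys))) ⟩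
  sum (take j (map f (take (length us) ys)))   ∎
  where open ≤-Reasoning

length-take-Dom : ∀ {f : A → ℕ} {xs ys us} → Dom f xs ys → us ⊑ xs →
  length (take (length us) ys) ≡ length us
length-take-Dom {ys = ys} {us} d p =
  trans (length-take (length us) ys)
        (m≤n⇒m⊓n≡m (≤-trans (⊑-length p) (≤-reflexive (length-≡ d))))

-- The factors are replaced one at a time by summation by parts: first the values of `f` on the
-- selection by those on `ys`, weighted by `g` on the selection; then the values of `g`, weighted by
-- `f` on `ys`.
Dom-* : ∀ {f g : A → ℕ} {xs ys} → Dom f xs ys → Dom g xs ys → Dom (λ x → f x * g x) xs ys
Dom-* {A = A} {f = f} {g} {xs} {ys} d e = ∑≤∑take⇒Dom
  (AllPairs.map (λ (p , q) → *-mono-≤ p q) (AllPairs.zip (antitone d , antitone e)))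
  (length-≡ d)
  bound
  where
  open ≤-Reasoning
  bound : ∀ {us} → us ⊑ xs →
    ∑ (λ x → f x * g x) us ≤ ∑ (λ x → f x * g x) (take (length us) ys)
  -- Summation by parts needs nonincreasing weights, so the selection is listed by decreasing `g`.
  bound {us} p = let ws , ws↭us , anti = ∃-sorted g us in begin
    ∑ (λ x → f x * g x) us                   ≡⟨ ∑-↭ _ (↭-sym ws↭us) ⟩
    ∑ (λ x → f x * g x) ws                   ≡⟨ sym (dot-map f g ws) ⟩
    dot (map f ws) (map g ws)                ≤⟨ abel₀ (lengths f ws (q ws↭us)) (AllPairs.map⁺ anti)
                                                      (Dom⇒partial-sums d (q ws↭us)) ⟩
    dot (map f (take (length ws) ys)) (map g ws)
                                             ≡⟨ dot-comm (map f (take (length ws) ys)) (map g ws) ⟩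
    dot (map g ws) (map f (take (length ws) ys))
      ≤⟨ abel₀ (lengths g ws (q ws↭us)) (AllPairs.map⁺ (AllPairs.take⁺ (length ws) (antitone d)))
               (Dom⇒partial-sums e (q ws↭us)) ⟩
    dot (map g (take (length ws) ys)) (map f (take (length ws) ys))
                                             ≡⟨ dot-comm (map g (take (length ws) ys)) _ ⟩
    dot (map f (take (length ws) ys)) (map g (take (length ws) ys))
                                             ≡⟨ dot-map f g (take (length ws) ys) ⟩
    ∑ (λ x → f x * g x) (take (length ws) ys)
                                             ≡⟨ cong (λ m → ∑ _ (take m ys)) (Perm.↭-length ws↭us) ⟩
    ∑ (λ x → f x * g x) (take (length us) ys) ∎
    where
    q : ∀ {ws} → ws ↭ us → ws ⊑ xs
    q r = ⊑-resp-↭ r p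
    lengths : ∀ (h : A → ℕ) ws → ws ⊑ xs →
      length (map h ws) ≡ length (map h (take (length ws) ys))
    lengths h ws r = trans (length-map h ws) (sym (trans (length-map h (take (length ws) ys)) (length-take-Dom d r)))

∑-dominated : ∀ {f : A → ℕ} {xs ys} → length ys ≤ length xs →
  All (λ x → All (λ y → f y ≤ f x) ys) xs → ∑ f ys ≤ ∑ f xs
∑-dominated {xs = xs}     {[]}     _       _        = z≤n
∑-dominated {xs = x ∷ xs} {y ∷ ys} (s≤s l) ((p ∷ _) ∷ ps) =
  +-mono-≤ p (∑-dominated l (All.map (λ { (_ ∷ qs) → qs }) ps))

AllPairs-++⁻ : ∀ {R : A → A → Set} xs {ys} → AllPairs R (xs ++ ys) →
  AllPairs R xs × AllPairs R ys × All (λ x → All (R x) ys) xs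
AllPairs-++⁻ []       ps       = [] , ps , []
AllPairs-++⁻ (x ∷ xs) (p ∷ ps) =
  let l , r , c = AllPairs-++⁻ xs ps in
  All.++⁻ˡ xs p ∷ l , r , All.++⁻ʳ xs p ∷ c

-- Passing between the vertices of a level and their children.

module _ {A B : Set} (ch : A → List B) where

  -- The children of a selection from `xs` are at most as many as the children of equally many first
  -- entries of `ys`, and the latter form an initial segment of all children of `ys`.
  Dom-∑-children : ∀ {f : B → ℕ} {xs ys} → Dom (length ∘ ch) xs ys →
    Dom f (concatMap ch xs) (concatMap ch ys) → Dom (∑ f ∘ ch) xs ys
  Dom-∑-children {f} {xs} {ys} o d = ∑≤∑take⇒Dom (anti ys (antitone o) (antitone d)) (length-≡ o) bound
    where
    anti : ∀ zs → Antitone (length ∘ ch) zs → Antitone f (concatMap ch zs) → Antitone (∑ f ∘ ch) zs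
    anti []       _        _  = []
    anti (z ∷ zs) (p ∷ ps) qs =
      let _ , r , c = AllPairs-++⁻ (ch z) qs in cross zs p c ∷ anti zs ps r
      where
      cross : ∀ ws → All (λ w → length (ch w) ≤ length (ch z)) ws →
        All (λ x → All (λ y → f y ≤ f x) (concatMap ch ws)) (ch z) →
        All (λ w → ∑ f (ch w) ≤ ∑ f (ch z)) ws
      cross []       _        _  = []
      cross (w ∷ ws) (l ∷ ls) cs =
        ∑-dominated l (All.map (All.++⁻ˡ (ch w)) cs) ∷ cross ws ls (All.map (All.++⁻ʳ (ch w)) cs)
    open ≤-Reasoning
    bound : ∀ {us} → us ⊑ xs → ∑ (∑ f ∘ ch) us ≤ ∑ (∑ f ∘ ch) (take (length us) ys)
    bound {us} p = begin
      ∑ (∑ f ∘ ch) us                                             ≡⟨ sym (∑-concatMap f ch us) ⟩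
      ∑ f (concatMap ch us)                                       ≤⟨ Dom⇒∑≤∑take d (⊑-concatMap ch p) ⟩
      ∑ f (take (length (concatMap ch us)) (concatMap ch ys))     ≤⟨ ∑-take-mono f len (concatMap ch ys) ⟩
      ∑ f (take (length (concatMap ch first)) (concatMap ch ys))  ≡⟨ cong (∑ f) taken ⟩
      ∑ f (concatMap ch first)                                    ≡⟨ ∑-concatMap f ch first ⟩
      ∑ (∑ f ∘ ch) first                                          ∎
      where
      first = take (length us) ys
      len : length (concatMap ch us) ≤ length (concatMap ch first)
      len = subst₂ _≤_ (sym (length-concatMap ch us)) (sym (length-concatMap ch first)) (Dom⇒∑≤∑take o p)
      taken : take (length (concatMap ch first)) (concatMap ch ys) ≡ concatMap ch first
      taken = trans (cong (take (length (concatMap ch first)))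
                      (trans (cong (concatMap ch) (sym (take++drop≡id (length us) ys)))
                             (concatMap-++ ch first _)))
                    (take-++-length (concatMap ch first) _)

  children : List A → List (A × B)
  children = concatMap (λ x → map (x ,_) (ch x))

  excess-children : ∀ (f : A → ℕ) τ xs →
    excess (f ∘ proj₁) τ (children xs) ≡ ∑ (λ x → length (ch x) * (f x ∸ τ)) xs
  excess-children f τ xs =
    trans (∑-concatMap _ (λ x → map (x ,_) (ch x)) xs)
          (∑-cong (λ x → trans (∑-map _ (x ,_) (ch x)) (∑-const (f x ∸ τ) (ch x))) xs)

  length-children : ∀ xs → length (children xs) ≡ length (concatMap ch xs)
  length-children xs =
    trans (length-concatMap _ xs) (trans (∑-cong (λ x → length-map (x ,_) (ch x)) xs)
                                         (sym (length-concatMap ch xs)))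

  map-proj₂-children : ∀ xs → map proj₂ (children xs) ≡ concatMap ch xs
  map-proj₂-children []       = refl
  map-proj₂-children (x ∷ xs) =
    trans (map-++ proj₂ (map (x ,_) (ch x)) (children xs))
          (cong₂ _++_ (trans (sym (map-∘ (ch x))) (map-id (ch x))) (map-proj₂-children xs))

  -- Each value of `f` is repeated once per child, so the excess over τ is the sum of the outdegrees
  -- times `f x ∸ τ`: a product of comonotone functions.
  Dom-parent : ∀ {f : A → ℕ} {xs ys} → Dom (length ∘ ch) xs ys → Dom f xs ys →
    length (concatMap ch xs) ≡ length (concatMap ch ys) →
    Dom (f ∘ proj₁) (children xs) (children ys)
  Dom-parent {f} {xs} {ys} o d len = record
    { antitone = anti ys (antitone d)
    ; length-≡ = trans (length-children xs) (trans len (sym (length-children ys)))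
    ; excess-≤ = λ τ → subst₂ _≤_ (sym (excess-children f τ xs)) (sym (excess-children f τ ys))
        (Dom-total (Dom-* o (Dom-∸ τ)))
    }
    where
    same : ∀ {a : A} (bs : List B) → Antitone (f ∘ proj₁) (map (a ,_) bs)
    same []       = []
    same {a} (b ∷ bs) = All.map⁺ (All.universal (λ _ → ≤-refl) bs) ∷ same bs
    anti : ∀ zs → Antitone f zs → Antitone (f ∘ proj₁) (children zs)
    anti []       _        = []
    anti (z ∷ zs) (p ∷ ps) = AllPairs.++⁺ (same (ch z)) (anti zs ps)
      (All.map⁺ (All.universal (λ _ → below p) (ch z)))
      where
      below : ∀ {ws} → All (λ w → f w ≤ f z) ws → All (λ y → f (proj₁ y) ≤ f z) (children ws)
      below []                = []
      below {w ∷ ws} (q ∷ qs) = All.++⁺ (All.map⁺ (All.universal (λ _ → q) (ch w))) (below qs)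
    Dom-∸ : ∀ τ → Dom (λ x → f x ∸ τ) xs ys
    Dom-∸ τ = record
      { antitone = AllPairs.map (∸-monoˡ-≤ τ) (antitone d)
      ; length-≡ = length-≡ d
      ; excess-≤ = λ σ → subst₂ _≤_ (∑-cong (λ x → sym (∸-+-assoc (f x) τ σ)) xs)
                                    (∑-cong (λ x → sym (∸-+-assoc (f x) τ σ)) ys) (excess-≤ d (τ + σ))
      }

-- Only coefficients up to `k` are assumed, because at an edge the domination of the factors is
-- itself obtained by strong induction on the coefficient.
Dom-⊛ : ∀ {xs ys : List A} {f g : A → Series} k → (∀ {j} → j ≤ k → Dom (λ x → f x j) xs ys) →
  (∀ {j} → j ≤ k → Dom (λ x → g x j) xs ys) → Dom (λ x → (f x ⊛ g x) k) xs ys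
Dom-⊛ zero    d e = Dom-* (d z≤n) (e z≤n)
Dom-⊛ (suc k) d e =
  Dom-+ (Dom-* (d z≤n) (e ≤-refl)) (Dom-⊛ k (d ∘ s≤s) (e ∘ m≤n⇒m≤1+n))

Dom-delay : ∀ {xs ys : List A} {f : A → Series} → (∀ k → Dom (λ x → f x k) xs ys) →
  ∀ k → Dom (λ x → delay (f x) k) xs ys
Dom-delay d zero    = Dom-const 0 (length-≡ (d 0))
Dom-delay d (suc k) = d k

Dom-solve : ∀ {xs ys : List A} {f s : A → Series} → (∀ k → Dom (λ x → f x k) xs ys) →
  (∀ k → Dom (λ x → s x k) xs ys) → ∀ k → Dom (λ x → solve (f x) (s x) k) xs ys
Dom-solve d e zero    = d 0
Dom-solve d e (suc k) =
  Dom-solve (λ j → Dom-+ (d (suc j)) (Dom-* (d 0) (Dom-delay e j))) e k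

-- Rooted plane trees and the level-wise comparison.

data Tree : Set where
  node : List Tree → Tree

ch : Tree → List Tree
ch (node cs) = cs

outdegree : Tree → ℕ
outdegree = length ∘ ch

below : List Tree → List Tree
below = concatMap ch

-- Applying `f` to the argument first makes `level (suc i) F` definitionally `level i (below F)`, so
-- a statement about all levels passes to the forest below by composition with `suc`.
iter : (List A → List A) → ℕ → List A → List A
iter f zero    F = F
iter f (suc i) F = iter f i (f F)

level : ℕ → List Tree → List Tree
level = iter below

-- D t counts the closed walks at the root of t by length: D = 1 + x² S D.

mutual
  D : Tree → Series
  D (node cs) = solve 𝟙 (S cs)

  S : List Tree → Series
  S []       k = 0
  S (c ∷ cs) k = D c k + S cs k

S-∑ : ∀ cs k → S cs k ≡ ∑ (λ c → D c k) cs
S-∑ []       k = refl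
S-∑ (c ∷ cs) k = cong (D c k +_) (S-∑ cs k)

D-Solves : ∀ t → D t Solves 𝟙 , S (ch t)
D-Solves (node cs) = solve-Solves 𝟙 (S cs)

-- A tree t inside a larger tree, with the series W of all closed walks at its
-- root.  A closed walk at a child c of a vertex p either starts with an excursion
-- below c, or is a closed walk below c followed by an excursion to p, where all
-- closed walks at p are possible: W(c) = 1 + x² (S(c) W(c) + D(c) W(p)).

Item : Set
Item = Tree × Series

descend : Tree → Series → Series
descend c w = solve (𝟙 ⊕ delay (delay (D c ⊛ w))) (S (ch c))

push : Item → List Item
push (t , w) = map (λ c → c , descend c w) (ch t)

pushes : List Item → List Item
pushes = concatMap push

trees : List Item → List Tree
trees = map proj₁

at : ℕ → Item → ℕ
at k x = proj₂ x k

mutual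
  closed : Tree → Series → List Series
  closed (node cs) w = w ∷ closed* cs w

  closed* : List Tree → Series → List Series
  closed* []       w = []
  closed* (c ∷ cs) w = closed c (descend c w) ++ closed* cs w

closedF : List Item → List Series
closedF = concatMap (λ x → closed (proj₁ x) (proj₂ x))

closed*-push : ∀ cs w → closed* cs w ≡ closedF (push (node cs , w))
closed*-push []       w = refl
closed*-push (c ∷ cs) w = cong (closed c (descend c w) ++_) (closed*-push cs w)

-- `closed` lists a tree depth first while the comparison works level by level; sums do not see the
-- difference.
∑-closedF : ∀ (g : Series → ℕ) X →
  ∑ g (closedF X) ≡ ∑ (g ∘ proj₂) X + ∑ g (closedF (pushes X))
∑-closedF g []                 = refl
∑-closedF g ((node cs , w) ∷ X) = begin
  g w + ∑ g (closed* cs w ++ closedF X)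
    ≡⟨ cong (g w +_) (∑-++ g (closed* cs w) (closedF X)) ⟩
  g w + (∑ g (closed* cs w) + ∑ g (closedF X))
    ≡⟨ cong₂ (λ l e → g w + (∑ g l + e)) (closed*-push cs w) (∑-closedF g X) ⟩
  g w + (∑ g (closedF P) + (∑ (g ∘ proj₂) X + ∑ g (closedF (pushes X))))
    ≡⟨ lemma (g w) (∑ g (closedF P)) (∑ (g ∘ proj₂) X) _ ⟩
  g w + ∑ (g ∘ proj₂) X + (∑ g (closedF P) + ∑ g (closedF (pushes X)))
    ≡⟨ cong (g w + ∑ (g ∘ proj₂) X +_) (sym (trans (cong (∑ g) (concatMap-++ _ P (pushes X)))
                                                  (∑-++ g (closedF P) _))) ⟩
  g w + ∑ (g ∘ proj₂) X + ∑ g (closedF (P ++ pushes X)) ∎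
  where
  open ≡-Reasoning
  P = push (node cs , w)
  lemma : ∀ a b c d → a + (b + (c + d)) ≡ a + c + (b + d)
  lemma = solve-∀

trees-pushes : ∀ X → trees (pushes X) ≡ below (trees X)
trees-pushes []                  = refl
trees-pushes ((node cs , w) ∷ X) =
  trans (map-++ proj₁ (push (node cs , w)) (pushes X))
        (cong₂ _++_ (trans (sym (map-∘ cs)) (map-id cs)) (trees-pushes X))

-- Domination by levels, for the closed walks below a vertex and for all closed walks.

infix 4 _≼_

_≼_ : List Tree → List Tree → Set
X ≼ Y = ∀ i → Dom outdegree (level i X) (level i Y)

[]-Dom⇒[] : ∀ {f : A → ℕ} {ys} → Dom f [] ys → ys ≡ []
[]-Dom⇒[] {ys = []} _ = refl
[]-Dom⇒[] {ys = _ ∷ _} d with length-≡ d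
... | ()

Dom-[] : ∀ {f g : A → ℕ} {ys} → Dom g [] ys → Dom f [] ys
Dom-[] d rewrite []-Dom⇒[] d = ↭⇒Dom [] ↭-refl

-- Induction from the leaves upwards, with the height as measure: sums over children give `S` from
-- `D` one level lower, and solving the equation gives `D` from `S` on the same level.
Dom-D : ∀ h {X Y} → level h X ≡ [] → X ≼ Y → ∀ k → Dom (λ t → D t k) X Y
Dom-S : ∀ h {X Y} → level h X ≡ [] → X ≼ Y → ∀ k → Dom (λ t → S (ch t) k) X Y

Dom-D h empty X≼Y k = Dom-resp-≗ (λ { (node cs) → refl })
  (Dom-solve {f = λ _ → 𝟙} {s = λ t → S (ch t)}
    (λ j → Dom-const (𝟙 j) (length-≡ (X≼Y 0))) (Dom-S h empty X≼Y) k)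

Dom-S zero    refl  X≼Y k = Dom-[] (X≼Y 0)
Dom-S (suc h) empty X≼Y k = Dom-resp-≗ (λ t → sym (S-∑ (ch t) k))
  (Dom-∑-children ch (X≼Y 0) (Dom-D h empty (X≼Y ∘ suc) k))

pushes-children : ∀ X →
  pushes X ≡ map (λ y → proj₂ y , descend (proj₂ y) (proj₂ (proj₁ y))) (children (ch ∘ proj₁) X)
pushes-children []      = refl
pushes-children (x ∷ X) =
  trans (cong₂ _++_ (map-∘ (ch (proj₁ x))) (pushes-children X)) (sym (map-++ _ _ (children (ch ∘ proj₁) X)))

-- This direction runs from the root downwards: the equation at a child involves `D` and `S` at the
-- child, already dominated on its level, and the series of the parent, pulled back by `Dom-parent`.
Dom-pushes : ∀ h {X Y} → level h (trees X) ≡ [] → trees X ≼ trees Y →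
  (∀ k → Dom (at k) X Y) → ∀ k → Dom (at k) (pushes X) (pushes Y)
Dom-pushes zero {[]}        empty X≼Y d k rewrite []-Dom⇒[] (d 0) = ↭⇒Dom [] ↭-refl
Dom-pushes (suc h) {X} {Y} empty X≼Y d k =
  subst₂ (Dom (at k)) (sym (pushes-children X)) (sym (pushes-children Y))
    (Dom-map⁺ φ (Dom-solve {f = λ y → 𝟙 ⊕ delay (delay (D (proj₂ y) ⊛ proj₂ (proj₁ y)))}
                           {s = λ y → S (ch (proj₂ y))} inhomogeneous (Dom-child (Dom-S h empty (X≼Y ∘ suc))) k))
  where
  φ : Item × Tree → Item
  φ y = proj₂ y , descend (proj₂ y) (proj₂ (proj₁ y))
  o : Dom (length ∘ ch ∘ proj₁) X Y
  o = Dom-map⁻ proj₁ (X≼Y 0)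
  lengths : length (concatMap (ch ∘ proj₁) X) ≡ length (concatMap (ch ∘ proj₁) Y)
  lengths = trans (cong length (sym (concatMap-map ch proj₁ X)))
                  (trans (length-≡ (X≼Y 1)) (cong length (concatMap-map ch proj₁ Y)))
  Dom-child : ∀ {f : Tree → Series} → (∀ k → Dom (λ t → f t k) (below (trees X)) (below (trees Y))) →
    ∀ k → Dom (λ y → f (proj₂ y) k) (children (ch ∘ proj₁) X) (children (ch ∘ proj₁) Y)
  Dom-child e k = Dom-map⁻ proj₂ (subst₂ (Dom _) (eq X) (eq Y) (e k))
    where
    eq : ∀ Z → below (trees Z) ≡ map proj₂ (children (ch ∘ proj₁) Z)
    eq Z = trans (concatMap-map ch proj₁ Z) (sym (map-proj₂-children (ch ∘ proj₁) Z))
  inhomogeneous : ∀ k → Dom (λ y → (𝟙 ⊕ delay (delay (D (proj₂ y) ⊛ proj₂ (proj₁ y)))) k)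
    (children (ch ∘ proj₁) X) (children (ch ∘ proj₁) Y)
  inhomogeneous k = Dom-+
    (Dom-const (𝟙 k) (trans (length-children _ X) (trans lengths (sym (length-children _ Y)))))
    (Dom-delay {f = λ y → delay (D (proj₂ y) ⊛ proj₂ (proj₁ y))}
      (Dom-delay {f = λ y → D (proj₂ y) ⊛ proj₂ (proj₁ y)}
        (λ k → Dom-⊛ {f = λ y → D (proj₂ y)} {g = λ y → proj₂ (proj₁ y)} k
          (λ {j} _ → Dom-child (Dom-D h empty (X≼Y ∘ suc)) j)
          (λ {j} _ → Dom-parent (ch ∘ proj₁) o (d j) lengths))) k)

≼-pushes : ∀ {X Y} → trees X ≼ trees Y → trees (pushes X) ≼ trees (pushes Y)
≼-pushes {X} {Y} X≼Y i =
  subst₂ (λ P Q → Dom outdegree (level i P) (level i Q))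
    (sym (trees-pushes X)) (sym (trees-pushes Y)) (X≼Y (suc i))

-- Concatenated levels need not be in nonincreasing order, so of `Dom` only the inequality of
-- excesses, which add up over the levels, survives.
excess-closedF-≤ : ∀ h {X Y} → level h (trees X) ≡ [] → trees X ≼ trees Y →
  (∀ k → Dom (at k) X Y) → ∀ k τ →
  excess (_$ k) τ (closedF X) ≤ excess (_$ k) τ (closedF Y)
excess-closedF-≤ zero {[]} _ _ _ _ _ = z≤n
excess-closedF-≤ (suc h) {X} {Y} empty X≼Y d k τ =
  subst₂ _≤_ (sym (∑-closedF (λ w → w k ∸ τ) X)) (sym (∑-closedF (λ w → w k ∸ τ) Y))
    (+-mono-≤ (excess-≤ (d k) τ)
      (excess-closedF-≤ h (trans (cong (level h) (trees-pushes X)) empty) (≼-pushes {X} {Y} X≼Y)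
        (Dom-pushes (suc h) empty X≼Y d) k τ))

plevel : ℕ → List Item → List Item
plevel = iter pushes

-- Kept level by level for its `antitone` part, which later orders the values in the greedy tree.
Dom-plevel : ∀ h {X Y} → level h (trees X) ≡ [] → trees X ≼ trees Y →
  (∀ k → Dom (at k) X Y) → ∀ i k → Dom (at k) (plevel i X) (plevel i Y)
Dom-plevel h empty X≼Y d zero k = d k
Dom-plevel h {X} {Y} empty X≼Y d (suc i) k =
  Dom-plevel h (trans (cong (level h) (trees-pushes X)) (level-below h _ empty)) (≼-pushes {X} {Y} X≼Y)
    (Dom-pushes h empty X≼Y d) i k
  where
  level-below : ∀ h F → level h F ≡ [] → level h (below F) ≡ []
  level-below zero    F refl = refl
  level-below (suc h) F eq   = level-below h (below F) eq

-- Trees rooted at an edge.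

-- P and R are the series of closed walks at the ends of an edge whose removal
-- leaves subtrees with child series s and t, and x q is the series of walks from
-- one end to the other.

record EdgeSystem (s t P R q : Series) : Set where
  field
    P-eq  : P ≗ 𝟙 ⊕ delay (delay q) ⊕ delay (delay (s ⊛ P))
    R-eq  : R ≗ 𝟙 ⊕ delay (delay q) ⊕ delay (delay (t ⊛ R))
    q-eqˡ : q ≗ P ⊕ delay (delay (t ⊛ q))
    q-eqʳ : q ≗ R ⊕ delay (delay (s ⊛ q))

-- A walk from `A` to the root is a closed walk below `A`, a step along the edge and any closed walk
-- at the root, so q = D A ⊛ P. Unfolding the factor `D A` gives `q-eqˡ`; unfolding `P` gives
-- `q-eqʳ`, because D A ⊛ (1 + x² q) is `R`.
edgeSystem : ∀ A cs → let P = D (node (A ∷ cs)) in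
  EdgeSystem (S cs) (S (ch A)) P (descend A P) (D A ⊛ P)
edgeSystem A cs = record
  { P-eq  = P-eq
  ; R-eq  = solve-Solves _ t
  ; q-eqˡ = q-eq D-A P (D-Solves A)
  ; q-eqʳ = q-eqʳ
  }
  where
  open ≡-Reasoning
  P = D (node (A ∷ cs))
  R = descend A P
  D-A = D A
  s = S cs
  t = S (ch A)
  q = D-A ⊛ P
  q-eq : ∀ X h → X Solves 𝟙 , t → X ⊛ h ≗ h ⊕ delay (delay (t ⊛ (X ⊛ h)))
  q-eq X h eq k =
    trans (⊛-cong (solve-unique eq) (λ _ → refl) k)
      (trans (solve-𝟙-⊛ t h k)
        (trans (solve-Solves h t k)
          (cong (h k +_) (delay-cong (delay-cong (⊛-cong (λ _ → refl) λ j →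
            trans (sym (solve-𝟙-⊛ t h j)) (⊛-cong (sym ∘ solve-unique eq) (λ _ → refl) j))) k))))
  P-eq : P ≗ 𝟙 ⊕ delay (delay q) ⊕ delay (delay (s ⊛ P))
  P-eq k = begin
    P k                                                        ≡⟨ D-Solves (node (A ∷ cs)) k ⟩
    𝟙 k + delay (delay ((D-A ⊕ s) ⊛ P)) k
      ≡⟨ cong (𝟙 k +_) (delay-cong (λ j → trans (delay-cong (⊛-distribʳ-⊕ P D-A s) j) (delay-⊕ q (s ⊛ P) j)) k) ⟩
    𝟙 k + delay (delay q ⊕ delay (s ⊛ P)) k                    ≡⟨ cong (𝟙 k +_) (delay-⊕ (delay q) (delay (s ⊛ P)) k) ⟩
    𝟙 k + (delay (delay q) k + delay (delay (s ⊛ P)) k)        ≡⟨ sym (+-assoc (𝟙 k) _ _) ⟩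
    𝟙 k + delay (delay q) k + delay (delay (s ⊛ P)) k          ∎
  R-closed : R ≗ D-A ⊛ (𝟙 ⊕ delay (delay q))
  R-closed k = sym (trans (⊛-cong (solve-unique (D-Solves A)) (λ _ → refl) k) (solve-𝟙-⊛ t (𝟙 ⊕ delay (delay q)) k))
  D²-delay : ∀ f g → f ⊛ delay (delay g) ≗ delay (delay (f ⊛ g))
  D²-delay f g k = trans (⊛-delay f (delay g) k) (delay-cong (⊛-delay f g) k)
  q-eqʳ : q ≗ R ⊕ delay (delay (s ⊛ q))
  q-eqʳ k = begin
    (D-A ⊛ P) k
      ≡⟨ ⊛-cong (λ _ → refl) P-eq k ⟩
    (D-A ⊛ (𝟙 ⊕ delay (delay q) ⊕ delay (delay (s ⊛ P)))) k
      ≡⟨ ⊛-distribˡ-⊕ D-A (𝟙 ⊕ delay (delay q)) (delay (delay (s ⊛ P))) k ⟩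
    (D-A ⊛ (𝟙 ⊕ delay (delay q))) k + (D-A ⊛ delay (delay (s ⊛ P))) k
      ≡⟨ cong₂ _+_ (sym (R-closed k)) (D²-delay D-A (s ⊛ P) k) ⟩
    R k + delay (delay (D-A ⊛ (s ⊛ P))) k
      ≡⟨ cong (R k +_) (delay-cong (delay-cong swap) k) ⟩
    R k + delay (delay (s ⊛ q)) k ∎
    where
    swap : D-A ⊛ (s ⊛ P) ≗ s ⊛ q
    swap j = trans (sym (⊛-assoc D-A s P j))
               (trans (⊛-cong (⊛-comm D-A s) (λ _ → refl) j) (⊛-assoc s D-A P j))

Dom-pair : ∀ {f : A → ℕ} {g : B → ℕ} {a b c d a′ b′ c′ d′} →
  f a ≡ g a′ → f b ≡ g b′ → f c ≡ g c′ → f d ≡ g d′ →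
  Dom f (a ∷ b ∷ []) (c ∷ d ∷ []) → Dom g (a′ ∷ b′ ∷ []) (c′ ∷ d′ ∷ [])
Dom-pair a b c d e = record
  { antitone = (subst₂ _≤_ d c (All.head (AllPairs.head (antitone e))) ∷ []) ∷ [] ∷ []
  ; length-≡ = refl
  ; excess-≤ = λ τ → subst₂ _≤_ (cong₂ (λ m n → m ∸ τ + (n ∸ τ + 0)) a b)
                                (cong₂ (λ m n → m ∸ τ + (n ∸ τ + 0)) c d) (excess-≤ e τ)
  }

-- Closed walks at either end may cross the edge, so neither end can be settled before the other as
-- a parent is before its child: both ends and `q` are compared simultaneously, coefficient by
-- coefficient.
module EdgeDom {s t P R q s′ t′ P′ R′ q′ : Series}
  (sys : EdgeSystem s t P R q) (sys′ : EdgeSystem s′ t′ P′ R′ q′) where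

  private
    module E  = EdgeSystem sys
    module E′ = EdgeSystem sys′

  record End : Set where
    constructor end
    field
      child self across : Series

  open End

  xs ys : List End
  xs = end s P q ∷ end t R q ∷ []
  ys = end s′ P′ q′ ∷ end t′ R′ q′ ∷ []

  Dom-across : ∀ {k} → q k ≤ q′ k → Dom (λ x → across x k) xs ys
  Dom-across p = record
    { antitone = (≤-refl ∷ []) ∷ [] ∷ []
    ; length-≡ = refl
    ; excess-≤ = λ τ → +-mono-≤ (∸-monoˡ-≤ τ p) (+-monoˡ-≤ 0 (∸-monoˡ-≤ τ p))
    }

  -- The factor x² refers coefficient `k` to a strictly smaller one, where the induction hypothesis
  -- of `step` applies.
  Dom-delay² : ∀ {f : End → Series} k → (∀ {j} → j < k → Dom (λ x → f x j) xs ys) →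
    Dom (λ x → delay (delay (f x)) k) xs ys
  Dom-delay² zero          d = Dom-const 0 refl
  Dom-delay² (suc zero)    d = Dom-const 0 refl
  Dom-delay² (suc (suc k)) d = d (s≤s (n≤1+n k))

  module _ (children-Dom : ∀ k → Dom (λ x → child x k) xs ys) where

    step : ∀ k → (∀ {j} → j < k → Dom (λ x → self x j) xs ys × q j ≤ q′ j) →
      Dom (λ x → self x k) xs ys × q k ≤ q′ k
    step k IH = self-Dom , q≤q′
      where
      self-Dom : Dom (λ x → self x k) xs ys
      self-Dom = Dom-pair
        {f = λ x → 𝟙 k + delay (delay (across x)) k + delay (delay (child x ⊛ self x)) k}
        (sym (E.P-eq k)) (sym (E.R-eq k)) (sym (E′.P-eq k)) (sym (E′.R-eq k))
        (Dom-+ (Dom-+ (Dom-const (𝟙 k) refl) (Dom-delay² {f = across} k (Dom-across ∘ proj₂ ∘ IH)))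
               (Dom-delay² {f = λ x → child x ⊛ self x} k λ {j} j<k →
                 Dom-⊛ {f = child} {g = self} j (λ {i} _ → children-Dom i)
                       (λ i≤j → proj₁ (IH (≤-<-trans i≤j j<k)))))
      -- Each of the two equations for q alone has a coefficient that need not be
      -- dominated, but their sum only involves s + t and P + R.
      doubled : Dom (λ x → self x k + delay (delay (child x ⊛ across x)) k) xs ys
      doubled = Dom-+ self-Dom
        (Dom-delay² {f = λ x → child x ⊛ across x} k λ {j} j<k →
          Dom-⊛ {f = child} {g = across} j (λ {i} _ → children-Dom i)
                (λ i≤j → Dom-across (proj₂ (IH (≤-<-trans i≤j j<k)))))
      lemma : ∀ a b c d → a + d + (b + c) ≡ a + c + (b + d + 0)
      lemma = solve-∀
      double : ∀ {s t P R q} → EdgeSystem s t P R q →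
        q k + q k ≡ P k + delay (delay (s ⊛ q)) k + (R k + delay (delay (t ⊛ q)) k + 0)
      double {P = P} {R} e = trans (cong₂ _+_ (EdgeSystem.q-eqˡ e k) (EdgeSystem.q-eqʳ e k)) (lemma (P k) (R k) _ _)
      q≤q′ : q k ≤ q′ k
      q≤q′ = halve (subst₂ _≤_ (sym (double sys)) (sym (double sys′)) (Dom-total doubled))
        where
        halve : ∀ {m n} → m + m ≤ n + n → m ≤ n
        halve {m} {n} p = ≮⇒≥ λ n<m → <⇒≱ (+-mono-< n<m n<m) p

    self-Dom : ∀ k → Dom (λ x → self x k) xs ys
    self-Dom k = proj₁ (all (suc k) ≤-refl)
      where
      all : ∀ n {j} → j < n → Dom (λ x → self x j) xs ys × q j ≤ q′ j
      all (suc n) {j} (s≤s j≤n) = step j λ i<j → all n (<-≤-trans i<j j≤n)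

edgeItems : Tree → List Tree → List Item
edgeItems A cs = (node cs , P) ∷ (A , descend A P) ∷ []
  where P = D (node (A ∷ cs))

Dom-edgeItems : ∀ h {A cs A′ cs′} → level h (node cs ∷ A ∷ []) ≡ [] →
  (node cs ∷ A ∷ []) ≼ (node cs′ ∷ A′ ∷ []) → ∀ k → Dom (at k) (edgeItems A cs) (edgeItems A′ cs′)
Dom-edgeItems h {A} {cs} {A′} {cs′} empty dom k =
  Dom-pair {f = λ x → End.self x k} refl refl refl refl
    (self-Dom (λ j → Dom-pair {f = λ t → S (ch t) j} refl refl refl refl (Dom-S h empty dom j)) k)
  where open EdgeDom (edgeSystem A cs) (edgeSystem A′ cs′)

-- `descend` sees a parent only through its series, so cutting off the branch `A` while keeping the
-- series at both ends changes no value, only the order of listing.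
closed-edgeItems : ∀ A cs → closed (node (A ∷ cs)) (D (node (A ∷ cs))) ↭ closedF (edgeItems A cs)
closed-edgeItems A cs = prep P (↭-trans (Perm.++-comm (closed A (descend A P)) (closed* cs P))
  (↭-reflexive (cong (closed* cs P ++_) (sym (++-identityʳ _)))))
  where P = D (node (A ∷ cs))

-- Sorting the levels of a forest.

graft : List ℕ → List Tree → List Tree
graft []       ts = []
graft (o ∷ os) ts = node (take o ts) ∷ graft os (drop o ts)

below-graft : ∀ os ts → sum os ≡ length ts → below (graft os ts) ≡ ts
below-graft []       []  eq = refl
below-graft (o ∷ os) ts eq =
  trans (cong (take o ts ++_) (below-graft os (drop o ts) (sym (length-drop-sum o ts eq))))
        (take++drop≡id o ts)
  where
  length-drop-sum : ∀ o ts → o + sum os ≡ length ts → length (drop o ts) ≡ sum os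
  length-drop-sum o ts eq = trans (length-drop o ts) (trans (cong (_∸ o) (sym eq)) (m+n∸m≡n o (sum os)))

outdegree-graft : ∀ os ts → sum os ≤ length ts → map outdegree (graft os ts) ≡ os
outdegree-graft []       ts p = refl
outdegree-graft (o ∷ os) ts p = cong₂ _∷_
  (trans (length-take o ts) (m≤n⇒m⊓n≡m (≤-trans (m≤m+n o _) p)))
  (outdegree-graft os (drop o ts)
    (subst (sum os ≤_) (sym (length-drop o ts))
      (subst (_≤ length ts ∸ o) (m+n∸m≡n o (sum os)) (∸-monoˡ-≤ o p))))

Nonincreasing : List ℕ → Set
Nonincreasing = AllPairs _≥_

infix 4 _⟿_

_⟿_ : List Tree → List Tree → Set
X ⟿ Y = ∀ i → map outdegree (level i X) ↭ map outdegree (level i Y)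
             × Nonincreasing (map outdegree (level i Y))

⟿⇒≼ : ∀ {X Y} → X ⟿ Y → X ≼ Y
⟿⇒≼ X⟿Y i = Dom-map⁻ {f = id} outdegree (↭⇒Dom (proj₂ (X⟿Y i)) (proj₁ (X⟿Y i)))

length-below : ∀ F → length (below F) ≡ sum (map outdegree F)
length-below F = length-concatMap ch F

length-level-⟿ : ∀ {X Y} → X ⟿ Y → ∀ i → length (level i X) ≡ length (level i Y)
length-level-⟿ X⟿Y i = length-≡ (⟿⇒≼ X⟿Y i)

length≡0⇒[] : ∀ {xs : List A} → length xs ≡ 0 → xs ≡ []
length≡0⇒[] {xs = []} _ = refl

level-empty-⟿ : ∀ {X Y} → X ⟿ Y → ∀ h → level h X ≡ [] → level h Y ≡ []
level-empty-⟿ X⟿Y h eq = length≡0⇒[] (trans (sym (length-level-⟿ X⟿Y h)) (cong length eq))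

-- The forest below is sorted first; then the sorted outdegrees of the top level are grafted on it
-- from left to right. Sorting preserves their sum, so the trees below are exactly used up.
sort-levels : ∀ h X → level h X ≡ [] → ∃ λ Y → X ⟿ Y
sort-levels zero    [] _ = [] , all-empty
  where
  all-empty : [] ⟿ []
  all-empty zero    = ↭-refl , []
  all-empty (suc i) = all-empty i
sort-levels (suc h) X  eq with sort-levels h (below X) eq | ∃-sorted id (map outdegree X)
... | Y , X⟿Y | os , os↭ , anti = graft os Y , λ
  { zero    → subst (λ l → map outdegree X ↭ l × Nonincreasing l) (sym os-graft) (↭-sym os↭ , anti)
  ; (suc i) → subst (λ F → map outdegree (level i (below X)) ↭ map outdegree (level i F)
                         × Nonincreasing (map outdegree (level i F)))
                    (sym (below-graft os Y sum-os)) (X⟿Y i)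
  }
  where
  sum-os : sum os ≡ length Y
  sum-os = trans (sum-↭ os↭) (trans (sym (length-below X)) (length-level-⟿ X⟿Y 0))
  os-graft : map outdegree (graft os Y) ≡ os
  os-graft = outdegree-graft os Y (≤-reflexive sum-os)

-- Outdegree multisets, sizes and depth sums.

mutual
  outdegrees : Tree → List ℕ
  outdegrees (node cs) = length cs ∷ outdegrees* cs

  outdegrees* : List Tree → List ℕ
  outdegrees* []       = []
  outdegrees* (c ∷ cs) = outdegrees c ++ outdegrees* cs

outdegrees*-++ : ∀ F G → outdegrees* (F ++ G) ≡ outdegrees* F ++ outdegrees* G
outdegrees*-++ []      G = refl
outdegrees*-++ (t ∷ F) G = trans (cong (outdegrees t ++_) (outdegrees*-++ F G)) (sym (++-assoc (outdegrees t) _ _))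

outdegrees*-below : ∀ F → outdegrees* F ↭ map outdegree F ++ outdegrees* (below F)
outdegrees*-below []            = ↭-refl
outdegrees*-below (node cs ∷ F) = prep (length cs) (↭-trans
  (Perm.++⁺ˡ (outdegrees* cs) (outdegrees*-below F))
  (↭-trans (Perm.shifts (outdegrees* cs) (map outdegree F))
    (Perm.++⁺ˡ (map outdegree F) (↭-reflexive (sym (outdegrees*-++ cs (below F)))))))

outdegrees*-⟿ : ∀ h {X Y} → level h X ≡ [] → X ⟿ Y → outdegrees* X ↭ outdegrees* Y
outdegrees*-⟿ zero    {X} {Y} refl X⟿Y with refl ← level-empty-⟿ X⟿Y 0 refl = ↭-refl
outdegrees*-⟿ (suc h) {X} {Y} eq  X⟿Y =
  ↭-trans (outdegrees*-below X)
    (↭-trans (Perm.++⁺ (proj₁ (X⟿Y 0)) (outdegrees*-⟿ h eq (X⟿Y ∘ suc)))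
             (↭-sym (outdegrees*-below Y)))

size* : List Tree → ℕ
size* F = length (outdegrees* F)

size*-below : ∀ F → size* F ≡ length F + size* (below F)
size*-below F = trans (Perm.↭-length (outdegrees*-below F))
  (trans (length-++ (map outdegree F)) (cong (_+ size* (below F)) (length-map outdegree F)))

size*-++ : ∀ F G → size* (F ++ G) ≡ size* F + size* G
size*-++ F G = trans (cong length (outdegrees*-++ F G)) (length-++ (outdegrees* F))

mutual
  totalDepth : Tree → ℕ
  totalDepth (node cs) = size* cs + totalDepth* cs

  totalDepth* : List Tree → ℕ
  totalDepth* []       = 0
  totalDepth* (c ∷ cs) = totalDepth c + totalDepth* cs

totalDepth*-++ : ∀ F G → totalDepth* (F ++ G) ≡ totalDepth* F + totalDepth* G
totalDepth*-++ []      G = refl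
totalDepth*-++ (t ∷ F) G = trans (cong (totalDepth t +_) (totalDepth*-++ F G)) (sym (+-assoc (totalDepth t) _ _))

totalDepth*-below : ∀ F → totalDepth* F ≡ size* (below F) + totalDepth* (below F)
totalDepth*-below []            = refl
totalDepth*-below (node cs ∷ F) = begin
  size* cs + totalDepth* cs + totalDepth* F
    ≡⟨ cong (size* cs + totalDepth* cs +_) (totalDepth*-below F) ⟩
  size* cs + totalDepth* cs + (size* (below F) + totalDepth* (below F))
    ≡⟨ interchange (size* cs) (totalDepth* cs) (size* (below F)) _ ⟩
  size* cs + size* (below F) + (totalDepth* cs + totalDepth* (below F))
    ≡⟨ sym (cong₂ _+_ (size*-++ cs (below F)) (totalDepth*-++ cs (below F))) ⟩
  size* (cs ++ below F) + totalDepth* (cs ++ below F) ∎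
  where open ≡-Reasoning

totalDepth*-⟿ : ∀ h {X Y} → level h X ≡ [] → X ⟿ Y → totalDepth* X ≡ totalDepth* Y
totalDepth*-⟿ zero    {X} {Y} refl X⟿Y with refl ← level-empty-⟿ X⟿Y 0 refl = refl
totalDepth*-⟿ (suc h) {X} {Y} eq  X⟿Y =
  trans (totalDepth*-below X)
    (trans (cong₂ _+_ (Perm.↭-length (outdegrees*-⟿ h eq (X⟿Y ∘ suc))) (totalDepth*-⟿ h eq (X⟿Y ∘ suc)))
           (sym (totalDepth*-below Y)))

size*-mono : ∀ h {X Y} → level h X ≡ [] → (∀ i → length (level i Y) ≤ length (level i X)) →
  size* Y ≤ size* X
size*-mono zero    {Y = []}    refl p = z≤n
size*-mono zero    {Y = _ ∷ _} refl p with p 0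
... | ()
size*-mono (suc h) {X} {Y} eq p =
  subst₂ _≤_ (sym (size*-below Y)) (sym (size*-below X)) (+-mono-≤ (p 0) (size*-mono h eq (p ∘ suc)))

-- A single strictly shorter level would make the total size strictly smaller.
size*-≡⇒levels-≡ : ∀ h {X Y} → level h X ≡ [] → (∀ i → length (level i Y) ≤ length (level i X)) →
  size* X ≤ size* Y → ∀ i → length (level i Y) ≡ length (level i X)
size*-≡⇒levels-≡ zero {Y = Y} refl p le i =
  ≤-antisym (p i) (subst (_≤ length (level i Y)) (sym (cong length (level-[] i))) z≤n)
  where
  level-[] : ∀ i → level i [] ≡ []
  level-[] zero    = refl
  level-[] (suc i) = level-[] i
size*-≡⇒levels-≡ (suc h) {X} {Y} eq p le = λ
  { zero    → ≤-antisym (p 0) (+-cancelʳ-≤ (size* (below X)) _ _ (≤-trans le′ (+-monoʳ-≤ (length Y) below-≤)))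
  ; (suc i) → size*-≡⇒levels-≡ h eq (p ∘ suc)
      (+-cancelˡ-≤ (length X) _ _ (≤-trans le′ (+-monoˡ-≤ _ (p 0)))) i
  }
  where
  le′ : length X + size* (below X) ≤ length Y + size* (below Y)
  le′ = subst₂ _≤_ (size*-below X) (size*-below Y) le
  below-≤ : size* (below Y) ≤ size* (below X)
  below-≤ = size*-mono h eq (p ∘ suc)

-- Breadth-first sequences and alternating levels of two forests.

level-++ : ∀ i F G → level i (F ++ G) ≡ level i F ++ level i G
level-++ zero    F G = refl
level-++ (suc i) F G = trans (cong (level i) (concatMap-++ ch F G)) (level-++ i (below F) (below G))

below-level : ∀ i F → below (level i F) ≡ level (suc i) F
below-level zero    F = refl
below-level (suc i) F = below-level i (below F)

-- Generic in step and value because it is used for outdegrees along `below` and for closed walk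
-- counts along `pushes`.
breadthFirst : (List A → List A) → (A → ℕ) → ℕ → List A → List ℕ
breadthFirst f v zero    F = []
breadthFirst f v (suc h) F = map v F ++ breadthFirst f v h (f F)

bfs : ℕ → List Tree → List ℕ
bfs = breadthFirst below outdegree

bfs-↭ : ∀ h {F} → level h F ≡ [] → bfs h F ↭ outdegrees* F
bfs-↭ zero        refl = ↭-refl
bfs-↭ (suc h) {F} eq   =
  ↭-trans (Perm.++⁺ˡ (map outdegree F) (bfs-↭ h eq)) (↭-sym (outdegrees*-below F))

++-cancel-length : ∀ {xs ys us vs : List A} → length xs ≡ length us → xs ++ ys ≡ us ++ vs → xs ≡ us × ys ≡ vs
++-cancel-length {xs = []}    {us = []}    _   eq = refl , eq
++-cancel-length {xs = _ ∷ _} {us = _ ∷ _} len eq with ∷-injective eq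
... | refl , eq′ = let p , q = ++-cancel-length (suc-injective len) eq′ in cong (_ ∷_) p , q

forest-≡ : ∀ {F G} → map outdegree F ≡ map outdegree G → below F ≡ below G → F ≡ G
forest-≡ {[]}          {[]}          _ _  = refl
forest-≡ {node cs ∷ F} {node ds ∷ G} o eq with ∷-injective o
... | p , ps with ++-cancel-length {xs = cs} {us = ds} p eq
... | refl , eq′ = cong (node cs ∷_) (forest-≡ ps eq′)

-- The outdegrees of one level tell the length of the next, hence where each level ends in the
-- sequence; the forest is then rebuilt from its deepest level.
bfs-injective : ∀ h {F G} → level h F ≡ [] → level h G ≡ [] → length F ≡ length G →
  bfs h F ≡ bfs h G → F ≡ G
bfs-injective zero            refl refl _   _  = refl
bfs-injective (suc h) {F} {G} eqF  eqG  len eq =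
  let p , q = ++-cancel-length (trans (length-map outdegree F) (trans len (sym (length-map outdegree G)))) eq in
  forest-≡ p (bfs-injective h eqF eqG
    (trans (length-below F) (trans (cong sum p) (sym (length-below G)))) q)

nonincreasing-↭⇒≡ : ∀ {xs ys} → Nonincreasing xs → Nonincreasing ys → xs ↭ ys → xs ≡ ys
nonincreasing-↭⇒≡ xs↘ ys↘ p = Pointwise-≡⇒≡ (↗↭↗⇒≋ ≥-totalOrder
  (AllPairs⇒Sorted ≥-totalOrder xs↘) (AllPairs⇒Sorted ≥-totalOrder ys↘) (↭⇒↭ₛ p))
  where open DecTotalOrder ≥-decTotalOrder using () renaming (totalOrder to ≥-totalOrder)

interleave : (List A → List A) → (A → ℕ) → List A → List A → ℕ → List ℕ
interleave f v F G zero    = map v F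
interleave f v F G (suc j) = interleave f v G (f F) j

catenate : (ℕ → List ℕ) → ℕ → List ℕ
catenate Z zero    = []
catenate Z (suc h) = Z 0 ++ catenate (Z ∘ suc) h

catenate-bounded : ∀ {b} Z → (∀ j → Nonincreasing (Z j ++ Z (suc j))) →
  (∀ j → Z j ≡ [] → Z (suc j) ≡ []) → All (_≤ b) (Z 0) → ∀ h → All (_≤ b) (catenate Z h)
catenate-bounded     Z ps empty q zero    = []
catenate-bounded {b} Z ps empty q (suc h) =
  All.++⁺ q (catenate-bounded (Z ∘ suc) (ps ∘ suc) (empty ∘ suc) (next (Z 0) refl q (ps 0)) h)
  where
  next : ∀ zs → Z 0 ≡ zs → All (_≤ b) zs → Nonincreasing (zs ++ Z 1) → All (_≤ b) (Z 1)
  next []       eq _        _       = subst (All (_≤ b)) (sym (empty 0 eq)) []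
  next (z ∷ zs) _  (z≤b ∷ _) (p ∷ _) = All.map (λ r → ≤-trans r z≤b) (All.++⁻ʳ zs p)

-- Comparisons of neighbouring blocks chain together only through nonempty blocks; the second
-- hypothesis rules out a gap.
catenate-nonincreasing : ∀ Z → (∀ j → Nonincreasing (Z j ++ Z (suc j))) →
  (∀ j → Z j ≡ [] → Z (suc j) ≡ []) → ∀ h → Nonincreasing (catenate Z h)
catenate-nonincreasing Z ps empty zero    = []
catenate-nonincreasing Z ps empty (suc h) =
  let Z₀ , _ , cross = AllPairs-++⁻ (Z 0) (ps 0) in
  AllPairs.++⁺ Z₀ (catenate-nonincreasing (Z ∘ suc) (ps ∘ suc) (empty ∘ suc) h)
    (All.map (λ q → catenate-bounded (Z ∘ suc) (ps ∘ suc) (empty ∘ suc) q h) cross)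

module _ {A : Set} (f : List A → List A) (v : A → ℕ) where

  interleave-nonincreasing : ∀ F G →
    (∀ i → Nonincreasing (map v (iter f i F) ++ map v (iter f i G))) →
    (∀ i → Nonincreasing (map v (iter f i G) ++ map v (iter f (suc i) F))) →
    ∀ j → Nonincreasing (interleave f v F G j ++ interleave f v F G (suc j))
  interleave-nonincreasing F G p q zero    = p 0
  interleave-nonincreasing F G p q (suc j) = interleave-nonincreasing G (f F) q (p ∘ suc) j

  breadthFirst-interleave : (∀ F G → f (F ++ G) ≡ f F ++ f G) → ∀ h F G →
    breadthFirst f v h (F ++ G) ≡ catenate (interleave f v F G) (h + h)
  breadthFirst-interleave f-++ zero    F G = refl
  breadthFirst-interleave f-++ (suc h) F G rewrite +-suc h h = begin
    map v (F ++ G) ++ breadthFirst f v h (f (F ++ G))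
      ≡⟨ cong₂ _++_ (map-++ v F G)
           (trans (cong (breadthFirst f v h) (f-++ F G)) (breadthFirst-interleave f-++ h (f F) (f G))) ⟩
    (map v F ++ map v G) ++ catenate (interleave f v (f F) (f G)) (h + h)
      ≡⟨ ++-assoc (map v F) _ _ ⟩
    map v F ++ map v G ++ catenate (interleave f v (f F) (f G)) (h + h) ∎
    where open ≡-Reasoning

-- If a nonempty block has no children, its first entry is a leaf; as outdegrees do not increase,
-- the next block consists of leaves too, so emptiness is passed on.
interleave-empty : ∀ F G →
  (∀ j → Nonincreasing (interleave below outdegree F G j ++ interleave below outdegree F G (suc j))) →
  (F ≡ [] → G ≡ []) → (G ≡ [] → below F ≡ []) →
  ∀ j → interleave below outdegree F G j ≡ [] → interleave below outdegree F G (suc j) ≡ []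
interleave-empty []      G ps p q zero    eq rewrite p refl = refl
interleave-empty F       G ps p q (suc j) eq = interleave-empty G (below F) (ps ∘ suc) q (next F p (ps 0)) j eq
  where
  leaves : ∀ G → All (_≤ 0) (map outdegree G) → below G ≡ []
  leaves []            _        = refl
  leaves (node [] ∷ G) (_ ∷ qs) = leaves G qs
  next : ∀ F → (F ≡ [] → G ≡ []) → Nonincreasing (map outdegree F ++ map outdegree G) → below F ≡ [] → below G ≡ []
  next []            p _       _ rewrite p refl = refl
  next (node [] ∷ F) p (r ∷ _) _ = leaves G (All.++⁻ʳ (map outdegree F) r)

-- Approaching the greedy tree.

-- The degree of a non-root vertex is its outdegree plus one, so the strict inequality says that the
-- root has maximal degree.
RootMaximal : Tree → Set
RootMaximal T = All (_< outdegree T) (outdegrees* (ch T))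

closedExcess : ℕ → ℕ → Tree → ℕ
closedExcess k τ T = excess (_$ k) τ (closed T (D T))

rootItem : Tree → Item
rootItem T = T , D T

closedF-rootItem : ∀ T → closedF [ rootItem T ] ≡ closed T (D T)
closedF-rootItem T = ++-identityʳ _

Dom-rootItem : ∀ h {T T′} → level h [ T ] ≡ [] → [ T ] ≼ [ T′ ] →
  ∀ k → Dom (at k) [ rootItem T ] [ rootItem T′ ]
Dom-rootItem h empty dom k = Dom-map⁺ rootItem (Dom-D h empty dom k)

sort-root-≤ : ∀ h {T T′} → level h [ T ] ≡ [] → [ T ] ⟿ [ T′ ] →
  ∀ k τ → closedExcess k τ T ≤ closedExcess k τ T′
sort-root-≤ h {T} {T′} empty T⟿T′ k τ =
  subst₂ (λ l l′ → excess (_$ k) τ l ≤ excess (_$ k) τ l′) (closedF-rootItem T) (closedF-rootItem T′)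
    (excess-closedF-≤ h {[ rootItem T ]} {[ rootItem T′ ]} empty (⟿⇒≼ T⟿T′)
      (Dom-rootItem h empty (⟿⇒≼ T⟿T′)) k τ)

sort-edge-≤ : ∀ h {A cs A′ cs′} → level h (node cs ∷ A ∷ []) ≡ [] →
  (node cs ∷ A ∷ []) ⟿ (node cs′ ∷ A′ ∷ []) →
  ∀ k τ → closedExcess k τ (node (A ∷ cs)) ≤ closedExcess k τ (node (A′ ∷ cs′))
sort-edge-≤ h {A} {cs} {A′} {cs′} empty sorted k τ =
  subst₂ _≤_ (sym (∑-↭ _ (closed-edgeItems A cs))) (sym (∑-↭ _ (closed-edgeItems A′ cs′)))
    (excess-closedF-≤ h {edgeItems A cs} {edgeItems A′ cs′} empty (⟿⇒≼ sorted)
      (Dom-edgeItems h empty (⟿⇒≼ sorted)) k τ)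

below-⟿ : ∀ {F G F′ G′} → F ++ G ⟿ F′ ++ G′ → below F ++ below G ⟿ below F′ ++ below G′
below-⟿ {F} {G} {F′} {G′} p =
  subst₂ _⟿_ (concatMap-++ ch F G) (concatMap-++ ch F′ G′) (p ∘ suc)

-- The outdegrees on `F` are some of those on the joint level, and after sorting at least as many of
-- the largest ones stand in front, on `F′`; so `F′` has no fewer children. At an edge this means
-- that the other side can only shrink.
first-part-grows : ∀ i {F G F′ G′} → F ++ G ⟿ F′ ++ G′ → length F ≤ length F′ →
  length (level i F) ≤ length (level i F′)
first-part-grows zero    p le = le
first-part-grows (suc i) {F} {G} {F′} {G′} p le = first-part-grows i (below-⟿ {F} {G} {F′} {G′} p) (begin
  length (below F)                               ≡⟨ length-below F ⟩
  ∑ outdegree F                                  ≤⟨ Dom⇒∑≤∑take (⟿⇒≼ p 0) (sub G ↭-refl) ⟩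
  ∑ outdegree (take (length F) (F′ ++ G′))       ≤⟨ ∑-take-mono outdegree le (F′ ++ G′) ⟩
  ∑ outdegree (take (length F′) (F′ ++ G′))      ≡⟨ cong (∑ outdegree) (take-++-length F′ G′) ⟩
  ∑ outdegree F′                                 ≡⟨ length-below F′ ⟨
  length (below F′)                              ∎)
  where open ≤-Reasoning

level-lengths : ∀ i {F G F′ G′} → F ++ G ⟿ F′ ++ G′ →
  length (level i F) + length (level i G) ≡ length (level i F′) + length (level i G′)
level-lengths i {F} {G} {F′} {G′} p = trans (sym (split F G)) (trans (length-level-⟿ p i) (split F′ G′))
  where
  split : ∀ F G → length (level i (F ++ G)) ≡ length (level i F) + length (level i G)
  split F G = trans (cong length (level-++ i F G)) (length-++ (level i F))

+-≡-≤⇒≥ : ∀ {a b c d} → a + b ≡ c + d → a ≤ c → d ≤ b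
+-≡-≤⇒≥ {a} {b} {c} {d} eq a≤c = +-cancelˡ-≤ c d b (≤-trans (≤-reflexive (sym eq)) (+-monoˡ-≤ b a≤c))

-- Exchanging x ∈ b for y ∈ a cannot increase a sum that is already maximal.

maximal-sum⇒separated : ∀ {a b a′ b′} → b ++ a ↭ b′ ++ a′ → Nonincreasing (b′ ++ a′) →
  length b ≡ length b′ → sum b ≡ sum b′ → All (λ x → All (_≤ x) a) b
maximal-sum⇒separated {a} {b} {a′} {b′} p anti len sums =
  All.tabulate λ {x} x∈b → All.tabulate λ {y} y∈a →
    let l , r , b≡ = ∈-∃++ x∈b ; m , n , a≡ = ∈-∃++ y∈a in
    exchange x y (l ++ r) (m ++ n)
      (↭-trans (↭-reflexive b≡) (Perm.shift x l r)) (↭-trans (↭-reflexive a≡) (Perm.shift y m n))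
  where
  open ≤-Reasoning
  exchange : ∀ x y b₀ a₀ → b ↭ x ∷ b₀ → a ↭ y ∷ a₀ → y ≤ x
  exchange x y b₀ a₀ b↭ a↭ = +-cancelʳ-≤ (sum b₀) y x (begin
    sum (y ∷ b₀)                               ≡⟨ cong sum (sym (map-id (y ∷ b₀))) ⟩
    ∑ id (y ∷ b₀)                              ≤⟨ Dom⇒∑≤∑take (↭⇒Dom anti p) (sub (x ∷ a₀) exchanged) ⟩
    ∑ id (take (suc (length b₀)) (b′ ++ a′))
      ≡⟨ cong (λ m → ∑ id (take m (b′ ++ a′))) (trans (sym (Perm.↭-length b↭)) len) ⟩
    ∑ id (take (length b′) (b′ ++ a′))         ≡⟨ cong sum (trans (map-id _) (take-++-length b′ a′)) ⟩
    sum b′                                     ≡⟨ sym sums ⟩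
    sum b                                      ≡⟨ sum-↭ b↭ ⟩
    sum (x ∷ b₀)                               ∎)
    where
    exchanged : (y ∷ b₀) ++ (x ∷ a₀) ↭ b ++ a
    exchanged = ↭-trans (prep y (Perm.shift x b₀ a₀))
      (↭-trans (_↭_.swap y x ↭-refl)
      (↭-trans (prep x (↭-sym (Perm.shift y b₀ a₀)))
               (↭-sym (Perm.++⁺ b↭ a↭))))

-- The levels of node (A ∷ cs) seen from its root and from the edge between the root and A.

record Interleaved (A : Tree) (cs : List Tree) : Set where
  field
    edge-levels : ∀ i → Nonincreasing (map outdegree (level i [ node cs ]) ++ map outdegree (level i [ A ]))
    root-levels : ∀ i → Nonincreasing (map outdegree (level i [ A ]) ++ map outdegree (level (suc i) [ node cs ]))

  consecutive : ∀ j → Nonincreasing (interleave below outdegree [ node cs ] [ A ] j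
                                  ++ interleave below outdegree [ node cs ] [ A ] (suc j))
  consecutive = interleave-nonincreasing below outdegree [ node cs ] [ A ] edge-levels root-levels

  empty : ∀ j → interleave below outdegree [ node cs ] [ A ] j ≡ [] →
                interleave below outdegree [ node cs ] [ A ] (suc j) ≡ []
  empty = interleave-empty [ node cs ] [ A ] consecutive (λ ()) (λ ())

  bfs-nonincreasing : ∀ h → Nonincreasing (bfs h (A ∷ cs))
  bfs-nonincreasing h = subst Nonincreasing
    (sym (trans (breadthFirst-interleave below outdegree (concatMap-++ ch) h [ A ] cs)
                (cong (λ G → catenate (interleave below outdegree [ A ] G) (h + h)) (sym (++-identityʳ cs)))))
    (AllPairs.tail (catenate-nonincreasing _ consecutive empty (suc (h + h))))

module _ {A : Set} (f : List A → List A) (v : A → ℕ) where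

  levels-nonincreasing : ∀ F → (∀ h → Nonincreasing (breadthFirst f v h F)) →
    ∀ i → Nonincreasing (map v (iter f i F) ++ map v (iter f (suc i) F))
  levels-nonincreasing F p zero    =
    subst (λ l → Nonincreasing (map v F ++ l)) (++-identityʳ (map v (f F))) (p 2)
  levels-nonincreasing F p (suc i) =
    levels-nonincreasing (f F) (λ h → proj₁ (proj₂ (AllPairs-++⁻ (map v F) (p (suc h))))) i

Greedy : Tree → Set
Greedy T = RootMaximal T × (∀ h → Nonincreasing (bfs h (ch T)))

RootMaximal⇒first-child : ∀ A cs → RootMaximal (node (A ∷ cs)) → outdegree A ≤ length cs
RootMaximal⇒first-child (node _) cs (p ∷ _) = s≤s⁻¹ p

map-level-++ : ∀ i F G → map outdegree (level i (F ++ G)) ≡ map outdegree (level i F) ++ map outdegree (level i G)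
map-level-++ i F G = trans (cong (map outdegree) (level-++ i F G)) (map-++ outdegree (level i F) (level i G))

AllPairs-drop-outer : ∀ {R : A → A → Set} as bs cs ds → AllPairs R ((as ++ bs) ++ (cs ++ ds)) → AllPairs R (bs ++ cs)
AllPairs-drop-outer as bs cs ds p =
  let l , r , c = AllPairs-++⁻ (as ++ bs) p in
  AllPairs.++⁺ (proj₁ (proj₂ (AllPairs-++⁻ as l))) (proj₁ (AllPairs-++⁻ cs r))
    (All.map (All.++⁻ˡ cs) (All.++⁻ʳ as c))

-- Two consecutive root levels read A_i, B_(i+1), A_(i+1), B_(i+2): the first two blocks are a root
-- level, the middle two an edge level. The top edge level comes from the maximal degree of the
-- root.
Greedy⇒Interleaved : ∀ A cs → Greedy (node (A ∷ cs)) → Interleaved A cs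
Greedy⇒Interleaved A cs (rootmax , sorted) = record
  { edge-levels = λ
      { zero    → (RootMaximal⇒first-child A cs rootmax ∷ []) ∷ [] ∷ []
      ; (suc i) → subst (λ F → Nonincreasing (map outdegree (level i F) ++ map outdegree (level (suc i) [ A ])))
                    (sym (++-identityʳ cs))
                    (AllPairs-drop-outer (map outdegree (level i [ A ])) _ (map outdegree (level (suc i) [ A ])) _
                      (subst₂ (λ l m → Nonincreasing (l ++ m)) (map-level-++ i [ A ] cs) (map-level-++ (suc i) [ A ] cs)
                        (consecutive-levels i)))
      }
  ; root-levels = λ i → subst (λ F → Nonincreasing (map outdegree (level i [ A ]) ++ map outdegree (level i F)))
      (sym (++-identityʳ cs))
      (subst Nonincreasing (map-level-++ i [ A ] cs) (proj₁ (AllPairs-++⁻ _ (consecutive-levels i))))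
  }
  where
  consecutive-levels : ∀ i →
    Nonincreasing (map outdegree (level i (A ∷ cs)) ++ map outdegree (level (suc i) (A ∷ cs)))
  consecutive-levels = levels-nonincreasing below outdegree (A ∷ cs) sorted

-- If `A` loses no vertex, no level of either side changes its length. The outdegrees on a level of
-- the rest sum to the length of its next level, which is the same after sorting; so this sum was
-- already maximal and `maximal-sum⇒separated` applies.
stable⇒Interleaved : ∀ h {A cs A′ cs′} → level h (node cs ∷ A ∷ []) ≡ [] →
  (∀ i → Nonincreasing (map outdegree (level i (A ∷ cs)))) →
  (node cs ∷ A ∷ []) ⟿ (node cs′ ∷ A′ ∷ []) → size* [ A ] ≤ size* [ A′ ] → Interleaved A cs
stable⇒Interleaved h {A} {cs} {A′} {cs′} empty sorted ⟿′ size = record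
  { edge-levels = λ i → AllPairs.++⁺ (first-sorted i) (proj₁ (AllPairs-++⁻ _ (root-levels i))) (separated i)
  ; root-levels = root-levels
  }
  where
  rest  = [ node cs ]
  rest′ = [ node cs′ ]
  root-levels : ∀ i → Nonincreasing (map outdegree (level i [ A ]) ++ map outdegree (level (suc i) rest))
  root-levels i = subst (λ F → Nonincreasing (map outdegree (level i [ A ]) ++ map outdegree (level i F)))
    (sym (++-identityʳ cs)) (subst Nonincreasing (map-level-++ i [ A ] cs) (sorted i))
  first-sorted : ∀ i → Nonincreasing (map outdegree (level i rest))
  first-sorted zero    = [] ∷ []
  first-sorted (suc i) = proj₁ (proj₂ (AllPairs-++⁻ (map outdegree (level i [ A ])) (root-levels i)))
  empty-A : level h [ A ] ≡ []
  empty-A = length≡0⇒[] (n≤0⇒n≡0 (≤-trans (length-++-≤ʳ _ {level h rest})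
    (≤-reflexive (trans (cong length (sym (level-++ h rest [ A ]))) (cong length empty)))))
  lengths : ∀ i → length (level i rest) + length (level i [ A ]) ≡ length (level i rest′) + length (level i [ A′ ])
  lengths i = level-lengths i {rest} {[ A ]} {rest′} {[ A′ ]} ⟿′
  A-≡ : ∀ i → length (level i [ A′ ]) ≡ length (level i [ A ])
  A-≡ = size*-≡⇒levels-≡ h {[ A ]} {[ A′ ]} empty-A
    (λ i → +-≡-≤⇒≥ (lengths i) (first-part-grows i {rest} {[ A ]} {rest′} {[ A′ ]} ⟿′ ≤-refl)) size
  B-≡ : ∀ i → length (level i rest) ≡ length (level i rest′)
  B-≡ i = +-cancelʳ-≡ (length (level i [ A ])) _ _
    (trans (lengths i) (cong (length (level i rest′) +_) (A-≡ i)))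
  sum-level : ∀ i F → sum (map outdegree (level i F)) ≡ length (level (suc i) F)
  sum-level i F = trans (sym (length-below (level i F))) (cong length (below-level i F))
  separated : ∀ i → All (λ x → All (_≤ x) (map outdegree (level i [ A ]))) (map outdegree (level i rest))
  separated i = maximal-sum⇒separated {b′ = map outdegree (level i rest′)}
    (subst₂ _↭_ (map-level-++ i rest [ A ]) (map-level-++ i rest′ [ A′ ]) (proj₁ (⟿′ i)))
    (subst Nonincreasing (map-level-++ i rest′ [ A′ ]) (proj₂ (⟿′ i)))
    (trans (length-map outdegree (level i rest)) (trans (B-≡ i) (sym (length-map outdegree (level i rest′)))))
    (trans (sum-level i rest) (trans (B-≡ (suc i)) (sym (sum-level i rest′))))

level-split : ∀ h F G → level h (F ++ G) ≡ [] → level h F ≡ [] × level h G ≡ []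
level-split h F G eq = ++-conicalˡ _ _ eq′ , ++-conicalʳ _ _ eq′
  where eq′ = trans (sym (level-++ h F G)) eq

level-suc : ∀ h F → level h F ≡ [] → level (suc h) F ≡ []
level-suc zero    F refl = refl
level-suc (suc h) F eq   = level-suc h (below F) eq

level-+ : ∀ m h F → level h F ≡ [] → level (m + h) F ≡ []
level-+ zero    h F eq = eq
level-+ (suc m) h F eq = level-suc (m + h) F (level-+ m h F eq)

edge-height : ∀ h A cs → level h (A ∷ cs) ≡ [] → level (suc h) (node cs ∷ A ∷ []) ≡ []
edge-height h A cs empty =
  let a , c = level-split h [ A ] cs empty in
  trans (level-++ (suc h) [ node cs ] [ A ])
        (cong₂ _++_ (trans (cong (level h) (++-identityʳ cs)) c) (level-suc h [ A ] a))

sort-tree : ∀ h T → level h [ T ] ≡ [] → ∃ λ T′ → [ T ] ⟿ [ T′ ]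
sort-tree h T empty with sort-levels h [ T ] empty
... | []         , p with () ← length-level-⟿ p 0
... | T′ ∷ []    , p = T′ , p
... | _ ∷ _ ∷ _  , p with () ← length-level-⟿ p 0

sort-pair : ∀ h T U → level h (T ∷ U ∷ []) ≡ [] →
  ∃₂ λ cs U′ → (T ∷ U ∷ []) ⟿ (node cs ∷ U′ ∷ [])
sort-pair h T U empty with sort-levels h (T ∷ U ∷ []) empty
... | []                 , p with () ← length-level-⟿ p 0
... | _ ∷ []             , p with () ← length-level-⟿ p 0
... | node cs ∷ U′ ∷ []  , p = cs , U′ , p
... | _ ∷ _ ∷ _ ∷ _      , p with () ← length-level-⟿ p 0

-- Descent to the greedy tree along the depth sum.

module Approach {T* : Tree} {h* : ℕ} (empty* : level h* (ch T*) ≡ []) (greedy* : Greedy T*) where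

  -- Nonincreasing sequences with the same entries coincide, and a breadth-first sequence determines
  -- its forest; so the descent ends at the greedy tree itself, as a plane tree.
  same-bfs⇒≡ : ∀ h cs → level h cs ≡ [] → (∀ j → Nonincreasing (bfs j cs)) →
    length cs ≡ outdegree T* → outdegrees* cs ↭ outdegrees* (ch T*) → cs ≡ ch T*
  same-bfs⇒≡ h cs empty sorted len perm =
    bfs-injective H emptyH empty*H len
      (nonincreasing-↭⇒≡ (sorted H) (proj₂ greedy* H)
        (↭-trans (bfs-↭ H emptyH) (↭-trans perm (↭-sym (bfs-↭ H empty*H)))))
    where
    H = h* + h
    emptyH : level H cs ≡ []
    emptyH = level-+ h* h cs empty
    empty*H : level H (ch T*) ≡ []
    empty*H = subst (λ m → level m (ch T*) ≡ []) (+-comm h h*) (level-+ h h* (ch T*) empty*)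

  -- Every round starts with a sort from the root, since stability at the edge yields the greedy
  -- order only if the root levels are sorted. That sort leaves the depth sum unchanged.
  approach : ∀ n T → totalDepth T < n → ∀ h → level h [ T ] ≡ [] → RootMaximal T →
    outdegree T ≡ outdegree T* → outdegrees* (ch T) ↭ outdegrees* (ch T*) →
    ∀ k τ → closedExcess k τ T ≤ closedExcess k τ T*
  approach (suc n) T depth (suc h) emptyT rootmax len perm k τ
    with T₁ , T⟿T₁ ← sort-tree (suc h) T emptyT =
    ≤-trans (sort-root-≤ (suc h) emptyT T⟿T₁ k τ) (after-root-sort T₁ T⟿T₁)
    where
    after-root-sort : ∀ T₁ → [ T ] ⟿ [ T₁ ] → closedExcess k τ T₁ ≤ closedExcess k τ T*
    after-root-sort T₁ T⟿T₁ = go T₁ len₁ perm₁ depth₁ rootmax₁ empty₁ sorted₁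
      where
      outdegrees-root : ∀ T → outdegrees* [ T ] ≡ outdegree T ∷ outdegrees* (ch T)
      outdegrees-root (node cs) = ++-identityʳ _
      od : outdegree T₁ ≡ outdegree T
      od = sym (proj₁ (∷-injective (Perm.↭-singleton-inv (proj₁ (T⟿T₁ 0)))))
      len₁ : outdegree T₁ ≡ outdegree T*
      len₁ = trans od len
      perm-T : outdegrees* (ch T₁) ↭ outdegrees* (ch T)
      perm-T = Perm.drop-∷ (↭-trans (↭-reflexive (cong (_∷ outdegrees* (ch T₁)) (sym od)))
        (subst₂ _↭_ (outdegrees-root T₁) (outdegrees-root T) (↭-sym (outdegrees*-⟿ (suc h) emptyT T⟿T₁))))
      perm₁ : outdegrees* (ch T₁) ↭ outdegrees* (ch T*)
      perm₁ = ↭-trans perm-T perm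
      depth₁ : totalDepth T₁ ≤ n
      depth₁ = ≤-trans (≤-reflexive (+-cancelʳ-≡ 0 _ _ (sym (totalDepth*-⟿ (suc h) emptyT T⟿T₁)))) (s≤s⁻¹ depth)
      rootmax₁ : RootMaximal T₁
      rootmax₁ = subst (λ d → All (_< d) (outdegrees* (ch T₁))) (sym od)
        (Perm.All-resp-↭ (↭-sym perm-T) rootmax)
      empty₁ : level h (ch T₁) ≡ []
      empty₁ = subst (λ F → level h F ≡ []) (++-identityʳ (ch T₁)) (level-empty-⟿ T⟿T₁ (suc h) emptyT)
      sorted₁ : ∀ i → Nonincreasing (map outdegree (level i (ch T₁)))
      sorted₁ i = subst (λ F → Nonincreasing (map outdegree (level i F))) (++-identityʳ (ch T₁)) (proj₂ (T⟿T₁ (suc i)))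

      finish : ∀ cs → cs ≡ ch T* → closedExcess k τ (node cs) ≤ closedExcess k τ T*
      finish cs refl = ≤-reflexive (cong (closedExcess k τ) (η T*))
        where
        η : ∀ T → node (ch T) ≡ T
        η (node _) = refl

      go : ∀ T₁ → outdegree T₁ ≡ outdegree T* → outdegrees* (ch T₁) ↭ outdegrees* (ch T*) →
        totalDepth T₁ ≤ n → RootMaximal T₁ → level h (ch T₁) ≡ [] →
        (∀ i → Nonincreasing (map outdegree (level i (ch T₁)))) →
        closedExcess k τ T₁ ≤ closedExcess k τ T*
      go (node []) len _ _ _ _ _ = finish [] (sym (length≡0⇒[] (sym len)))
      go (node (A ∷ cs)) len perm depth rootmax empty sorted
        with cs′ , A′ , ⟿Z ← sort-pair (suc h) (node cs) A (edge-height h A cs empty)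
        with size* [ A ] ≤? size* [ A′ ]
      ... | yes stable = finish (A ∷ cs)
              (same-bfs⇒≡ h (A ∷ cs) empty
                (Interleaved.bfs-nonincreasing
                  (stable⇒Interleaved (suc h) {A} {cs} {A′} {cs′} (edge-height h A cs empty) sorted ⟿Z stable))
                len perm)
      ... | no smaller = ≤-trans (sort-edge-≤ (suc h) (edge-height h A cs empty) ⟿Z k τ)
              -- Rejoining the ends of the edge may raise the height bound; termination rests on `n`
              -- alone.
              (approach n (node (A′ ∷ cs′)) depth′ (2 + h) empty′ rootmax′ len′ perm′ k τ)
        where
        empty-edge = edge-height h A cs empty
        -- The root has maximal degree, so the two ends are already in order without their common
        -- edge, and sorting leaves both outdegrees in place.
        same-od : length cs′ ∷ outdegree A′ ∷ [] ≡ length cs ∷ outdegree A ∷ []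
        same-od = nonincreasing-↭⇒≡ (proj₂ (⟿Z 0))
          ((RootMaximal⇒first-child A cs rootmax ∷ []) ∷ [] ∷ []) (↭-sym (proj₁ (⟿Z 0)))
        same-cs : length cs′ ≡ length cs
        same-cs = proj₁ (∷-injective same-od)
        len′ : suc (length cs′) ≡ outdegree T*
        len′ = trans (cong suc same-cs) len
        regroup : ∀ A cs → outdegrees* (node cs ∷ A ∷ []) ↭ length cs ∷ outdegrees* (A ∷ cs)
        regroup A cs = prep (length cs) (↭-trans (Perm.++-comm (outdegrees* cs) (outdegrees A ++ []))
          (↭-reflexive (cong (_++ outdegrees* cs) (++-identityʳ (outdegrees A)))))
        perm-step : outdegrees* (A′ ∷ cs′) ↭ outdegrees* (A ∷ cs)
        perm-step = Perm.drop-∷ (↭-trans (↭-reflexive (cong (_∷ outdegrees* (A′ ∷ cs′)) (sym same-cs)))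
          (↭-trans (↭-sym (regroup A′ cs′))
            (↭-trans (↭-sym (outdegrees*-⟿ (suc h) empty-edge ⟿Z)) (regroup A cs))))
        perm′ = ↭-trans perm-step perm
        rootmax′ : RootMaximal (node (A′ ∷ cs′))
        rootmax′ = subst (λ d → All (_< suc d) (outdegrees* (A′ ∷ cs′))) (sym same-cs)
          (Perm.All-resp-↭ (↭-sym perm-step) rootmax)
        empty-parts = level-split (suc h) [ node cs′ ] [ A′ ] (level-empty-⟿ ⟿Z (suc h) empty-edge)
        empty′ : level (2 + h) [ node (A′ ∷ cs′) ] ≡ []
        empty′ = trans (cong (level (suc h)) (++-identityʳ (A′ ∷ cs′)))
          (trans (level-++ (suc h) [ A′ ] cs′)
            (cong₂ _++_ (proj₂ empty-parts)
              (level-suc h cs′ (trans (cong (level h) (sym (++-identityʳ cs′))) (proj₁ empty-parts)))))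
        -- Here a and s are the sizes of the branch and of the other children, e and d their depth
        -- sums. Rejoining the edge moves the branch one step down, so the depth sum of the tree is
        -- that of the pair plus a.
        shorter : ∀ a s a′ s′ d d′ e e′ → a′ < a → (s + d) + (e + 0) ≡ (s′ + d′) + (e′ + 0) →
          (a′ + s′) + (e′ + d′) < (a + s) + (e + d)
        shorter a s a′ s′ d d′ e e′ lt eq =
          subst₂ _<_ (sym (lemma a′ s′ e′ d′)) (trans (cong (a +_) (sym eq)) (sym (lemma a s e d))) (+-monoˡ-< _ lt)
          where
          lemma : ∀ a s e d → (a + s) + (e + d) ≡ a + ((s + d) + (e + 0))
          lemma = solve-∀
        size-split : ∀ A cs → totalDepth (node (A ∷ cs)) ≡ (size* [ A ] + size* cs) + (totalDepth A + totalDepth* cs)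
        size-split A cs = cong (_+ (totalDepth A + totalDepth* cs)) (size*-++ [ A ] cs)
        depth′ : totalDepth (node (A′ ∷ cs′)) < n
        depth′ = <-≤-trans (subst₂ _<_ (sym (size-split A′ cs′)) (sym (size-split A cs))
          (shorter (size* [ A ]) (size* cs) (size* [ A′ ]) (size* cs′)
            (totalDepth* cs) (totalDepth* cs′) (totalDepth A) (totalDepth A′)
            (≰⇒> smaller) (totalDepth*-⟿ (suc h) empty-edge ⟿Z))) depth

-- The closed walk counts along a breadth-first traversal of a greedy tree.

interleave-trees : ∀ (v : Item → ℕ) X Y j →
  length (interleave pushes v X Y j) ≡ length (interleave below outdegree (trees X) (trees Y) j)
interleave-trees v X Y zero    =
  trans (length-map v X) (sym (trans (length-map outdegree (trees X)) (length-map proj₁ X)))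
interleave-trees v X Y (suc j) =
  trans (interleave-trees v Y (pushes X) j)
        (cong (λ F → length (interleave below outdegree (trees Y) F j)) (trees-pushes X))

plevel-++ : ∀ i X Y → plevel i (X ++ Y) ≡ plevel i X ++ plevel i Y
plevel-++ zero    X Y = refl
plevel-++ (suc i) X Y = trans (cong (plevel i) (concatMap-++ push X Y)) (plevel-++ i (pushes X) (pushes Y))

-- A greedy tree is its own sorted form in both views. Comparing it with itself leaves just the
-- `antitone` part of the domination, and the two views chain these level orders together.
Greedy-closed-nonincreasing : ∀ {h T} → level h [ T ] ≡ [] → Greedy T →
  ∀ k m → Nonincreasing (breadthFirst pushes (at k) m [ rootItem T ])
Greedy-closed-nonincreasing {h} {T} empty greedy k zero = []
Greedy-closed-nonincreasing {h} {node []} empty greedy k (suc m) =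
  subst (λ l → Nonincreasing (_ ∷ l)) (sym (nothing m)) ([] ∷ [])
  where
  nothing : ∀ m → breadthFirst pushes (at k) m [] ≡ []
  nothing zero    = refl
  nothing (suc m) = nothing m
Greedy-closed-nonincreasing {h} {node (A ∷ cs)} empty greedy k (suc m) =
  subst (λ l → Nonincreasing (P k ∷ l))
    (sym (breadthFirst-interleave pushes (at k) (concatMap-++ push) m [ (A , R) ] (pushes [ (node cs , P) ])))
    (catenate-nonincreasing Z consecutive Z-empty (suc (m + m)))
  where
  P = D (node (A ∷ cs))
  R = descend A P
  rest  = [ (node cs , P) ]
  Z = interleave pushes (at k) rest [ (A , R) ]
  module I = Interleaved (Greedy⇒Interleaved A cs greedy)
  height : level h (node cs ∷ A ∷ []) ≡ []
  height = lift-height h empty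
    where
    lift-height : ∀ h → level h [ node (A ∷ cs) ] ≡ [] → level h (node cs ∷ A ∷ []) ≡ []
    lift-height (suc h) eq = edge-height h A cs (trans (cong (level h) (sym (++-identityʳ (A ∷ cs)))) eq)
  edge⟿ : (node cs ∷ A ∷ []) ⟿ (node cs ∷ A ∷ [])
  edge⟿ i = ↭-refl , subst Nonincreasing (sym (map-level-++ i [ node cs ] [ A ])) (I.edge-levels i)
  root⟿ : [ node (A ∷ cs) ] ⟿ [ node (A ∷ cs) ]
  root⟿ zero    = ↭-refl , [] ∷ []
  root⟿ (suc i) = ↭-refl , subst Nonincreasing
    (sym (map-level-++ i [ A ] (cs ++ []))) (I.root-levels i)
  split : ∀ i X Y → Antitone (at k) (plevel i (X ++ Y)) →
    Nonincreasing (map (at k) (plevel i X) ++ map (at k) (plevel i Y))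
  split i X Y anti = subst Nonincreasing
    (trans (cong (map (at k)) (plevel-++ i X Y)) (map-++ (at k) (plevel i X) (plevel i Y)))
    (AllPairs.map⁺ anti)
  consecutive : ∀ j → Nonincreasing (Z j ++ Z (suc j))
  consecutive = interleave-nonincreasing pushes (at k) rest [ (A , R) ]
    (λ i → split i rest [ (A , R) ]
      (antitone (Dom-plevel h {edgeItems A cs} height (⟿⇒≼ edge⟿) (Dom-edgeItems h height (⟿⇒≼ edge⟿)) i k)))
    (λ i → split i [ (A , R) ] (pushes rest)
      (antitone (Dom-plevel h {[ rootItem (node (A ∷ cs)) ]} empty (⟿⇒≼ root⟿)
                           (Dom-rootItem h empty (⟿⇒≼ root⟿)) (suc i) k)))
  -- Emptiness of a block depends only on its trees, so it is inherited from the blocks of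
  -- outdegrees.
  Z-empty : ∀ j → Z j ≡ [] → Z (suc j) ≡ []
  Z-empty j eq = length≡0⇒[] (trans (interleave-trees (at k) rest [ (A , R) ] (suc j))
    (cong length (I.empty j (length≡0⇒[] (trans (sym (interleave-trees (at k) rest [ (A , R) ] j)) (cong length eq))))))

-- Counting walks.

ind : ∀ {p} {P : Set p} → Dec P → ℕ
ind d = if does d then 1 else 0

ind-yes : ∀ {p} {P : Set p} (d : Dec P) → P → ind d ≡ 1
ind-yes (yes _) _ = refl
ind-yes (no ¬p) p = ⊥-elim (¬p p)

ind-no : ∀ {p} {P : Set p} (d : Dec P) → ¬ P → ind d ≡ 0
ind-no (yes p) ¬p = ⊥-elim (¬p p)
ind-no (no _)  _  = refl

ind-⇔ : ∀ {p q} {P : Set p} {Q : Set q} (d : Dec P) (e : Dec Q) → (P → Q) → (Q → P) → ind d ≡ ind e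
ind-⇔ (yes p) e f g = sym (ind-yes e (f p))
ind-⇔ (no ¬p) e f g = sym (ind-no e (¬p ∘ g))

ind-× : ∀ {p q} {P : Set p} {Q : Set q} (d : Dec P) (e : Dec Q) → ind (d ×-dec e) ≡ ind d * ind e
ind-× d e with does d
... | true  = sym (+-identityʳ _)
... | false = refl

∑-filter : ∀ {p} {P : A → Set p} (P? : ∀ x → Dec (P x)) (f : A → ℕ) xs →
  ∑ f (filter P? xs) ≡ ∑ (λ x → ind (P? x) * f x) xs
∑-filter P? f []       = refl
∑-filter P? f (x ∷ xs) with does (P? x)
... | true  = cong₂ _+_ (sym (+-identityʳ (f x))) (∑-filter P? f xs)
... | false = ∑-filter P? f xs

length-∑ : ∀ (xs : List A) → length xs ≡ ∑ (const 1) xs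
length-∑ xs = sym (trans (∑-const 1 xs) (*-identityʳ _))

length-filter-∑ : ∀ {p} {P : A → Set p} (P? : ∀ x → Dec (P x)) xs →
  length (filter P? xs) ≡ ∑ (λ x → ind (P? x)) xs
length-filter-∑ P? xs =
  trans (length-∑ (filter P? xs)) (trans (∑-filter P? (const 1) xs) (∑-cong (λ x → *-identityʳ _) xs))

∑-swap : ∀ (f : A → B → ℕ) xs ys → ∑ (λ x → ∑ (f x) ys) xs ≡ ∑ (λ y → ∑ (λ x → f x y) xs) ys
∑-swap f []       ys = sym (trans (∑-const 0 ys) (*-zeroʳ (length ys)))
∑-swap f (x ∷ xs) ys =
  trans (cong (∑ (f x) ys +_) (∑-swap f xs ys)) (sym (∑-+ (f x) (λ y → ∑ (λ x → f x y) xs) ys))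

∑-*ʳ : ∀ c (f : A → ℕ) xs → ∑ (λ x → f x * c) xs ≡ ∑ f xs * c
∑-*ʳ c f xs = trans (∑-cong (λ x → *-comm (f x) c) xs) (trans (∑-*ˡ c f xs) (*-comm c _))

∑-zero : ∀ (f : A → ℕ) → (∀ x → f x ≡ 0) → ∀ xs → ∑ f xs ≡ 0
∑-zero f p xs = trans (∑-cong p xs) (trans (∑-const 0 xs) (*-zeroʳ (length xs)))

∑-allFin-suc : ∀ {n} (f : Fin (suc n) → ℕ) → ∑ f (allFin (suc n)) ≡ f zero + ∑ (f ∘ suc) (allFin n)
∑-allFin-suc f = cong (f zero +_)
  (trans (cong (∑ f) (sym (map-tabulate id suc))) (∑-map f suc (allFin _)))

∑-δ : ∀ {n} (u : Fin n) (g : Fin n → ℕ) → ∑ (λ x → ind (x ≟ᶠ u) * g x) (allFin n) ≡ g u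
∑-δ {suc n} zero    g = begin
  ∑ (λ x → ind (x ≟ᶠ zero) * g x) (allFin (suc n))  ≡⟨ ∑-allFin-suc (λ x → ind (x ≟ᶠ zero) * g x) ⟩
  g zero + 0 + ∑ (const 0) (allFin n)               ≡⟨ cong (g zero + 0 +_) (∑-zero (const 0) (λ _ → refl) (allFin n)) ⟩
  g zero + 0 + 0                                    ≡⟨ trans (+-identityʳ _) (+-identityʳ _) ⟩
  g zero                                            ∎
  where open ≡-Reasoning
∑-δ {suc n} (suc u) g = trans (∑-allFin-suc (λ x → ind (x ≟ᶠ suc u) * g x)) (∑-δ u (g ∘ suc))

∑-≥ : ∀ {n} (f : Fin n → ℕ) v → f v ≤ ∑ f (allFin n)
∑-≥ {n} f v = subst (_≤ ∑ f (allFin n)) (∑-δ v f) (∑-mono (λ x → bound (x ≟ᶠ v) (f x)) (allFin n))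
  where
  bound : ∀ {p} {P : Set p} (d : Dec P) m → ind d * m ≤ m
  bound (yes _) m = ≤-reflexive (+-identityʳ m)
  bound (no _)  m = z≤n

∑-cartesianProductWith : ∀ {C : Set} (f : A → B → C) (g : C → ℕ) xs ys →
  ∑ g (List.cartesianProductWith f xs ys) ≡ ∑ (λ x → ∑ (λ y → g (f x y)) ys) xs
∑-cartesianProductWith f g []       ys = refl
∑-cartesianProductWith f g (x ∷ xs) ys =
  trans (∑-++ g (map (f x) ys) _) (cong₂ _+_ (∑-map g (f x) ys) (∑-cartesianProductWith f g xs ys))

module Walks {n} (G : Graph n) where
  open Graph G

  walks : ℕ → Fin n → Fin n → ℕ
  walks zero    u v = ind (u ≟ᶠ v)
  walks (suc k) u v = ∑ (λ z → ind (u ~? z) * walks k z v) (allFin n)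

  count-walks : ∀ k u v → length (filter (isWalk? u v) (vectors n (suc k))) ≡ walks k u v
  count-walks k u v = trans (length-filter-∑ (isWalk? u v) (vectors n (suc k))) (go k u)
    where
    open ≡-Reasoning
    rest : ∀ {k} → Vec (Fin n) (suc k) → ℕ
    rest w = ind (Vec.last w ≟ᶠ v) * ind (linked? _~?_ w)
    split : ∀ u {k} (w : Vec (Fin n) (suc k)) → ind (isWalk? u v w) ≡ ind (Vec.head w ≟ᶠ u) * rest w
    split u w = trans (ind-× (Vec.head w ≟ᶠ u) ((Vec.last w ≟ᶠ v) ×-dec linked? _~?_ w))
                      (cong (ind (Vec.head w ≟ᶠ u) *_) (ind-× (Vec.last w ≟ᶠ v) (linked? _~?_ w)))
    from : ∀ k u → ∑ (λ w → ind (isWalk? u v w)) (vectors n (suc k)) ≡ ∑ (λ w → rest (u Vec.∷ w)) (vectors n k)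
    from k u = begin
      ∑ (λ w → ind (isWalk? u v w)) (vectors n (suc k))
        ≡⟨ ∑-cartesianProductWith Vec._∷_ _ (allFin n) (vectors n k) ⟩
      ∑ (λ x → ∑ (λ w → ind (isWalk? u v (x Vec.∷ w))) (vectors n k)) (allFin n)
        ≡⟨ ∑-cong (λ x → trans (∑-cong (λ w → split u (x Vec.∷ w)) (vectors n k))
                               (∑-*ˡ (ind (x ≟ᶠ u)) _ (vectors n k))) (allFin n) ⟩
      ∑ (λ x → ind (x ≟ᶠ u) * ∑ (λ w → rest (x Vec.∷ w)) (vectors n k)) (allFin n)
        ≡⟨ ∑-δ u _ ⟩
      ∑ (λ w → rest (u Vec.∷ w)) (vectors n k) ∎
    go : ∀ k u → ∑ (λ w → ind (isWalk? u v w)) (vectors n (suc k)) ≡ walks k u v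
    go zero    u = trans (from zero u) (trans (+-identityʳ _) (*-identityʳ _))
    go (suc k) u = begin
      ∑ (λ w → ind (isWalk? u v w)) (vectors n (2 + k))
        ≡⟨ from (suc k) u ⟩
      ∑ (λ w → rest (u Vec.∷ w)) (vectors n (suc k))
        ≡⟨ ∑-cartesianProductWith Vec._∷_ _ (allFin n) (vectors n k) ⟩
      ∑ (λ z → ∑ (λ w → rest (u Vec.∷ z Vec.∷ w)) (vectors n k)) (allFin n)
        ≡⟨ ∑-cong (λ z → trans (∑-cong (step z) (vectors n k)) (∑-*ˡ (ind (u ~? z)) _ (vectors n k))) (allFin n) ⟩
      ∑ (λ z → ind (u ~? z) * ∑ (λ w → rest (z Vec.∷ w)) (vectors n k)) (allFin n)
        ≡⟨ ∑-cong (λ z → cong (ind (u ~? z) *_) (trans (sym (from k z)) (go k z))) (allFin n) ⟩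
      ∑ (λ z → ind (u ~? z) * walks k z v) (allFin n) ∎
      where
      lemma : ∀ a b c → a * (b * c) ≡ b * (a * c)
      lemma = solve-∀
      step : ∀ z w → rest (u Vec.∷ z Vec.∷ w) ≡ ind (u ~? z) * rest (z Vec.∷ w)
      step z w = trans (cong (ind (Vec.last (z Vec.∷ w) ≟ᶠ v) *_) (ind-× (u ~? z) (linked? _~?_ (z Vec.∷ w))))
                       (lemma (ind (Vec.last (z Vec.∷ w) ≟ᶠ v)) (ind (u ~? z)) (ind (linked? _~?_ (z Vec.∷ w))))

  closedWalks-walks : ∀ k v → closedWalks k G v ≡ walks k v v
  closedWalks-walks k v = count-walks k v v

  walks-sucʳ : ∀ k u v → walks (suc k) u v ≡ ∑ (λ z → walks k u z * ind (z ~? v)) (allFin n)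
  walks-sucʳ zero u v = begin
    ∑ (λ z → ind (u ~? z) * ind (z ≟ᶠ v)) (allFin n)  ≡⟨ ∑-cong (λ z → *-comm (ind (u ~? z)) _) (allFin n) ⟩
    ∑ (λ z → ind (z ≟ᶠ v) * ind (u ~? z)) (allFin n)  ≡⟨ ∑-δ v _ ⟩
    ind (u ~? v)                                      ≡⟨ sym (∑-δ u (λ z → ind (z ~? v))) ⟩
    ∑ (λ z → ind (z ≟ᶠ u) * ind (z ~? v)) (allFin n)
      ≡⟨ ∑-cong (λ z → cong (_* ind (z ~? v)) (ind-⇔ (z ≟ᶠ u) (u ≟ᶠ z) sym sym)) (allFin n) ⟩
    ∑ (λ z → ind (u ≟ᶠ z) * ind (z ~? v)) (allFin n)  ∎
    where open ≡-Reasoning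
  walks-sucʳ (suc k) u v = begin
    ∑ (λ y → ind (u ~? y) * walks (suc k) y v) (allFin n)
      ≡⟨ ∑-cong (λ y → cong (ind (u ~? y) *_) (walks-sucʳ k y v)) (allFin n) ⟩
    ∑ (λ y → ind (u ~? y) * ∑ (λ z → walks k y z * ind (z ~? v)) (allFin n)) (allFin n)
      ≡⟨ ∑-cong (λ y → sym (∑-*ˡ (ind (u ~? y)) _ (allFin n))) (allFin n) ⟩
    ∑ (λ y → ∑ (λ z → ind (u ~? y) * (walks k y z * ind (z ~? v))) (allFin n)) (allFin n)
      ≡⟨ ∑-swap _ (allFin n) (allFin n) ⟩
    ∑ (λ z → ∑ (λ y → ind (u ~? y) * (walks k y z * ind (z ~? v))) (allFin n)) (allFin n)
      ≡⟨ ∑-cong (λ z → trans (∑-cong (λ y → sym (*-assoc (ind (u ~? y)) _ _)) (allFin n))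
                             (∑-*ʳ (ind (z ~? v)) _ (allFin n))) (allFin n) ⟩
    ∑ (λ z → walks (suc k) u z * ind (z ~? v)) (allFin n) ∎
    where open ≡-Reasoning

  -- A closed walk that first steps to the father comes back downwards, whereas `walks-up` counts
  -- walks from the lower end; reversal links the two.
  walks-sym : ∀ k u v → walks k u v ≡ walks k v u
  walks-sym zero    u v = ind-⇔ (u ≟ᶠ v) (v ≟ᶠ u) sym sym
  walks-sym (suc k) u v = begin
    ∑ (λ z → ind (u ~? z) * walks k z v) (allFin n)
      ≡⟨ ∑-cong (λ z → trans (cong₂ _*_ (ind-⇔ (u ~? z) (z ~? u) ~-sym ~-sym) (walks-sym k z v))
                             (*-comm (ind (z ~? u)) _)) (allFin n) ⟩
    ∑ (λ z → walks k v z * ind (z ~? u)) (allFin n)  ≡⟨ sym (walks-sucʳ k v u) ⟩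
    walks (suc k) v u                                ∎
    where open ≡-Reasoning

-- The rooted tree structure of a connected acyclic graph.

least : ∀ {P : ℕ → Set} → (∀ k → Dec (P k)) → ∀ k → P k → ∃ λ m → P m × (∀ {j} → P j → m ≤ j)
least P? k Pk with P? 0
least P? k       Pk | yes P0 = 0 , P0 , λ _ → z≤n
least P? zero    P0 | no ¬P0 = ⊥-elim (¬P0 P0)
least P? (suc k) Pk | no ¬P0 =
  let m , Pm , min = least (P? ∘ suc) k Pk in
  suc m , Pm , λ { {zero} P0 → ⊥-elim (¬P0 P0) ; {suc j} Pj → s≤s (min Pj) }

module SimplePaths {n} (R : Fin n → Fin n → Set) where

  SimplePath : Fin n → Fin n → ∀ {k} → Vec (Fin n) (suc k) → Set
  SimplePath u v w = Vec.head w ≡ u × Vec.last w ≡ v × Linked R w × VecUnique.Unique w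

  -- Loop erasure, one vertex at a time: before `u` is prepended to a simple path, the path is cut
  -- at `u` if it passes there.
  drop-until : ∀ u {v x k} (w : Vec (Fin n) (suc k)) → SimplePath x v w →
    VecAll.All (u ≢_) w ⊎ (∃₂ λ j (w′ : Vec (Fin n) (suc j)) → SimplePath u v w′)
  drop-until u (y ∷ w) path with u ≟ᶠ y
  drop-until u (y ∷ w)     (_ , l , ls , us)             | yes refl = inj₂ (-, y ∷ w , refl , l , ls , us)
  drop-until u (y ∷ [])    _                             | no u≢y   = inj₁ (u≢y VecAll.∷ VecAll.[])
  drop-until u (y ∷ z ∷ w) (_ , l , _ ∷ ls , _ VecAllPairs.∷ us) | no u≢y with drop-until u (z ∷ w) (refl , l , ls , us)
  ... | inj₁ avoids = inj₁ (u≢y VecAll.∷ avoids)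
  ... | inj₂ found  = inj₂ found

  simplePath : ∀ {u v} → Star R u v → ∃₂ λ k (w : Vec (Fin n) (suc k)) → SimplePath u v w
  simplePath {u} ε = 0 , u ∷ [] , refl , refl , [-] , VecAll.[] VecAllPairs.∷ VecAllPairs.[]
  simplePath {u} (u~z ◅ rest) with simplePath rest
  ... | k , w , path@(refl , l , ls , us) with drop-until u w path
  ... | inj₁ avoids = suc k , u ∷ w , refl , l , u~z ∷ ls , avoids VecAllPairs.∷ us
  ... | inj₂ found  = found

module RootedTree {n} (G : Graph n) (isTree : IsTree G) (r : Fin n) where
  open Graph G
  open IsTree isTree

  data Walk : ℕ → Fin n → Fin n → Set where
    nil  : ∀ {v} → Walk 0 v v
    step : ∀ {k u z v} → u ~ z → Walk k z v → Walk (suc k) u v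

  walk? : ∀ k u v → Dec (Walk k u v)
  walk? zero    u v = map′ (λ { refl → nil }) (λ { nil → refl }) (u ≟ᶠ v)
  walk? (suc k) u v = map′ (λ (_ , e , w) → step e w) (λ { (step e w) → -, e , w })
    (any? λ z → (u ~? z) ×-dec walk? k z v)

  snoc : ∀ {k u v z} → Walk k u v → v ~ z → Walk (suc k) u z
  snoc nil        e = step e nil
  snoc (step d w) e = step d (snoc w e)

  reverse : ∀ {k u v} → Walk k u v → Walk k v u
  reverse nil        = nil
  reverse (step e w) = snoc (reverse w) (~-sym e)

  IsWalk⇒Walk : ∀ {k u v} (w : Vec (Fin n) (suc k)) → IsWalk u v w → Walk k u v
  IsWalk⇒Walk (x ∷ [])    (refl , refl , _)      = nil
  IsWalk⇒Walk (x ∷ y ∷ w) (refl , l , e ∷ es) = step e (IsWalk⇒Walk (y ∷ w) (refl , l , es))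

  Walk⇒IsWalk : ∀ {k u v} → Walk k u v → ∃ λ (w : Vec (Fin n) (suc k)) → IsWalk u v w
  Walk⇒IsWalk nil = _ ∷ [] , refl , refl , [-]
  Walk⇒IsWalk (step e w) with Walk⇒IsWalk w
  ... | ws , refl , l , es = _ ∷ ws , refl , l , e ∷ es

  private
    shortest : ∀ v → ∃ λ m → Walk m v r × (∀ {j} → Walk j v r → m ≤ j)
    shortest v = let k , w , isWalk = connected v r in least (λ k → walk? k v r) k (IsWalk⇒Walk w isWalk)

  abstract
    lev : Fin n → ℕ
    lev v = proj₁ (shortest v)

    lev-walk : ∀ v → Walk (lev v) v r
    lev-walk v = proj₁ (proj₂ (shortest v))

    lev-minimal : ∀ {v j} → Walk j v r → lev v ≤ j
    lev-minimal {v} = proj₂ (proj₂ (shortest v))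

  lev-root : lev r ≡ 0
  lev-root = n≤0⇒n≡0 (lev-minimal nil)

  lev≡0⇒root : ∀ {v} → lev v ≡ 0 → v ≡ r
  lev≡0⇒root {v} eq with lev v | lev-walk v
  lev≡0⇒root refl | _ | nil = refl

  Height-lev : ∀ v → Rooted.Height G r v (lev v)
  Height-lev v = Walk⇒IsWalk (reverse (lev-walk v)) , λ w isWalk → lev-minimal (reverse (IsWalk⇒Walk w isWalk))

  private
    second : ∀ {k v} → Walk k v r → Fin n
    second {v = v} nil    = v
    second (step {z = z} _ _) = z

    second-walk : ∀ {k v i} (w : Walk k v r) → k ≡ suc i → v ~ second w × Walk i (second w) r
    second-walk (step e w) refl = e , w

  abstract
    par : Fin n → Fin n
    par v = second (lev-walk v)

    par-spec : ∀ {v i} → lev v ≡ suc i → v ~ par v × lev (par v) ≡ i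
    par-spec {v} {i} eq =
      let e , w = second-walk (lev-walk v) eq in
      e , ≤-antisym (lev-minimal w) (s≤s⁻¹ (subst (_≤ suc (lev (par v))) eq (lev-minimal (step e (lev-walk (par v))))))

  Down : Fin n → Fin n → Set
  Down u v = lev u ≡ suc (lev v) × par u ≡ v

  -- Any other edge would close a cycle with the paths from its ends to the root.

  edge-down : ∀ {u v} → u ~ v → Down u v ⊎ Down v u
  edge-down {u} {v} u~v with (lev u ≟ suc (lev v)) ×-dec (par u ≟ᶠ v) | (lev v ≟ suc (lev u)) ×-dec (par v ≟ᶠ u)
  ... | yes d  | _      = inj₁ d
  ... | no _   | yes d  = inj₂ d
  ... | no ¬uv | no ¬vu = ⊥-elim (cycle (simplePath (to-root (lev u) refl ◅◅ Star-reverse R-sym (to-root (lev v) refl))))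
    where
    R : Fin n → Fin n → Set
    R a b = a ~ b × ¬ (a ≡ u × b ≡ v) × ¬ (a ≡ v × b ≡ u)
    R-sym : ∀ {a b} → R a b → R b a
    R-sym (e , p , q) = ~-sym e , (λ (x , y) → q (y , x)) , λ (x , y) → p (y , x)
    open SimplePaths R
    to-root : ∀ {w} i → lev w ≡ i → Star R w r
    to-root {w} zero eq = subst (λ x → Star R x r) (sym (lev≡0⇒root eq)) ε
    to-root {w} (suc i) eq =
      let e , l = par-spec eq in
      (e , (λ { (refl , p) → ¬uv (trans eq (cong suc (trans (sym l) (cong lev p))) , p) })
         , (λ { (refl , p) → ¬vu (trans eq (cong suc (trans (sym l) (cong lev p))) , p) })) ◅ to-root i l
    cycle : ¬ (∃₂ λ k (w : Vec (Fin n) (suc k)) → SimplePath u v w)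
    cycle (0 , x ∷ [] , refl , refl , _)                                = ~-irrefl refl u~v
    cycle (1 , x ∷ y ∷ [] , refl , refl , (_ , p , _) ∷ _ , _)          = p (refl , refl)
    cycle (suc (suc m) , w , h , l , ls , us) =
      acyclic w (us , Linked.map proj₁ ls , subst₂ _~_ (sym l) (sym h) (~-sym u~v))

  Kid : Fin n → Fin n → Set
  Kid p c = p ~ c × lev c ≡ suc (lev p)

  kid? : ∀ p c → Dec (Kid p c)
  kid? p c = (p ~? c) ×-dec (lev c ≟ suc (lev p))

  -- `par` is a chosen neighbour one level up; acyclicity, through `edge-down`, makes it the only
  -- one.
  Kid⇒par : ∀ {p c} → Kid p c → par c ≡ p
  Kid⇒par (e , l) with edge-down e
  ... | inj₁ (l′ , _) = ⊥-elim (<-asym (≤-reflexive (sym l)) (≤-reflexive (sym l′)))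
  ... | inj₂ (_ , p)  = p

  par-Kid : ∀ {v i} → lev v ≡ suc i → Kid (par v) v
  par-Kid eq = let e , l = par-spec eq in ~-sym e , trans eq (cong suc (sym l))

  Kid⇒Father : ∀ {p c} → Kid p c → Rooted.Father G r c p
  Kid⇒Father {p} {c} (e , l) = e , lev p , Height-lev p , subst (Rooted.Height G r c) l (Height-lev c)

  nbr-split : ∀ {c i} → lev c ≡ suc i → ∀ z → ind (c ~? z) ≡ ind (kid? c z) + ind (z ≟ᶠ par c)
  nbr-split {c} {i} eq z with c ~? z
  ... | no ¬e = trans (ind-no (c ~? z) ¬e) (sym (cong₂ _+_ (ind-no (kid? c z) (¬e ∘ proj₁))
                               (ind-no (z ≟ᶠ par c) λ p → ¬e (subst (c ~_) (sym p) (proj₁ (par-spec eq))))))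
  ... | yes e with edge-down e
  ...   | inj₁ (l , p) = trans (ind-yes (c ~? z) e) (sym (cong₂ _+_
    (ind-no (kid? c z) λ (_ , l′) → <-asym (≤-reflexive (sym l)) (≤-reflexive (sym l′)))
    (ind-yes (z ≟ᶠ par c) (sym p))))
  ...   | inj₂ (l , p) = trans (ind-yes (c ~? z) e) (sym (cong₂ _+_ (ind-yes (kid? c z) (e , l))
                                        (ind-no (z ≟ᶠ par c) λ q → <⇒≢ (m≤n⇒m≤1+n ≤-refl)
                                          (trans (sym (proj₂ (par-spec eq)))
                                            (trans (cong lev (sym q)) (trans l (cong suc eq)))))))

  nbr-root : ∀ {c} → lev c ≡ 0 → ∀ z → ind (c ~? z) ≡ ind (kid? c z)
  nbr-root {c} eq z with c ~? z
  ... | no ¬e = trans (ind-no (c ~? z) ¬e) (sym (ind-no (kid? c z) (¬e ∘ proj₁)))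
  ... | yes e with edge-down e
  ...   | inj₂ (l , p) = trans (ind-yes (c ~? z) e) (sym (ind-yes (kid? c z) (e , l)))
  ...   | inj₁ (l , p) with () ← trans (sym eq) l

-- From a rooted tree of vertices to a plane tree.

S-⊛ : ∀ (t : A → Tree) cs g k → (S (map t cs) ⊛ g) k ≡ ∑ (λ c → (D (t c) ⊛ g) k) cs
S-⊛ t []       g k = 𝟘⊛ g k
S-⊛ t (c ∷ cs) g k = trans (⊛-distribʳ-⊕ g (D (t c)) (S (map t cs)) k) (cong ((D (t c) ⊛ g) k +_) (S-⊛ t cs g k))

∣∣-∑ : ∀ {n} (p : Vec Bool n) → ∣ p ∣ ≡ ∑ (λ i → if Vec.lookup p i then 1 else 0) (allFin n)
∣∣-∑ []          = refl
∣∣-∑ (true  ∷ p) = trans (cong suc (∣∣-∑ p)) (sym (∑-allFin-suc (λ i → if Vec.lookup (true ∷ p) i then 1 else 0)))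
∣∣-∑ (false ∷ p) = trans (∣∣-∑ p) (sym (∑-allFin-suc (λ i → if Vec.lookup (false ∷ p) i then 1 else 0)))

deg-∑ : ∀ {n} (G : Graph n) v → Graph.deg G v ≡ ∑ (λ z → ind (Graph._~?_ G v z)) (allFin n)
deg-∑ {n} G v = trans (∣∣-∑ (Vec.tabulate (Graph.edge G v)))
  (∑-cong (λ z → cong (λ b → if b then 1 else 0) (lookup∘tabulate (Graph.edge G v) z)) (allFin n))

<⇒∃suc : ∀ {m n} → m < n → ∃ λ i → n ≡ suc i
<⇒∃suc {n = suc i} _ = i , refl

-- The list `ord` fixes the order of siblings: an arbitrary one for the tree to be compared, the
-- BFS-ordering for the greedy tree.
module Enumerated {n} (G : Graph n) (isTree : IsTree G) (r : Fin n)
  (ord : List (Fin n)) (ord↭ : ord ↭ allFin n) where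

  open Graph G
  open RootedTree G isTree r
  open Walks G

  -- The sum of all levels bounds each of them, and the outer `suc` lets the root split off
  -- definitionally from the list `vertices`.
  H : ℕ
  H = suc (∑ lev (allFin n))

  lev<H : ∀ v → lev v < H
  lev<H v = s≤s (∑-≥ lev v)

  kids : Fin n → List (Fin n)
  kids p = filter (kid? p) ord

  kids-Kid : ∀ p → All (Kid p) (kids p)
  kids-Kid p = All.all-filter (kid? p) ord

  ∑-kids : ∀ (g : Fin n → ℕ) p → ∑ g (kids p) ≡ ∑ (λ z → ind (kid? p z) * g z) (allFin n)
  ∑-kids g p = trans (∑-filter (kid? p) g ord) (∑-↭ _ ord↭)

  ∑-nbrs : ∀ (g : Fin n → ℕ) {v i} → lev v ≡ suc i →
    ∑ (λ z → ind (v ~? z) * g z) (allFin n) ≡ ∑ g (kids v) + g (par v)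
  ∑-nbrs g {v} eq = begin
    ∑ (λ z → ind (v ~? z) * g z) (allFin n)
      ≡⟨ ∑-cong (λ z → trans (cong (_* g z) (nbr-split eq z)) (*-distribʳ-+ (g z) (ind (kid? v z)) _)) (allFin n) ⟩
    ∑ (λ z → ind (kid? v z) * g z + ind (z ≟ᶠ par v) * g z) (allFin n)
      ≡⟨ ∑-+ _ _ (allFin n) ⟩
    ∑ (λ z → ind (kid? v z) * g z) (allFin n) + ∑ (λ z → ind (z ≟ᶠ par v) * g z) (allFin n)
      ≡⟨ cong₂ _+_ (sym (∑-kids g v)) (∑-δ (par v) g) ⟩
    ∑ g (kids v) + g (par v) ∎
    where open ≡-Reasoning

  ∑-nbrs-root : ∀ (g : Fin n → ℕ) {v} → lev v ≡ 0 →
    ∑ (λ z → ind (v ~? z) * g z) (allFin n) ≡ ∑ g (kids v)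
  ∑-nbrs-root g {v} eq = trans (∑-cong (λ z → cong (_* g z) (nbr-root eq z)) (allFin n)) (sym (∑-kids g v))

  deg-nonroot : ∀ {v i} → lev v ≡ suc i → deg v ≡ suc (length (kids v))
  deg-nonroot {v} eq = begin
    deg v                                     ≡⟨ deg-∑ G v ⟩
    ∑ (λ z → ind (v ~? z)) (allFin n)         ≡⟨ ∑-cong (λ z → sym (*-identityʳ _)) (allFin n) ⟩
    ∑ (λ z → ind (v ~? z) * 1) (allFin n)     ≡⟨ ∑-nbrs (const 1) eq ⟩
    ∑ (const 1) (kids v) + 1                  ≡⟨ +-comm _ 1 ⟩
    suc (∑ (const 1) (kids v))                ≡⟨ cong suc (sym (length-∑ (kids v))) ⟩
    suc (length (kids v))                     ∎
    where open ≡-Reasoning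

  deg-root : ∀ {v} → lev v ≡ 0 → deg v ≡ length (kids v)
  deg-root {v} eq = begin
    deg v                                     ≡⟨ deg-∑ G v ⟩
    ∑ (λ z → ind (v ~? z)) (allFin n)         ≡⟨ ∑-cong (λ z → sym (*-identityʳ _)) (allFin n) ⟩
    ∑ (λ z → ind (v ~? z) * 1) (allFin n)     ≡⟨ ∑-nbrs-root (const 1) eq ⟩
    ∑ (const 1) (kids v)                      ≡⟨ sym (length-∑ (kids v)) ⟩
    length (kids v)                           ∎
    where open ≡-Reasoning

  -- The fuel `H ∸ lev v` used in `subtree` is positive and drops by one from a vertex to its
  -- children, so it disappears from the equation `subtree-unfold`.
  grow : ℕ → Fin n → Tree
  grow zero    v = node []
  grow (suc h) v = node (map (grow h) (kids v))

  subtree : Fin n → Tree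
  subtree v = grow (H ∸ lev v) v

  subtree-unfold : ∀ v → subtree v ≡ node (map subtree (kids v))
  subtree-unfold v = trans (cong (λ h → grow h v) (+-∸-assoc 1 (lev<H v)))
    (cong node (map-cong-local (All.map (λ {c} (_ , l) → cong (λ m → grow (H ∸ m) c) (sym l)) (kids-Kid v))))

  w : Fin n → Series
  w v k = walks k v v

  -- A walk from c to a vertex v outside the subtree of c is a closed walk below c,
  -- the step to par c and an arbitrary walk from there.

  walks-up : ∀ h c v → H ≤ lev c + h → lev v < lev c →
    (λ k → walks k c v) ≗ delay (D (subtree c) ⊛ λ j → walks j (par c) v)

  -- The target may be `c` itself, so this serves the induction for `walks-up` as well as the
  -- excursions in closed walks at `c`.
  ∑-walks-kids : ∀ h c v → H ≤ suc (lev c) + h → lev v ≤ lev c → ∀ k →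
    ∑ (λ z → walks k z v) (kids c) ≡ delay (S (map subtree (kids c)) ⊛ λ j → walks j c v) k
  ∑-walks-kids h c v H≤ v≤c k = begin
    ∑ (λ z → walks k z v) (kids c)
      ≡⟨ cong sum (map-cong-local (All.map (λ {z} kid@(_ , l) →
           trans (walks-up h z v (subst (λ m → H ≤ m + h) (sym l) H≤) (subst (lev v <_) (sym l) (s≤s v≤c)) k)
                 (cong (λ p → delay (D (subtree z) ⊛ λ j → walks j p v) k) (Kid⇒par kid))) (kids-Kid c))) ⟩
    ∑ (λ z → delay (D (subtree z) ⊛ λ j → walks j c v) k) (kids c)
      ≡⟨ delayed k ⟩
    delay (S (map subtree (kids c)) ⊛ λ j → walks j c v) k ∎
    where
    open ≡-Reasoning
    delayed : ∀ k → ∑ (λ z → delay (D (subtree z) ⊛ λ j → walks j c v) k) (kids c)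
                  ≡ delay (S (map subtree (kids c)) ⊛ λ j → walks j c v) k
    delayed zero    = ∑-zero (const 0) (λ _ → refl) (kids c)
    delayed (suc k) = sym (S-⊛ subtree (kids c) _ k)

  walks-up zero    c v H≤ v<c k = ⊥-elim (<⇒≱ (lev<H c) (subst (H ≤_) (+-identityʳ _) H≤))
  walks-up (suc h) c v H≤ v<c k with i , eq ← <⇒∃suc v<c = begin
    walks k c v                                ≡⟨ solve-unique solves k ⟩
    solve (delay gp) s k                       ≡⟨ solve-delay gp s k ⟩
    delay (solve gp s) k                       ≡⟨ delay-cong (λ j → sym (solve-𝟙-⊛ s gp j)) k ⟩
    delay (solve 𝟙 s ⊛ gp) k                   ≡⟨ cong (λ t → delay (D t ⊛ gp) k) (sym (subtree-unfold c)) ⟩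
    delay (D (subtree c) ⊛ gp) k               ∎
    where
    open ≡-Reasoning
    gp : Series
    gp j = walks j (par c) v
    s : Series
    s = S (map subtree (kids c))
    solves : (λ j → walks j c v) Solves delay gp , s
    solves zero    = ind-no (c ≟ᶠ v) λ c≡v → <-irrefl (cong lev (sym c≡v)) v<c
    solves (suc j) = trans (∑-nbrs (λ z → walks j z v) eq)
      (trans (cong (_+ gp j) (∑-walks-kids h c v
                (subst (H ≤_) (+-suc (lev c) h) H≤) (<⇒≤ v<c) j))
             (+-comm _ (gp j)))

  H≤ : ∀ m → H ≤ m + H
  H≤ m = m≤n+m H m

  w-root : ∀ {v} → lev v ≡ 0 → w v ≗ D (subtree v)
  w-root {v} eq k = trans (solve-unique solves k) (cong (λ t → D t k) (sym (subtree-unfold v)))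
    where
    solves : w v Solves 𝟙 , S (map subtree (kids v))
    solves zero    = ind-yes (v ≟ᶠ v) refl
    solves (suc j) = trans (∑-nbrs-root (λ z → walks j z v) eq) (∑-walks-kids H v v (H≤ (suc (lev v))) ≤-refl j)

  w-nonroot : ∀ {v i} → lev v ≡ suc i → w v ≗ descend (subtree v) (w (par v))
  w-nonroot {v} eq k = trans (solve-unique solves k)
    (cong (λ t → solve (𝟙 ⊕ delay (delay (D (subtree v) ⊛ w (par v)))) (S (ch t)) k) (sym (subtree-unfold v)))
    where
    up : ∀ j → walks j (par v) v ≡ delay (D (subtree v) ⊛ w (par v)) j
    up j = trans (walks-sym j (par v) v)
      (walks-up H v (par v) (H≤ (lev v)) (subst₂ _<_ (sym (proj₂ (par-spec eq))) (sym eq) ≤-refl) j)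
    solves : w v Solves (𝟙 ⊕ delay (delay (D (subtree v) ⊛ w (par v)))) , S (map subtree (kids v))
    solves zero    = ind-yes (v ≟ᶠ v) refl
    solves (suc j) = trans (∑-nbrs (λ z → walks j z v) eq)
      (trans (cong₂ _+_ (∑-walks-kids H v v (H≤ (suc (lev v))) ≤-refl j) (up j))
             (+-comm _ (delay (D (subtree v) ⊛ w (par v)) j)))

  Represents : Item → Fin n → Set
  Represents x v = proj₁ x ≡ subtree v × proj₂ x ≗ w v

  expand : List (Fin n) → List (Fin n)
  expand = concatMap kids

  push-represents : ∀ {x v} → Represents x v → Pointwise Represents (push x) (kids v)
  push-represents {t , u} {v} (refl , u≗) =
    subst (λ T → Pointwise Represents (map (λ c → c , descend c u) (ch T)) (kids v))
      (sym (subtree-unfold v)) (go (kids v) (kids-Kid v))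
    where
    go : ∀ cs → All (Kid v) cs → Pointwise Represents (map (λ c → c , descend c u) (map subtree cs)) cs
    go []       []         = []
    go (c ∷ cs) (kid@(_ , l) ∷ ks) = (refl , λ k →
      trans (solve-cong (λ j → cong (𝟙 j +_) (delay-cong (delay-cong (⊛-cong {f = D (subtree c)} (λ _ → refl)
               (λ i → trans (u≗ i) (cong (λ p → w p i) (sym (Kid⇒par kid)))))) j))
              (λ _ → refl) k)
            (sym (w-nonroot l k))) ∷ go cs ks

  pushes-represent : ∀ {X F} → Pointwise Represents X F → Pointwise Represents (pushes X) (expand F)
  pushes-represent []       = []
  pushes-represent (p ∷ ps) = PW.++⁺ (push-represents p) (pushes-represent ps)

  vs : ℕ → List (Fin n) → List (Fin n)
  vs zero    F = []
  vs (suc h) F = F ++ vs h (expand F)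

  map-represent : ∀ {X F} k → Pointwise Represents X F → map (at k) X ≡ map (λ v → w v k) F
  map-represent k []             = refl
  map-represent k ((_ , p) ∷ ps) = cong₂ _∷_ (p k) (map-represent k ps)

  breadthFirst-represent : ∀ h {X F} k → Pointwise Represents X F →
    breadthFirst pushes (at k) h X ≡ map (λ v → w v k) (vs h F)
  breadthFirst-represent zero    k ps = refl
  breadthFirst-represent (suc h) {F = F} k ps =
    trans (cong₂ _++_ (map-represent k ps) (breadthFirst-represent h k (pushes-represent ps)))
          (sym (map-++ _ F (vs h (expand F))))

  ∑-closedF-represent : ∀ h {X F} → Pointwise Represents X F → iter expand h F ≡ [] → ∀ k (g : ℕ → ℕ) →
    ∑ (λ s → g (s k)) (closedF X) ≡ ∑ (λ v → g (w v k)) (vs h F)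
  ∑-closedF-represent zero    []  refl k g = refl
  ∑-closedF-represent (suc h) {X} {F} ps eq k g = begin
    ∑ (λ s → g (s k)) (closedF X)
      ≡⟨ ∑-closedF (λ s → g (s k)) X ⟩
    ∑ (g ∘ at k) X + ∑ (λ s → g (s k)) (closedF (pushes X))
      ≡⟨ cong₂ _+_ (trans (sym (∑-map g (at k) X)) (trans (cong (∑ g) (map-represent k ps)) (∑-map g _ F)))
                   (∑-closedF-represent h (pushes-represent ps) eq k g) ⟩
    ∑ (λ v → g (w v k)) F + ∑ (λ v → g (w v k)) (vs h (expand F))
      ≡⟨ sym (∑-++ _ F _) ⟩
    ∑ (λ v → g (w v k)) (F ++ vs h (expand F)) ∎
    where open ≡-Reasoning

  root-represents : Pointwise Represents [ rootItem (subtree r) ] [ r ]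
  root-represents = (refl , λ k → sym (w-root lev-root k)) ∷ []

  below-subtree : ∀ F → below (map subtree F) ≡ map subtree (expand F)
  below-subtree []      = refl
  below-subtree (v ∷ F) = trans (cong₂ _++_ (cong ch (subtree-unfold v)) (below-subtree F))
    (sym (map-++ subtree (kids v) (expand F)))

  level-subtree : ∀ h F → level h (map subtree F) ≡ map subtree (iter expand h F)
  level-subtree zero    F = refl
  level-subtree (suc h) F = trans (cong (level h) (below-subtree F)) (level-subtree h (expand F))

  outdegree-subtree : ∀ v → outdegree (subtree v) ≡ length (kids v)
  outdegree-subtree v = trans (cong outdegree (subtree-unfold v)) (length-map subtree (kids v))

  bfs-subtree : ∀ h F → bfs h (map subtree F) ≡ map (length ∘ kids) (vs h F)
  bfs-subtree zero    F = refl
  bfs-subtree (suc h) F = trans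
    (cong₂ _++_ (trans (sym (map-∘ F)) (map-cong outdegree-subtree F))
                (trans (cong (bfs h) (below-subtree F)) (bfs-subtree h (expand F))))
    (sym (map-++ _ F (vs h (expand F))))

  lev-expand : ∀ {i F} → All (λ v → lev v ≡ i) F → All (λ v → lev v ≡ suc i) (expand F)
  lev-expand []                 = []
  lev-expand {F = v ∷ F} (p ∷ ps) =
    All.++⁺ (All.map (λ (_ , l) → trans l (cong suc p)) (kids-Kid v)) (lev-expand ps)

  lev-iter : ∀ h {i F} → All (λ v → lev v ≡ i) F → All (λ v → lev v ≡ h + i) (iter expand h F)
  lev-iter zero    ps = ps
  lev-iter (suc h) {i} {F} ps =
    subst (λ m → All (λ v → lev v ≡ m) (iter expand h (expand F))) (+-suc h i) (lev-iter h (lev-expand ps))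

  lev-[r] : All (λ v → lev v ≡ 0) [ r ]
  lev-[r] = lev-root ∷ []

  iter-H : iter expand H [ r ] ≡ []
  iter-H = none (lev-iter H lev-[r])
    where
    none : ∀ {F} → All (λ v → lev v ≡ H + 0) F → F ≡ []
    none []              = refl
    none {v ∷ _} (p ∷ _) = ⊥-elim (<-irrefl (trans p (+-identityʳ H)) (lev<H v))

  vertices : List (Fin n)
  vertices = vs H [ r ]

  ∈-iter : ∀ h v → lev v ≡ h → v ∈ iter expand h [ r ]
  ∈-iter zero    v eq = here (lev≡0⇒root eq)
  ∈-iter (suc h) v eq = subst (v ∈_) (iter-suc h [ r ])
    (∈-concatMap⁺ kids (lose (∈-iter h (par v) (proj₂ (par-spec eq)))
      (∈-filter⁺ (kid? (par v)) (Perm.∈-resp-↭ (↭-sym ord↭) (∈-allFin v)) (par-Kid eq))))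
    where
    iter-suc : ∀ h F → expand (iter expand h F) ≡ iter expand (suc h) F
    iter-suc zero    F = refl
    iter-suc (suc h) F = iter-suc h (expand F)

  ∈-vs : ∀ {v} i h F → i < h → v ∈ iter expand i F → v ∈ vs h F
  ∈-vs zero    (suc h) F _       p = ∈-++⁺ˡ p
  ∈-vs (suc i) (suc h) F (s≤s q) p = ∈-++⁺ʳ F (∈-vs i h (expand F) q p)

  ∈-vertices : ∀ v → v ∈ vertices
  ∈-vertices v = ∈-vs (lev v) H [ r ] (lev<H v) (∈-iter (lev v) v refl)

  -- Used for `_≢_`, where it shows that no vertex is listed twice, for the BFS-ordering, and for
  -- the total relation to obtain bounds on levels.
  module Ordered (R : Fin n → Fin n → Set) (ord-R : AllPairs R ord)
    (lev-R : ∀ {u v} → lev u < lev v → R u v)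
    (kid-R : ∀ {p q c d} → lev p ≡ lev q → R p q → Kid p c → Kid q d → R c d) where

    expand-R : ∀ {i F} → All (λ v → lev v ≡ i) F → AllPairs R F → AllPairs R (expand F)
    expand-R []       []       = []
    expand-R {F = v ∷ F} (l ∷ ls) (p ∷ ps) =
      AllPairs.++⁺ (AllPairs.filter⁺ (kid? v) ord-R) (expand-R ls ps)
        (All.map (λ kid → cross kid l ls p) (kids-Kid v))
      where
      cross : ∀ {c i F} → Kid v c → lev v ≡ i → All (λ v → lev v ≡ i) F → All (R v) F → All (R c) (expand F)
      cross kid l []       []       = []
      cross {F = u ∷ F} kid l (m ∷ ms) (q ∷ qs) =
        All.++⁺ (All.map (kid-R (trans l (sym m)) q kid) (kids-Kid u)) (cross kid l ms qs)

    vs-lev : ∀ h {i F} → All (λ v → lev v ≡ i) F → All (λ v → i ≤ lev v) (vs h F)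
    vs-lev zero    ls = []
    vs-lev (suc h) ls = All.++⁺ (All.map (λ l → ≤-reflexive (sym l)) ls)
                                (All.map <⇒≤ (vs-lev h (lev-expand ls)))

    vs-R : ∀ h {i F} → All (λ v → lev v ≡ i) F → AllPairs R F → AllPairs R (vs h F)
    vs-R zero    ls ps = []
    vs-R (suc h) ls ps = AllPairs.++⁺ ps (vs-R h (lev-expand ls) (expand-R ls ps))
      (All.map (λ l → All.map (λ m → lev-R (≤-trans (s≤s (≤-reflexive l)) m)) (vs-lev h (lev-expand ls))) ls)

    vertices-R : AllPairs R vertices
    vertices-R = vs-R H lev-[r] ([] ∷ [])

  vertices↭ : AllPairs _≢_ ord → vertices ↭ allFin n
  vertices↭ unique = ∼bag⇒↭ (unique∧set⇒bag (Ordered.vertices-R _≢_ unique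
      (λ l p → <-irrefl (cong lev p) l)
      (λ _ p≢q kc kd c≡d → p≢q (trans (sym (Kid⇒par kc)) (trans (cong par c≡d) (Kid⇒par kd)))))
    (allFin⁺ n) (mk⇔ (λ _ → ∈-allFin _) (λ _ → ∈-vertices _)))

  height : level H [ subtree r ] ≡ []
  height = trans (level-subtree H [ r ]) (cong (map subtree) iter-H)

  closedExcess-vertices : ∀ k τ → closedExcess k τ (subtree r) ≡ ∑ (λ v → w v k ∸ τ) vertices
  closedExcess-vertices k τ = trans (cong (excess (_$ k) τ) (sym (closedF-rootItem (subtree r))))
    (∑-closedF-represent H root-represents iter-H k (_∸ τ))

  outdegree-root : outdegree (subtree r) ≡ deg r
  outdegree-root = trans (outdegree-subtree r) (sym (deg-root lev-root))

  nonroots : List (Fin n)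
  nonroots = vs (∑ lev (allFin n)) (expand [ r ])

  ch-subtree : ch (subtree r) ≡ map subtree (expand [ r ])
  ch-subtree = trans (cong ch (subtree-unfold r)) (cong (map subtree) (sym (++-identityʳ (kids r))))

  suc-lev-nonroots : All (λ v → 1 ≤ lev v) nonroots
  suc-lev-nonroots = Ordered.vs-lev (λ _ _ → ⊤) (trivial ord) _ _ (∑ lev (allFin n)) (lev-expand lev-[r])
    where
    trivial : ∀ (xs : List (Fin n)) → AllPairs (λ _ _ → ⊤) xs
    trivial []       = []
    trivial (x ∷ xs) = All.universal (λ _ → tt) xs ∷ trivial xs

  outdegrees-nonroots : outdegrees* (ch (subtree r)) ↭ map (length ∘ kids) nonroots
  outdegrees-nonroots = ↭-trans (↭-reflexive (cong outdegrees* ch-subtree))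
    (↭-trans (↭-sym (bfs-↭ (∑ lev (allFin n))
       (trans (level-subtree (∑ lev (allFin n)) (expand [ r ])) (cong (map subtree) iter-H))))
     (↭-reflexive (bfs-subtree (∑ lev (allFin n)) (expand [ r ]))))

  suc-outdegrees : map suc (map (length ∘ kids) nonroots) ≡ map deg nonroots
  suc-outdegrees = trans (sym (map-∘ nonroots)) (map-cong-local (All.map eq suc-lev-nonroots))
    where
    eq : ∀ {v} → 1 ≤ lev v → suc (length (kids v)) ≡ deg v
    eq p = sym (deg-nonroot (proj₂ (<⇒∃suc p)))

  degrees-vertices : map deg vertices ≡ outdegree (subtree r) ∷ map suc (map (length ∘ kids) nonroots)
  degrees-vertices = cong₂ _∷_ (sym outdegree-root) (sym suc-outdegrees)

-- Breadth-first orderings of a greedy tree.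

AllPairs-All : ∀ {P : A → Set} {Q R : A → A → Set} → (∀ {x y} → P x → P y → Q x y → R x y) →
  ∀ {xs} → All P xs → AllPairs Q xs → AllPairs R xs
AllPairs-All f []       []       = []
AllPairs-All f (p ∷ ps) (q ∷ qs) = All.map (λ (p′ , q′) → f p p′ q′) (All.zip (ps , q)) ∷ AllPairs-All f ps qs

filter-⊑ : ∀ {p} {P : A → Set p} (P? : ∀ x → Dec (P x)) xs → filter P? xs ⊑ xs
filter-⊑ P? []       = sub [] ↭-refl
filter-⊑ P? (x ∷ xs) with does (P? x) | filter-⊑ P? xs
... | true  | sub ys p = sub ys (prep x p)
... | false | sub ys p = sub (x ∷ ys) (↭-trans (Perm.shift x _ ys) (prep x p))

⊑-map : ∀ (f : A → B) {us xs} → us ⊑ xs → map f us ⊑ map f xs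
⊑-map f {us} (sub vs p) = sub (map f vs) (↭-trans (↭-reflexive (sym (map-++ f us vs))) (Perm.map⁺ f p))

module BFS {n} (G : Graph n) (isTree : IsTree G) (root : Fin n) {_≺_ : Fin n → Fin n → Set}
  (bfs≺ : IsBFSOrdering G root _≺_)
  (level-deg : ∀ {u v i} → Rooted.Height G root u i → Rooted.Height G root v (suc i) → Graph.deg G u ≥ Graph.deg G v)
  where

  open Graph G
  open RootedTree G isTree root
  open Rooted.IsBFSOrdering bfs≺
  open IsStrictTotalOrder isStrictTotalOrder using (irrefl; asym) renaming (compare to ≺-cmp)

  private
    ≼-order : DecTotalOrder _ _ _
    ≼-order = StrictTotalOrderProperties.decTotalOrder (record { isStrictTotalOrder = isStrictTotalOrder })
    module Sort = ListSort ≼-order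

  ord : List (Fin n)
  ord = Sort.sort (allFin n)

  ord↭ : ord ↭ allFin n
  ord↭ = Sort.sort-↭ (allFin n)

  ord-≺ : AllPairs _≺_ ord
  ord-≺ = AllPairs.map (λ { (inj₁ p , _) → p ; (inj₂ p , q) → ⊥-elim (q p) })
    (AllPairs.zip (Sorted⇒AllPairs (DecTotalOrder.totalOrder ≼-order) (Sort.sort-↗ (allFin n)) ,
                   PermSetoid.Unique-resp-↭ (setoid (Fin n)) (↭⇒↭ₛ (↭-sym ord↭)) (allFin⁺ n)))

  open Enumerated G isTree root ord ord↭ public
  open Walks G

  lev-≺ : ∀ {u v} → lev u < lev v → u ≺ v
  lev-≺ {u} {v} = level-mono (Height-lev u) (Height-lev v)

  Height-at : ∀ {v i} → lev v ≡ i → Rooted.Height G root v i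
  Height-at {v} refl = Height-lev v

  -- If `d` came first, monotonicity of fathers would put `q` before `p` or identify them.
  kid-≺ : ∀ {p q c d} → lev p ≡ lev q → p ≺ q → Kid p c → Kid q d → c ≺ d
  kid-≺ {p} {q} {c} {d} l p≺q kc kd with ≺-cmp c d
  ... | tri< c≺d _ _    = c≺d
  ... | tri≈ _ refl _   = ⊥-elim (irrefl (trans (sym (Kid⇒par kc)) (Kid⇒par kd)) p≺q)
  ... | tri> _ _ d≺c with father-mono (Height-lev d) (Height-at (trans (proj₂ kc) (trans (cong suc l) (sym (proj₂ kd)))))
                              d≺c (Kid⇒Father kd) (Kid⇒Father kc)
  ...   | inj₁ q≡p = ⊥-elim (irrefl (sym q≡p) p≺q)
  ...   | inj₂ q≺p = ⊥-elim (asym p≺q q≺p)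

  module O = Ordered _≺_ ord-≺ lev-≺ kid-≺

  -- The hypothesis on degrees relates consecutive levels; larger gaps are bridged by climbing from
  -- `v` along fathers to the level right after that of `u`.
  deg-lev : ∀ {v u} m → lev v ≤ m → lev u < lev v → deg v ≤ deg u
  deg-lev zero    l≤m l = ⊥-elim (<⇒≱ l (≤-trans l≤m z≤n))
  deg-lev {v} {u} (suc m) l≤m l with i , eq ← <⇒∃suc l
    with e , lp ← par-spec eq
    with m≤n⇒m<n∨m≡n (s≤s⁻¹ (subst (lev u <_) eq l))
  ... | inj₂ lu≡i = level-deg (Height-at lu≡i) (Height-at eq)
  ... | inj₁ lu<i = ≤-trans (level-deg (Height-at lp) (Height-at eq))
                      (deg-lev m (subst (_≤ m) (sym lp) (s≤s⁻¹ (subst (_≤ suc m) eq l≤m)))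
                               (subst (lev u <_) (sym lp) lu<i))

  deg-≺ : ∀ {u v} → u ≺ v → deg v ≤ deg u
  deg-≺ {u} {v} u≺v with <-cmp (lev u) (lev v)
  ... | tri< l _ _ = deg-lev (lev v) ≤-refl l
  ... | tri≈ _ l _ = deg-anti (Height-lev u) (Height-at (sym l)) u≺v
  ... | tri> _ _ l = ⊥-elim (asym u≺v (lev-≺ l))

  deg≤root : ∀ v → deg v ≤ deg root
  deg≤root v with lev v in eq
  ... | zero  = ≤-reflexive (cong deg (lev≡0⇒root eq))
  ... | suc i = deg-lev (lev v) ≤-refl (subst₂ _<_ (sym lev-root) (sym eq) (s≤s z≤n))

  greedy : Greedy (subtree root)
  greedy = rootMaximal , sorted
    where
    rootMaximal : RootMaximal (subtree root)
    rootMaximal = Perm.All-resp-↭ (↭-sym outdegrees-nonroots)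
      (All.map⁺ (All.map (λ {v} l → subst₂ _≤_ (deg-nonroot (proj₂ (<⇒∃suc l))) (sym outdegree-root) (deg≤root v))
                         suc-lev-nonroots))
    sorted : ∀ h → Nonincreasing (bfs h (ch (subtree root)))
    sorted h = subst Nonincreasing (sym (trans (cong (bfs h) ch-subtree) (bfs-subtree h (expand [ root ]))))
      (AllPairs.map⁺ (AllPairs-All
        (λ lu lv u≺v → s≤s⁻¹ (subst₂ _≤_ (deg-nonroot (proj₂ (<⇒∃suc lv))) (deg-nonroot (proj₂ (<⇒∃suc lu)))
                                          (deg-≺ u≺v)))
        (O.vs-lev h (lev-expand lev-[r])) (O.vs-R h (lev-expand lev-[r]) (O.expand-R lev-[r] ([] ∷ [])))))

  vertices-↭ : vertices ↭ allFin n
  vertices-↭ = vertices↭ (AllPairs.map (λ { p refl → irrefl refl p }) ord-≺)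

  closed-nonincreasing : ∀ k → Nonincreasing (map (closedWalks k G) vertices)
  closed-nonincreasing k = subst Nonincreasing
    (trans (breadthFirst-represent H k root-represents) (map-cong (λ v → sym (closedWalks-walks k v)) vertices))
    (Greedy-closed-nonincreasing {h = H} {subtree root} height greedy k H)

  length-vertices : length vertices ≡ n
  length-vertices = trans (Perm.↭-length vertices-↭) (length-tabulate id)

  -- `vertices` is listed along the BFS-ordering, so the predecessors of `v` are exactly the entries
  -- in front of it.
  rank : ∀ us v vs → vertices ≡ us ++ v ∷ vs → length (filter (_≺? v) (allFin n)) ≡ length us
  rank us v vs eq with AllPairs-++⁻ us (subst (AllPairs _≺_) eq O.vertices-R)
  ... | _ , (v≺ ∷ _) , ≺v = begin
    length (filter (_≺? v) (allFin n))
      ≡⟨ Perm.↭-length (Perm.filter-↭ (_≺? v) (↭-sym (subst (_↭ allFin n) eq vertices-↭))) ⟩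
    length (filter (_≺? v) (us ++ v ∷ vs))
      ≡⟨ cong length (filter-++ (_≺? v) us (v ∷ vs)) ⟩
    length (filter (_≺? v) us ++ filter (_≺? v) (v ∷ vs))
      ≡⟨ cong₂ (λ xs ys → length (xs ++ ys)) (filter-all (_≺? v) (All.map All.head ≺v))
               (filter-none (_≺? v) (irrefl refl ∷ All.map asym v≺)) ⟩
    length (us ++ [])
      ≡⟨ cong length (++-identityʳ us) ⟩
    length us ∎
    where open ≡-Reasoning

  first∈ : ∀ r v → length (filter (_≺? v) (allFin n)) < r → v ∈ₛ first r
  first∈ r v p = lookup⇒[]= v (first r)
    (trans (lookup∘tabulate _ v) (dec-true (length (filter (_≺? v) (allFin n)) <? r) p))

  first∉ : ∀ r v → r ≤ length (filter (_≺? v) (allFin n)) → ¬ v ∈ₛ first r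
  first∉ r v p q with () ← trans (sym ([]=⇒lookup q))
    (trans (lookup∘tabulate _ v) (dec-false (length (filter (_≺? v) (allFin n)) <? r) (≤⇒≯ p)))

  filter-first : ∀ {r} → r ≤ n → filter (_∈? first r) (allFin n) ↭ take r vertices
  filter-first {r} r≤n = ↭-trans (Perm.filter-↭ (_∈? first r) (↭-sym vertices-↭)) (↭-reflexive (begin
    filter (_∈? first r) vertices
      ≡⟨ cong (filter (_∈? first r)) (sym (take++drop≡id r vertices)) ⟩
    filter (_∈? first r) (take r vertices ++ drop r vertices)
      ≡⟨ filter-++ (_∈? first r) (take r vertices) (drop r vertices) ⟩
    filter (_∈? first r) (take r vertices) ++ filter (_∈? first r) (drop r vertices)
      ≡⟨ cong₂ _++_ (filter-all (_∈? first r) (All.tabulate inside))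
               (filter-none (_∈? first r) (All.tabulate outside)) ⟩
    take r vertices ++ []
      ≡⟨ ++-identityʳ _ ⟩
    take r vertices ∎))
    where
    open ≡-Reasoning
    len : length (take r vertices) ≡ r
    len = trans (length-take r vertices) (m≤n⇒m⊓n≡m (subst (r ≤_) (sym length-vertices) r≤n))
    inside : ∀ {v} → v ∈ take r vertices → v ∈ₛ first r
    inside {v} p with us , vs , eq ← ∈-∃++ p =
      first∈ r v (subst₂ _<_
        (sym (rank us v (vs ++ drop r vertices)
          (trans (sym (take++drop≡id r vertices)) (trans (cong (_++ drop r vertices) eq) (++-assoc us (v ∷ vs) _)))))
        (trans (sym (length-++ us)) (trans (cong length (sym eq)) len))
        (m<m+n (length us) (s≤s z≤n)))
    outside : ∀ {v} → v ∈ drop r vertices → ¬ v ∈ₛ first r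
    outside {v} p with us , vs , eq ← ∈-∃++ p =
      first∉ r v (subst (r ≤_)
        (sym (rank (take r vertices ++ us) v vs
          (trans (sym (take++drop≡id r vertices))
            (trans (cong (take r vertices ++_) eq) (sym (++-assoc (take r vertices) us _))))))
        (subst (_≤ length (take r vertices ++ us)) len (length-++-≤ˡ (take r vertices))))

-- Comparison of an arbitrary tree with the greedy tree.

toList-tabulate : ∀ {n} (f : Fin n → ℕ) → Vec.toList (Vec.tabulate f) ≡ map f (allFin n)
toList-tabulate f = trans (go f) (sym (map-tabulate id f))
  where
  go : ∀ {n} (f : Fin n → ℕ) → Vec.toList (Vec.tabulate f) ≡ List.tabulate f
  go {zero}  f = refl
  go {suc n} f = cong (f zero ∷_) (go (f ∘ suc))

length-∈? : ∀ {n} (U : Subset n) → length (filter (_∈? U) (allFin n)) ≡ ∣ U ∣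
length-∈? {n} U = trans (length-filter-∑ (_∈? U) (allFin n)) (trans (∑-cong member (allFin n)) (sym (∣∣-∑ U)))
  where
  member : ∀ i → ind (i ∈? U) ≡ (if Vec.lookup U i then 1 else 0)
  member i with Vec.lookup U i in eq
  ... | true  = ind-yes (i ∈? U) (lookup⇒[]= i U eq)
  ... | false = ind-no (i ∈? U) λ p → case trans (sym ([]=⇒lookup p)) eq of λ ()

module Comparison {n} (π : Vec ℕ n) (T* : Graph n) (root : Fin n) (T*∈ : T* ∈𝒯 π) {_≺_ : Fin n → Fin n → Set}
  (bfs≺ : IsBFSOrdering T* root _≺_)
  (level-deg : ∀ {u v i} → Rooted.Height T* root u i → Rooted.Height T* root v (suc i) → Graph.deg T* u ≥ Graph.deg T* v)
  where

  module B = BFS T* (proj₁ T*∈) root bfs≺ level-deg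

  degrees-list : ∀ {T} → T ∈𝒯 π → map (Graph.deg T) (allFin n) ↭ Vec.toList π
  degrees-list {T} (_ , p) = ↭-trans (↭-reflexive (sym (toList-tabulate (Graph.deg T)))) p

  Dom-closedWalks : ∀ T → T ∈𝒯 π → ∀ k →
    Dom id (map (closedWalks k T) (allFin n)) (map (closedWalks k T*) B.vertices)
  Dom-closedWalks T T∈ k = record
    { antitone = B.closed-nonincreasing k
    ; length-≡ = trans (length-map _ (allFin n)) (trans (sym (Perm.↭-length B.vertices-↭)) (sym (length-map _ B.vertices)))
    ; excess-≤ = excess-≤′
    }
    where
    same : map (Graph.deg T*) (allFin n) ↭ map (Graph.deg T) (allFin n)
    same = ↭-trans (degrees-list T*∈) (↭-sym (degrees-list T∈))
    -- The degree multisets agree, so some vertex of `T` has the degree of the greedy root, the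
    -- largest one; `T` is rooted there.
    root′ : ∃ λ r → r ∈ allFin n × Graph.deg T* root ≡ Graph.deg T r
    root′ = ∈-map⁻ (Graph.deg T) (Perm.∈-resp-↭ same (∈-map⁺ (Graph.deg T*) (∈-allFin root)))
    r = proj₁ root′
    deg-r : Graph.deg T r ≡ Graph.deg T* root
    deg-r = sym (proj₂ (proj₂ root′))
    module E = Enumerated T (proj₁ T∈) r (allFin n) ↭-refl
    module R = RootedTree T (proj₁ T∈) r
    vertices-T : E.vertices ↭ allFin n
    vertices-T = E.vertices↭ (allFin⁺ n)
    maximal : ∀ v → Graph.deg T v ≤ Graph.deg T r
    maximal v = All.lookup (Perm.All-resp-↭ {P = _≤ Graph.deg T r} same
        (All.map⁺ (All.universal (λ u → subst (Graph.deg T* u ≤_) (sym deg-r) (B.deg≤root u)) (allFin n))))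
      (∈-map⁺ (Graph.deg T) (∈-allFin v))
    rootMaximal : RootMaximal (E.subtree r)
    rootMaximal = Perm.All-resp-↭ (↭-sym E.outdegrees-nonroots)
      (All.map⁺ (All.map (λ {v} l → subst₂ _≤_ (E.deg-nonroot (proj₂ (<⇒∃suc l))) (sym E.outdegree-root) (maximal v))
                         E.suc-lev-nonroots))
    outdegree-≡ : outdegree (E.subtree r) ≡ outdegree (B.subtree root)
    outdegree-≡ = trans E.outdegree-root (trans deg-r (sym B.outdegree-root))
    -- The equal degrees of the roots cancel; every remaining degree is an outdegree plus one.
    nonroot-degrees : map suc (map (length ∘ E.kids) E.nonroots) ↭ map suc (map (length ∘ B.kids) B.nonroots)
    nonroot-degrees = Perm.drop-∷ (subst₂ _↭_
      (trans E.degrees-vertices (cong (_∷ _) outdegree-≡)) B.degrees-vertices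
      (↭-trans (Perm.map⁺ _ vertices-T) (↭-trans (↭-sym same) (Perm.map⁺ _ (↭-sym B.vertices-↭)))))
    map-pred-suc : ∀ xs → map pred (map suc xs) ≡ xs
    map-pred-suc xs = trans (sym (map-∘ xs)) (map-id xs)
    outdegrees-↭ : outdegrees* (ch (E.subtree r)) ↭ outdegrees* (ch (B.subtree root))
    outdegrees-↭ = ↭-trans E.outdegrees-nonroots (↭-trans
      (subst₂ _↭_ (map-pred-suc _) (map-pred-suc _) (Perm.map⁺ pred nonroot-degrees)) (↭-sym B.outdegrees-nonroots))
    empty* : level (pred B.H) (ch (B.subtree root)) ≡ []
    empty* = trans (cong (level (pred B.H)) (sym (++-identityʳ (ch (B.subtree root))))) B.height
    excess-list : ∀ (G : Graph n) τ xs → ∑ (λ v → Walks.walks G k v v ∸ τ) xs ≡ excess id τ (map (closedWalks k G) xs)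
    excess-list G τ xs = sym (trans (∑-map (_∸ τ) (closedWalks k G) xs)
      (∑-cong (λ v → cong (_∸ τ) (Walks.closedWalks-walks G k v)) xs))
    excess-≤′ : ∀ τ → excess id τ (map (closedWalks k T) (allFin n)) ≤ excess id τ (map (closedWalks k T*) B.vertices)
    excess-≤′ τ = begin
      excess id τ (map (closedWalks k T) (allFin n))    ≡⟨ ∑-↭ _ (Perm.map⁺ _ (↭-sym vertices-T)) ⟩
      excess id τ (map (closedWalks k T) E.vertices)    ≡⟨ sym (excess-list T τ E.vertices) ⟩
      ∑ (λ v → E.w v k ∸ τ) E.vertices                  ≡⟨ sym (E.closedExcess-vertices k τ) ⟩
      closedExcess k τ (E.subtree r)
        ≤⟨ Approach.approach {B.subtree root} {pred B.H} empty* B.greedy (suc (totalDepth (E.subtree r))) (E.subtree r) ≤-refl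
             E.H E.height rootMaximal outdegree-≡ outdegrees-↭ k τ ⟩
      closedExcess k τ (B.subtree root)                 ≡⟨ B.closedExcess-vertices k τ ⟩
      ∑ (λ v → B.w v k ∸ τ) B.vertices                  ≡⟨ excess-list T* τ B.vertices ⟩
      excess id τ (map (closedWalks k T*) B.vertices)   ∎
      where open ≤-Reasoning

  -- The common core of both forms of the theorem: `us` is an initial segment of the sorted counts
  -- in one, the counts on a vertex set in the other.
  sum-≤-first : ∀ T → T ∈𝒯 π → ∀ k {us} m → us ⊑ map (closedWalks k T) (allFin n) → length us ≤ m →
    sum us ≤ sum (take m (map (closedWalks k T*) B.vertices))
  sum-≤-first T T∈ k {us} m p le = begin
    sum us                          ≡⟨ cong sum (sym (map-id us)) ⟩
    ∑ id us                         ≤⟨ Dom⇒∑≤∑take (Dom-closedWalks T T∈ k) p ⟩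
    ∑ id (take (length us) ws)      ≤⟨ ∑-take-mono id le ws ⟩
    ∑ id (take m ws)                ≡⟨ cong sum (map-id (take m ws)) ⟩
    sum (take m ws)                 ∎
    where
    open ≤-Reasoning
    ws = map (closedWalks k T*) B.vertices

  majorized : ∀ T → T ∈𝒯 π → ∀ k → C k T ◁w C k T*
  majorized T T∈ k t = begin
    sum (take m (Sort.sort (Vec.toList (C k T))))
      ≤⟨ sum-≤-first T T∈ k m (⊑-take m (sub [] (↭-trans (Perm.++-identityʳ _) (sorted↭ T))))
           (≤-trans (≤-reflexive (length-take m (Sort.sort (Vec.toList (C k T))))) (m⊓n≤m m _)) ⟩
    sum (take m (map (closedWalks k T*) B.vertices))
      ≡⟨ cong (sum ∘ take m) (sym sorted-T*) ⟩
    sum (take m (Sort.sort (Vec.toList (C k T*)))) ∎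
    where
    open ≤-Reasoning
    m = suc (toℕ t)
    module Sort = ListSort ≥-decTotalOrder
    sorted↭ : ∀ G → Sort.sort (Vec.toList (C k G)) ↭ map (closedWalks k G) (allFin n)
    sorted↭ G = ↭-trans (Sort.sort-↭ _) (↭-reflexive (toList-tabulate (closedWalks k G)))
    sorted-T* : Sort.sort (Vec.toList (C k T*)) ≡ map (closedWalks k T*) B.vertices
    sorted-T* = nonincreasing-↭⇒≡ (Sorted⇒AllPairs (DecTotalOrder.totalOrder ≥-decTotalOrder) (Sort.sort-↗ _))
      (B.closed-nonincreasing k) (↭-trans (sorted↭ T*) (Perm.map⁺ _ (↭-sym B.vertices-↭)))

  sumOver-≤-first : ∀ T → T ∈𝒯 π → ∀ k (U : Subset n) →
    sumOver U (closedWalks k T) ≤ sum (take ∣ U ∣ (map (closedWalks k T*) B.vertices))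
  sumOver-≤-first T T∈ k U = sum-≤-first T T∈ k ∣ U ∣ (⊑-map (closedWalks k T) (filter-⊑ (_∈? U) (allFin n)))
    (≤-reflexive (trans (length-map (closedWalks k T) (filter (_∈? U) (allFin n))) (length-∈? U)))

  sumOver-first : ∀ {r} → r ≤ n → ∀ k →
    sumOver (IsBFSOrdering.first bfs≺ r) (closedWalks k T*) ≡ sum (take r (map (closedWalks k T*) B.vertices))
  sumOver-first {r} r≤n k = trans (∑-↭ _ (B.filter-first r≤n)) (cong sum (sym (take-map r B.vertices)))

  ∣first∣ : ∀ {r} → r ≤ n → ∣ IsBFSOrdering.first bfs≺ r ∣ ≡ r
  ∣first∣ {r} r≤n = trans (sym (length-∈? (IsBFSOrdering.first bfs≺ r))) (trans (Perm.↭-length (B.filter-first r≤n))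
    (trans (length-take r B.vertices) (m≤n⇒m⊓n≡m (subst (r ≤_) (sym B.length-vertices) r≤n))))

  maximum : ∀ k {r} → r ≤ n → IsMaximum
    (λ m → ∃ λ (T : Graph n) → T ∈𝒯 π × IsMaxSum r (closedWalks k T) m)
    (sumOver (IsBFSOrdering.first bfs≺ r) (closedWalks k T*))
  maximum k {r} r≤n =
    (T* , T*∈ , (IsBFSOrdering.first bfs≺ r , ∣first∣ r≤n , refl) , λ x (U , card , eq) → bound T* T*∈ U card eq) ,
    λ x (T , T∈ , (U , card , eq) , _) → bound T T∈ U card eq
    where
    bound : ∀ T → T ∈𝒯 π → ∀ U {x} → ∣ U ∣ ≡ r → sumOver U (closedWalks k T) ≡ x →
      x ≤ sumOver (IsBFSOrdering.first bfs≺ r) (closedWalks k T*)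
    bound T T∈ U card refl = subst (sumOver U (closedWalks k T) ≤_)
      (trans (cong (λ m → sum (take m (map (closedWalks k T*) B.vertices))) card) (sym (sumOver-first r≤n k)))
      (sumOver-≤-first T T∈ k U)

theorem2p3 : ∀ {n : ℕ} (π : Vec ℕ n) → IsTreeDegreeSequence π →
    ∀ (T* : Graph n) (root : Fin n) → IsGreedyTree T* root → T* ∈𝒯 π →
    (∀ (T : Graph n) → T ∈𝒯 π → ∀ (k : ℕ) → C k T ◁w C k T*)
    × (∀ (k : ℕ) (r : Fin n) (_≺_ : Rel (Fin n) 0ℓ) (bfs : IsBFSOrdering T* root _≺_) →
    IsMaximum
    (λ m → ∃ λ (T : Graph n) → T ∈𝒯 π × IsMaxSum (toℕ r) (closedWalks k T) m)
    (sumOver (IsBFSOrdering.first bfs (toℕ r)) (closedWalks k T*)))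
theorem2p3 π _ T* root greedy T*∈ =
  Comparison.majorized π T* root T*∈ (proj₂ bfsOrdering) level-deg-anti ,
  -- The comparison is run with the given ordering in place of the one contained in `greedy`, so the
  -- first vertices are taken in that very ordering.
  λ k r _≺_ bfs → Comparison.maximum π T* root T*∈ bfs level-deg-anti k (<⇒≤ (toℕ<n r))
  where open IsGreedyTree greedy
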